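{- Let $k>2$ be an integer, let $n=p_1p_2\cdots p_k$ where $p_1,\dots,p_k$ are distinct odd primes, and let $\zeta$ be a primitive $n$-th root of unity in $\bar{\mathbb{Q}}$. Let $c$ be a positive rational number such that $f=x^n-c$ is irreducible over $\mathbb{Q}$, let $a=c^{1/n}$ be the positive real root of $f$, and let $\mathbb{Q}_f=\mathbb{Q}(a,\zeta)$ be the splitting field of $f$. Consider the minimal generating set $B_2=\{a\zeta^{n/p_i}\}_{i=1}^k$ for $f$ over $\mathbb{Q}$ and the length $k$ cluster tower $$\mathbb{Q}\subseteq L_1\subseteq L_2\subseteq\dots\subseteq L_k=\mathbb{Q}_f,\qquad L_i=\mathbb{Q}(a\zeta^{n/p_1},a\zeta^{n/p_2},\dots,a\zeta^{n/p_i})\quad(1\le i\le k).$$ Then: (1) $L_i=\mathbb{Q}(a,\zeta^{n/(p_1p_2\cdots p_i)})$ for all $i\geq 2$. (2) The degree sequence of the cluster tower is $$(n,\ n\phi(p_1p_2),\ n\phi(p_1p_2p_3),\ \dots,\ n\phi(p_1p_2\cdots p_{k-1}),\ n\phi(n)).$$ (3) Let $\rho_{\mathbb{Q}}(L_i,a)$ be the number of roots of the minimal polynomial of $a$ over $\mathbb{Q}$ that are contained in $L_i$. Then $\rho_{\mathbb{Q}}(L_i,a)=p_1p_2\cdots p_i$ for $i\geq 2$, and $\rho_{\mathbb{Q}}(L_1,a)=1$.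
   Context: $\phi$ is Euler's totient function. A set $B$ of roots of $f$ is a minimal generating set for $f$ over $\mathbb{Q}$ if $\mathbb{Q}(B)=\mathbb{Q}_f$ and $\mathbb{Q}(A)\neq\mathbb{Q}_f$ for every $A\subsetneq B$. For an ordering $(\beta_1,\dots,\beta_m)$ of a minimal generating set, the chain $\mathbb{Q}\subseteq\mathbb{Q}(\beta_1)\subseteq\mathbb{Q}(\beta_1,\beta_2)\subseteq\dots\subseteq\mathbb{Q}(\beta_1,\dots,\beta_m)=\mathbb{Q}_f$ is a cluster tower associated with it; its length is the number of strict inclusions, and its degree sequence is the ordered sequence of degrees over $\mathbb{Q}$ of the distinct fields in the tower other than $\mathbb{Q}$. -}

module Defs where

open import Level using (Level; _⊔_; suc; 0ℓ)
open import Algebra.Bundles using (CommutativeRing; RawRing; RawSemiring)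
open import Algebra.Apartness.Bundles using (HeytingField; HeytingCommutativeRing)
open import Algebra.Morphism.Structures using (IsRingHomomorphism)
import Algebra.Definitions.RawSemiring as RawSemiringDefs
open import Data.Fin.Base using (Fin)
open import Data.List.Base using (List; []; _∷_; _++_; map; filter; foldr; length; replicate; take; upTo; tabulate)
import Data.List.Membership.Setoid as SetoidMembership
open import Data.List.Relation.Binary.Pointwise.Base using (Pointwise)
open import Data.Nat.Base using (ℕ; zero; _<_; _>_)
open import Data.Nat.ListAction using (product)
import Data.Nat.Base as ℕ
import Data.Nat.Coprimality as ℕ
import Data.Nat.DivMod as ℕ
open import Data.Product.Base using (_×_; ∃-syntax)
open import Data.Rational.Base using (ℚ; 0ℚ)
import Data.Rational.Properties as ℚ
open import Data.Sum.Base using (_⊎_)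
open import Data.Vec.Functional using (Vector)
open import Relation.Binary.Definitions using (Decidable; _Respects_)
open import Relation.Binary.PropositionalEquality using (_≡_)
open import Relation.Nullary using (¬_)
open import Relation.Unary using (Pred; _⊆_; _⊂_; _≐_)

-- m ÷ 0 = 0 is junk; the divisors of interest are products of primes.
infixl 7 _÷_
_÷_ : ℕ → ℕ → ℕ
m ÷ zero      = 0
m ÷ (ℕ.suc d) = m ℕ./ ℕ.suc d

φ : ℕ → ℕ
φ n = length (filter (λ m → ℕ.coprime? m n) (map ℕ.suc (upTo n)))

-- p₁ ⋯ pᵢ
prefixProduct : ∀ {k} → (Fin k → ℕ) → ℕ → ℕ
prefixProduct p i = product (take i (tabulate p))

-- Univariate polynomials as coefficient lists, constant term first; lists
-- that differ only by trailing zeros are identified by _≈ₚ_.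
module Polynomial {c ℓ : Level} (R : CommutativeRing c ℓ) where

  open CommutativeRing R

  Poly : Set c
  Poly = List Carrier

  coeff : Poly → ℕ → Carrier
  coeff []      _         = 0#
  coeff (x ∷ p) zero      = x
  coeff (x ∷ p) (ℕ.suc i) = coeff p i

  infix  4 _≈ₚ_
  infixl 6 _+ₚ_
  infixl 7 _*ₚ_

  _≈ₚ_ : Poly → Poly → Set ℓ
  p ≈ₚ q = ∀ i → coeff p i ≈ coeff q i

  _+ₚ_ : Poly → Poly → Poly
  []      +ₚ q       = q
  (x ∷ p) +ₚ []      = x ∷ p
  (x ∷ p) +ₚ (y ∷ q) = (x + y) ∷ (p +ₚ q)

  _*ₚ_ : Poly → Poly → Poly
  []      *ₚ q = []
  (x ∷ p) *ₚ q = map (x *_) q +ₚ (0# ∷ (p *ₚ q))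

  rawSemiringₚ : RawSemiring c ℓ
  rawSemiringₚ = record
    { Carrier = Poly
    ; _≈_     = _≈ₚ_
    ; _+_     = _+ₚ_
    ; _*_     = _*ₚ_
    ; 0#      = []
    ; 1#      = 1# ∷ []
    }

  open RawSemiringDefs rawSemiringₚ public using (_∣_; Irreducible)

  monicWith : List Carrier → Poly
  monicWith lower = lower ++ (1# ∷ [])

  Monic : Poly → Set (c ⊔ ℓ)
  Monic p = ∃[ lower ] p ≈ₚ monicWith lower

  -- xⁿ - r
  binomial : ℕ → Carrier → Poly
  binomial n r = monicWith (replicate n 0#) +ₚ (- r ∷ [])

  eval : Poly → Carrier → Carrier
  eval p x = foldr (λ coef acc → coef + x * acc) 0# p

module ℚ[x] = Polynomial ℚ.+-*-commutativeRing

-- The algebraic closure of ℚ as a discrete field: apartness is decidable, so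
-- it coincides with _≉_, and every nonzero element is invertible.
record AlgebraicClosureOfℚ (c ℓ₁ ℓ₂ : Level) : Set (suc (c ⊔ ℓ₁ ⊔ ℓ₂)) where
  field
    heytingField : HeytingField c ℓ₁ ℓ₂

  open HeytingField heytingField public
  open HeytingCommutativeRing heytingCommutativeRing public using (commutativeRing)
  open CommutativeRing commutativeRing public using (rawRing)
  open RawRing rawRing public using (rawSemiring)

  module K[x] = Polynomial commutativeRing

  field
    _#?_   : Decidable _#_
    ι      : ℚ → Carrier
    ι-homo : IsRingHomomorphism (CommutativeRing.rawRing ℚ.+-*-commutativeRing) rawRing ι

  IsRoot : ℚ[x].Poly → Carrier → Set ℓ₁
  IsRoot f x = K[x].eval (map ι f) x ≈ 0#

  field
    algebraic           : ∀ x → ∃[ f ] ¬ (f ℚ[x].≈ₚ []) × IsRoot f x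
    algebraicallyClosed : ∀ lower → length lower > 0 →
                          ∃[ x ] K[x].eval (K[x].monicWith lower) x ≈ 0#

module Subfields {c ℓ₁ ℓ₂ : Level} (Q̄ : AlgebraicClosureOfℚ c ℓ₁ ℓ₂) where

  open AlgebraicClosureOfℚ Q̄ public
  open RawSemiringDefs rawSemiring public using (_^_; sum)
  open SetoidMembership setoid public using (_∈_)

  -- The subfield ℚ(S).
  data ℚ⟨_⟩ {s : Level} (S : Pred Carrier s) : Pred Carrier (c ⊔ ℓ₁ ⊔ s) where
    rational  : ∀ q → ℚ⟨ S ⟩ (ι q)
    generator : ∀ {x} → S x → ℚ⟨ S ⟩ x
    add       : ∀ {x y} → ℚ⟨ S ⟩ x → ℚ⟨ S ⟩ y → ℚ⟨ S ⟩ (x + y)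
    neg       : ∀ {x} → ℚ⟨ S ⟩ x → ℚ⟨ S ⟩ (- x)
    mul       : ∀ {x y} → ℚ⟨ S ⟩ x → ℚ⟨ S ⟩ y → ℚ⟨ S ⟩ (x * y)
    inv       : ∀ {x y} → ℚ⟨ S ⟩ x → x * y ≈ 1# → ℚ⟨ S ⟩ y
    resp      : ∀ {x y} → x ≈ y → ℚ⟨ S ⟩ x → ℚ⟨ S ⟩ y

  ℚ⦅_⦆ : List Carrier → Pred Carrier (c ⊔ ℓ₁)
  ℚ⦅ xs ⦆ = ℚ⟨ _∈ xs ⟩

  SplittingField : ℚ[x].Poly → Pred Carrier (c ⊔ ℓ₁)
  SplittingField f = ℚ⟨ IsRoot f ⟩

  -- An identification of Q̄ with the algebraic numbers in ℂ: an ordered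
  -- subfield Real with Q̄ = Real(i).  Such a subfield is real closed, so (Real,
  -- Positive) is isomorphic to the ordered field of real algebraic numbers.
  record RealStructure (r : Level) : Set (c ⊔ ℓ₁ ⊔ suc r) where
    field
      Real            : Pred Carrier r
      Positive        : Pred Carrier r
      real-subfield   : ℚ⟨ Real ⟩ ⊆ Real
      positive⇒real   : Positive ⊆ Real
      positive-resp   : Positive Respects _≈_
      trichotomy      : ∀ {x} → Real x → Positive x ⊎ x ≈ 0# ⊎ Positive (- x)
      0-not-positive  : ¬ Positive 0#
      positive-+      : ∀ {x y} → Positive x → Positive y → Positive (x + y)
      positive-*      : ∀ {x y} → Positive x → Positive y → Positive (x * y)
      i               : Carrier
      i²≈-1           : i * i ≈ - 1#
      real+imaginary  : ∀ z → ∃[ u ] ∃[ v ] Real u × Real v × z ≈ u + v * i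

  IsPrimitiveRootOfUnity : ℕ → Carrier → Set ℓ₁
  IsPrimitiveRootOfUnity n z =
    z ^ n ≈ 1# × (∀ m → 0 < m → m < n → ¬ (z ^ m ≈ 1#))

  linearCombination : ∀ {d} → Vector ℚ d → Vector Carrier d → Carrier
  linearCombination q b = sum (λ j → ι (q j) * b j)

  -- [F : ℚ] = d, by a ℚ-basis with d elements.
  record HasDegree {s : Level} (F : Pred Carrier s) (d : ℕ) : Set (c ⊔ ℓ₁ ⊔ s) where
    field
      basis       : Vector Carrier d
      basis-in    : ∀ j → F (basis j)
      independent : ∀ q → linearCombination q basis ≈ 0# → ∀ j → q j ≡ 0ℚ
      spanning    : ∀ {x} → F x → ∃[ q ] x ≈ linearCombination q basis

  -- A must be closed under _≈_ to count as a subset of B: otherwise removing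
  -- one of several equal representatives would give a "proper" subset.
  IsMinimalGeneratingSet : ℚ[x].Poly → Pred Carrier (c ⊔ ℓ₁) → Set (suc (c ⊔ ℓ₁))
  IsMinimalGeneratingSet f B =
    B ⊆ IsRoot f ×
    ℚ⟨ B ⟩ ≐ SplittingField f ×
    ((A : Pred Carrier (c ⊔ ℓ₁)) → A Respects _≈_ → A ⊂ B →
      ¬ (ℚ⟨ A ⟩ ≐ SplittingField f))

  -- ℚ ⊆ ℚ(β₁) ⊆ ℚ(β₁,β₂) ⊆ ⋯
  clusterTower : List Carrier → List (Pred Carrier (c ⊔ ℓ₁))
  clusterTower βs = map (λ i → ℚ⦅ take i βs ⦆) (upTo (ℕ.suc (length βs)))

  -- StrictSteps F Gs Hs, for a chain F ⊆ G₁ ⊆ G₂ ⊆ ⋯ : the list Hs keeps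
  -- exactly those Gⱼ that are strictly larger than their predecessor.
  data StrictSteps : Pred Carrier (c ⊔ ℓ₁) → (Gs Hs : List (Pred Carrier (c ⊔ ℓ₁))) →
                     Set (suc (c ⊔ ℓ₁)) where
    []     : ∀ {F} → StrictSteps F [] []
    equal  : ∀ {F G Gs Hs} → F ≐ G → StrictSteps G Gs Hs → StrictSteps F (G ∷ Gs) Hs
    strict : ∀ {F G Gs Hs} → F ⊂ G → StrictSteps G Gs Hs → StrictSteps F (G ∷ Gs) (G ∷ Hs)

  HasLength : List Carrier → ℕ → Set (suc (c ⊔ ℓ₁))
  HasLength βs l =
    ∃[ Hs ] StrictSteps ℚ⦅ [] ⦆ (clusterTower βs) Hs × length Hs ≡ l

  HasDegreeSequence : List Carrier → List ℕ → Set (suc (c ⊔ ℓ₁))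
  HasDegreeSequence βs ds =
    ∃[ Hs ] StrictSteps ℚ⦅ [] ⦆ (clusterTower βs) Hs × Pointwise HasDegree Hs ds

  IsMinimalPolynomial : ℚ[x].Poly → Carrier → Set ℓ₁
  IsMinimalPolynomial m x =
    ℚ[x].Monic m × IsRoot m x × (∀ g → IsRoot g x → m ℚ[x].∣ g)

  -- Cardinality up to _≈_.
  record HasCardinality {s : Level} (S : Pred Carrier s) (r : ℕ) : Set (c ⊔ ℓ₁ ⊔ s) where
    field
      element    : Fin r → Carrier
      element-in : ∀ j → S (element j)
      distinct   : ∀ {j l} → element j ≈ element l → j ≡ l
      complete   : ∀ {x} → S x → ∃[ j ] x ≈ element j

  -- ρ_ℚ(F, x) = r
  ρ[_,_]≡_ : Pred Carrier (c ⊔ ℓ₁) → Carrier → ℕ → Set (c ⊔ ℓ₁)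
  ρ[ F , x ]≡ r =
    ∃[ m ] IsMinimalPolynomial m x × HasCardinality (λ y → IsRoot m y × F y) r

{-# OPTIONS --safe #-}

-- A relation between a and ζ can be conjugated: for t prime to n, replacing ζ
-- by ζᵗ and keeping a preserves all rational relations. For ζ alone this is
-- the irreducibility of the cyclotomic polynomial, in Landau's form: if
-- g(ζ) = 0 with g integral, then g(ζ^q) ≡ g(ζ)^q = 0 modulo q, which for large
-- primes q forces g(ζ^q) = 0, and every residue class t contains products of
-- large primes. To include a, one shows that 1, a, …, aⁿ⁻¹ are independent over
-- ℚ(ζ). Otherwise the minimal polynomial of a over ℚ(ζ) divides xⁿ − c and has
-- constant term ±aᵈζˢ with 0 < d < n, so that aᵈ lies in ℚ(ζ). As ℚ(ζ) is
-- abelian, the conjugates of the real number aᵈ are real; they differ from aᵈ by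
-- n-th roots of unity, and n is odd, so they all equal aᵈ. Hence aᵈ is
-- rational, against the irreducibility of xⁿ − c.
--
-- Consequently adjoining ζ^{n/p} to ℚ(a, ζ^{n/m}) with mp ∣ n has degree p − 1,
-- since a relation of degree p − 2 would have the p − 1 conjugates of ζ^{n/p} as
-- roots, and the degrees multiply to n φ(p₁⋯pᵢ). Finally Lᵢ contains a for
-- i ≥ 2 because aζ^{n/p₁} and aζ^{n/p₂} have a quotient whose p₂-th power
-- generates ℚ(ζ^{n/p₁}), whereas L₁ is isomorphic to the real field ℚ(a), in
-- which xⁿ − c has only one root.
module Submission where

open import Defs
open import Level using (Level; _⊔_)
open import Algebra.Bundles using (CommutativeRing)
import Algebra.Construct.DirectProduct as DirectProduct
open import Algebra.Morphism.Structures using (IsRingHomomorphism)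
import Algebra.Properties.AbelianGroup
import Algebra.Properties.CommutativeSemiring.Binomial
import Algebra.Properties.CommutativeSemiring.Exp
import Algebra.Properties.Ring
import Algebra.Properties.Semiring.Exp
import Algebra.Properties.Semiring.Mult
import Algebra.Properties.Semiring.Mult.TCOptimised
import Algebra.Properties.Semiring.Sum
import Algebra.Solver.Ring
open import Algebra.Solver.Ring.AlmostCommutativeRing
  using (fromCommutativeRing; _-Raw-AlmostCommutative⟶_)
open import Data.Bool.Base using (if_then_else_)
open import Data.Fin.Base as Fin using (Fin; zero; suc; toℕ; fromℕ; inject₁)
import Data.Fin.Properties as Fin
open import Data.Fin.Relation.Unary.Top as Fin using (‵fromℕ; ‵inject₁)
open import Data.Integer.Base as ℤ using (ℤ; +_; -[1+_]; _⊖_; 0ℤ; 1ℤ)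
import Data.Integer.Properties as ℤ
open import Data.Integer.Tactic.RingSolver using () renaming (solve-∀ to ℤ-solve-∀)
open import Data.List.Base as List using (List; []; _∷_)
import Data.List.Membership.Propositional.Properties as ∈
import Data.List.Properties as List
open import Data.List.Relation.Binary.Pointwise.Base using (Pointwise; []; _∷_)
open import Data.List.Relation.Unary.All as All using (All; []; _∷_)
import Data.List.Relation.Unary.All.Properties as All
open import Data.List.Relation.Unary.AllPairs using ([]; _∷_)
open import Data.List.Relation.Unary.Any using (here; there)
open import Data.List.Relation.Unary.Unique.Propositional using (Unique)
import Data.List.Relation.Unary.Unique.Propositional.Properties as Unique
open import Data.Maybe.Base using (map)
open import Data.Nat.Base as ℕ using (ℕ; zero; suc)
open import Data.Nat.Combinatorics using (_C_; nCn≡1; nCk≡n!/k![n-k]!; k![n∸k]!∣n!)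
import Data.Nat.Coprimality as ℕ
import Data.Nat.Divisibility as ℕ
import Data.Nat.DivMod as ℕ
open import Data.Nat.GCD
  using (gcd; gcd-GCD; gcd[m,n]∣m; gcd[m,n]∣n; gcd[m,n]≢0; module Bézout)
import Data.Nat.Induction as ℕ
open import Data.Nat.ListAction using (product)
open import Data.Nat.Primality
  using (Prime; prime?; ¬prime[0]; ¬prime[1]; prime[2]; euclidsLemma; prime⇒nonZero; prime⇒irreducible)
open import Data.Nat.Primality.Factorisation
  using (PrimeFactorisation; factorise; factorisationHasAllPrimeFactors)
import Data.Nat.Properties as ℕ
open import Data.Nat.Tactic.RingSolver using () renaming (solve-∀ to ℕ-solve-∀)
open import Data.Product.Base using (_×_; _,_; proj₁; proj₂; ∃-syntax)
open import Data.Rational.Base as ℚ using (ℚ; 0ℚ; 1ℚ)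
import Data.Rational.Properties as ℚ
import Data.Rational.Unnormalised.Base as ℚᵘ
import Data.Rational.Unnormalised.Properties as ℚᵘ
open import Data.Sum.Base using (_⊎_; inj₁; inj₂)
import Data.Vec.Functional as Vector
open import Function.Base using (_∘_; id)
open import Function.Definitions using (Injective)
open import Relation.Binary.Definitions using (_Respects_; tri<; tri≈; tri>)
import Relation.Binary.PropositionalEquality as ≡
open ≡ using (_≡_)
import Relation.Binary.Reasoning.Setoid
open import Relation.Nullary using (¬_; Dec; yes; no; does; contradiction)
open import Relation.Nullary.Decidable using (dec⇒maybe; dec-true; dec-false)
open import Relation.Unary using (Pred; _⊆_; _⊂_; _≐_; _∪_; ∅)

-- No automorphism or Galois group is constructed. A homomorphism between subfields is represented
-- by the subring of `Q̄ × Q̄` generated by pairs of corresponding generators; the work lies in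
-- showing that such a graph is `Functional`, and identities are transported by induction on how a
-- pair was generated. Equality in `Q̄` is decidable but membership in a subfield is not, so a field
-- enters through explicit coefficient vectors, and a polynomial of least degree is reached by
-- well-founded induction on the degree. Since n is squarefree, each step treats one prime p with n
-- = Np and N prime to p, through the relation 1 + x + ⋯ + x^(p-1) alone: the exponents t ≡ 1 modulo
-- N fix the lower field and move ζ^N to each of its p - 1 nontrivial powers. The same step, run
-- downwards, serves as Galois descent from ℚ(ζ) to ℚ. Landau's contradiction rests on no prime
-- being a unit of ℤ[ζ]. In place of norms and integral closure, this comes from an integral linear
-- system whose matrix is the identity modulo q.

open Algebra.Properties.Semiring.Exp (CommutativeRing.semiring ℚ.+-*-commutativeRing) using ()
  renaming (_^_ to _^ℚ_)
open Algebra.Properties.Semiring.Mult (CommutativeRing.semiring ℚ.+-*-commutativeRing) using ()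
  renaming (_×_ to _·ℚ_)

-- A ring solver with integer coefficients, so that it sees cancellation.
module ℤ-Solver {c ℓ : Level} (R : CommutativeRing c ℓ) where

  open CommutativeRing R
  open Algebra.Properties.Ring ring using (-0#≈0#; -‿distribˡ-*; -‿distribʳ-*; -‿involutive)
  open Algebra.Properties.AbelianGroup +-abelianGroup using (⁻¹-∙-comm; xyx⁻¹≈y)
  open Algebra.Properties.Semiring.Mult.TCOptimised semiring using (1+×; ×-homo-+; ×1-homo-*) renaming (_×_ to _·_)
  open Relation.Binary.Reasoning.Setoid setoid

  ⟦_⟧ℤ : ℤ → Carrier
  ⟦ + n ⟧ℤ     = n · 1#
  ⟦ -[1+ n ] ⟧ℤ = - (suc n · 1#)

  ⊖-homo : ∀ m n → ⟦ m ⊖ n ⟧ℤ ≈ m · 1# - n · 1#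
  ⊖-homo zero    zero    = sym (-‿inverseʳ 0#)
  ⊖-homo (suc m) zero    = sym (trans (+-congˡ -0#≈0#) (+-identityʳ _))
  ⊖-homo zero    (suc n) = sym (+-identityˡ _)
  ⊖-homo (suc m) (suc n) = begin
    ⟦ suc m ⊖ suc n ⟧ℤ                    ≡⟨ ≡.cong ⟦_⟧ℤ (ℤ.[1+m]⊖[1+n]≡m⊖n m n) ⟩
    ⟦ m ⊖ n ⟧ℤ                            ≈⟨ ⊖-homo m n ⟩
    m · 1# - n · 1#                       ≈⟨ +-congʳ (xyx⁻¹≈y 1# (m · 1#)) ⟨
    1# + m · 1# - 1# - n · 1#             ≈⟨ +-assoc _ _ _ ⟩
    1# + m · 1# + (- 1# - n · 1#)         ≈⟨ +-congˡ (⁻¹-∙-comm 1# (n · 1#)) ⟩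
    1# + m · 1# - (1# + n · 1#)           ≈⟨ +-cong (1+× m 1#) (-‿cong (1+× n 1#)) ⟨
    suc m · 1# - suc n · 1#               ∎

  ℤ-+-homo : ∀ i j → ⟦ i ℤ.+ j ⟧ℤ ≈ ⟦ i ⟧ℤ + ⟦ j ⟧ℤ
  ℤ-+-homo (+ m)    (+ n)    = ×-homo-+ 1# m n
  ℤ-+-homo (+ m)    -[1+ n ] = ⊖-homo m (suc n)
  ℤ-+-homo -[1+ m ] (+ n)    = trans (⊖-homo n (suc m)) (+-comm _ _)
  ℤ-+-homo -[1+ m ] -[1+ n ] = begin
    - (suc (suc (m ℕ.+ n)) · 1#)      ≡⟨ ≡.cong (λ k → - (suc k · 1#)) (ℕ.+-suc m n) ⟨
    - ((suc m ℕ.+ suc n) · 1#)        ≈⟨ -‿cong (×-homo-+ 1# (suc m) (suc n)) ⟩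
    - (suc m · 1# + suc n · 1#)       ≈⟨ ⁻¹-∙-comm _ _ ⟨
    - (suc m · 1#) + - (suc n · 1#)   ∎

  ℤ-neg-homo : ∀ i → ⟦ ℤ.- i ⟧ℤ ≈ - ⟦ i ⟧ℤ
  ℤ-neg-homo (+ zero)  = sym -0#≈0#
  ℤ-neg-homo (+ suc n) = refl
  ℤ-neg-homo -[1+ n ]  = sym (-‿involutive _)

  ℤ-*-homo : ∀ i j → ⟦ i ℤ.* j ⟧ℤ ≈ ⟦ i ⟧ℤ * ⟦ j ⟧ℤ
  ℤ-*-homo (+ m)    (+ n)    = trans (reflexive (≡.cong ⟦_⟧ℤ (≡.sym (ℤ.pos-* m n)))) (×1-homo-* m n)
  ℤ-*-homo (+ m)    -[1+ n ] = begin
    ⟦ + m ℤ.* -[1+ n ] ⟧ℤ        ≡⟨ ≡.cong ⟦_⟧ℤ (ℤ.neg-distribʳ-* (+ m) (+ suc n)) ⟨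
    ⟦ ℤ.- (+ m ℤ.* + suc n) ⟧ℤ   ≈⟨ ℤ-neg-homo (+ m ℤ.* + suc n) ⟩
    - ⟦ + m ℤ.* + suc n ⟧ℤ       ≈⟨ -‿cong (ℤ-*-homo (+ m) (+ suc n)) ⟩
    - (m · 1# * (suc n · 1#))    ≈⟨ -‿distribʳ-* _ _ ⟩
    m · 1# * - (suc n · 1#)      ∎
  ℤ-*-homo -[1+ m ] (+ n)    = begin
    ⟦ -[1+ m ] ℤ.* + n ⟧ℤ        ≡⟨ ≡.cong ⟦_⟧ℤ (ℤ.neg-distribˡ-* (+ suc m) (+ n)) ⟨
    ⟦ ℤ.- (+ suc m ℤ.* + n) ⟧ℤ   ≈⟨ ℤ-neg-homo (+ suc m ℤ.* + n) ⟩
    - ⟦ + suc m ℤ.* + n ⟧ℤ       ≈⟨ -‿cong (ℤ-*-homo (+ suc m) (+ n)) ⟩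
    - (suc m · 1# * (n · 1#))    ≈⟨ -‿distribˡ-* _ _ ⟩
    - (suc m · 1#) * (n · 1#)    ∎
  ℤ-*-homo -[1+ m ] -[1+ n ] = begin
    (suc m ℕ.* suc n) · 1#                  ≈⟨ ×1-homo-* (suc m) (suc n) ⟩
    suc m · 1# * (suc n · 1#)               ≈⟨ -‿involutive _ ⟨
    - - (suc m · 1# * (suc n · 1#))         ≈⟨ -‿cong (-‿distribʳ-* _ _) ⟩
    - (suc m · 1# * - (suc n · 1#))         ≈⟨ -‿distribˡ-* _ _ ⟩
    - (suc m · 1#) * - (suc n · 1#)         ∎

  ℤ-homomorphism : CommutativeRing.rawRing ℤ.+-*-commutativeRing
                   -Raw-AlmostCommutative⟶ fromCommutativeRing R
  ℤ-homomorphism = record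
    { ⟦_⟧    = ⟦_⟧ℤ
    ; +-homo = ℤ-+-homo
    ; *-homo = ℤ-*-homo
    ; -‿homo = ℤ-neg-homo
    ; 0-homo = refl
    ; 1-homo = refl
    }

  open Algebra.Solver.Ring (CommutativeRing.rawRing ℤ.+-*-commutativeRing) (fromCommutativeRing R)
    ℤ-homomorphism (λ i j → map (reflexive ∘ ≡.cong ⟦_⟧ℤ) (dec⇒maybe (i ℤ.≟ j))) public
    using (solve; _:=_; _:+_; _:*_; _:-_; :-_; con)

-- Horner evaluation, subrings, and reduction modulo a monic polynomial.

module Horner {c ℓ : Level} (R : CommutativeRing c ℓ) where

  open CommutativeRing R hiding (zero)
  open Algebra.Properties.Semiring.Exp semiring using (_^_; ^-homo-*; ^-congˡ; ^-assocʳ) public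
  open Algebra.Properties.Semiring.Sum semiring using (sum; sum-cong-≋; *-distribˡ-sum)
  open Relation.Binary.Reasoning.Setoid setoid
  open ℤ-Solver R

  -- horner b c x = c₀ + c₁ x + ⋯ + c_{d-1} x^{d-1} + b x^d; the leading
  -- coefficient b is 0 for arbitrary and 1 for monic polynomials.
  horner : ∀ {d} → Carrier → (Fin d → Carrier) → Carrier → Carrier
  horner {zero}  b c x = b
  horner {suc d} b c x = c zero + x * horner b (c ∘ suc) x

  horner-cong : ∀ {d b b′} {c c′ : Fin d → Carrier} {x x′} →
                b ≈ b′ → (∀ j → c j ≈ c′ j) → x ≈ x′ → horner b c x ≈ horner b′ c′ x′
  horner-cong {zero}  b≈ c≈ x≈ = b≈
  horner-cong {suc d} b≈ c≈ x≈ = +-cong (c≈ zero) (*-cong x≈ (horner-cong b≈ (c≈ ∘ suc) x≈))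

  horner-+ : ∀ {d} b b′ (c c′ : Fin d → Carrier) x →
             horner (b + b′) (λ j → c j + c′ j) x ≈ horner b c x + horner b′ c′ x
  horner-+ {zero}  b b′ c c′ x = refl
  horner-+ {suc d} b b′ c c′ x = trans
    (+-congˡ (*-congˡ (horner-+ b b′ (c ∘ suc) (c′ ∘ suc) x)))
    (solve 5 (λ c c′ x h h′ → c :+ c′ :+ x :* (h :+ h′) := c :+ x :* h :+ (c′ :+ x :* h′)) refl
      (c zero) (c′ zero) x (horner b (c ∘ suc) x) (horner b′ (c′ ∘ suc) x))

  horner-* : ∀ {d} t b (c : Fin d → Carrier) x →
             horner (t * b) (λ j → t * c j) x ≈ t * horner b c x
  horner-* {zero}  t b c x = refl
  horner-* {suc d} t b c x = trans
    (+-congˡ (*-congˡ (horner-* t b (c ∘ suc) x)))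
    (solve 4 (λ t c x h → t :* c :+ x :* (t :* h) := t :* (c :+ x :* h)) refl
      t (c zero) x (horner b (c ∘ suc) x))

  horner₀-+ : ∀ {d} (c c′ : Fin d → Carrier) x →
              horner 0# (λ j → c j + c′ j) x ≈ horner 0# c x + horner 0# c′ x
  horner₀-+ c c′ x =
    trans (horner-cong {c = λ j → c j + c′ j} (sym (+-identityʳ 0#)) (λ _ → refl) refl)
          (horner-+ 0# 0# c c′ x)

  horner₀-* : ∀ {d} t (c : Fin d → Carrier) x →
              horner 0# (λ j → t * c j) x ≈ t * horner 0# c x
  horner₀-* t c x =
    trans (horner-cong {c = λ j → t * c j} (sym (zeroʳ t)) (λ _ → refl) refl)
          (horner-* t 0# c x)

  horner-leading : ∀ {d} b (c : Fin d → Carrier) x →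
                   horner b c x ≈ horner 0# c x + b * x ^ d
  horner-leading {zero}  b c x = solve 1 (λ b → b := con 0ℤ :+ b :* con 1ℤ) refl b
  horner-leading {suc d} b c x = trans
    (+-congˡ (*-congˡ (horner-leading b (c ∘ suc) x)))
    (solve 5 (λ c x h b p → c :+ x :* (h :+ b :* p) := c :+ x :* h :+ b :* (x :* p)) refl
      (c zero) x (horner 0# (c ∘ suc) x) b (x ^ d))

  horner-zero : ∀ {d} {c : Fin d → Carrier} → (∀ j → c j ≈ 0#) → ∀ x → horner 0# c x ≈ 0#
  horner-zero {zero}  c≈0 x = refl
  horner-zero {suc d} c≈0 x =
    trans (+-cong (c≈0 zero) (trans (*-congˡ (horner-zero (c≈0 ∘ suc) x)) (zeroʳ x))) (+-identityʳ 0#)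

  horner-snoc : ∀ {d} (c : Fin (suc d) → Carrier) x →
                horner 0# c x ≈ horner (c (fromℕ d)) (c ∘ inject₁) x
  horner-snoc {zero}  c x = trans (+-congˡ (zeroʳ x)) (+-identityʳ (c zero))
  horner-snoc {suc d} c x = +-congˡ (*-congˡ (horner-snoc (c ∘ suc) x))

  horner-sum : ∀ {d} (c : Fin d → Carrier) x → horner 0# c x ≈ sum (λ j → c j * x ^ toℕ j)
  horner-sum {zero}  c x = refl
  horner-sum {suc d} c x = +-cong (sym (*-identityʳ _)) (begin
    x * horner 0# (c ∘ suc) x                     ≈⟨ *-congˡ (horner-sum (c ∘ suc) x) ⟩
    x * sum (λ j → c (suc j) * x ^ toℕ j)         ≈⟨ *-distribˡ-sum x (λ j → c (suc j) * x ^ toℕ j) ⟩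
    sum (λ j → x * (c (suc j) * x ^ toℕ j)) ≈⟨ sum-cong-≋ (λ j → solve 3 (λ x c p → x :* (c :* p) := c :* (x :* p)) refl x (c (suc j)) (x ^ toℕ j)) ⟩
    sum (λ j → c (suc j) * (x * x ^ toℕ j))       ∎)

  shift : ∀ {d} → (Fin d → Carrier) → Fin d → Carrier
  shift c zero    = 0#
  shift c (suc j) = c (inject₁ j)

  horner-shift : ∀ {d} (c : Fin (suc d) → Carrier) x →
                 x * horner 0# c x ≈ horner (c (fromℕ d)) (shift c) x
  horner-shift c x = trans (*-congˡ (horner-snoc c x)) (sym (+-identityˡ _))

  -- Ruffini's synthetic division by x - y. The leading coefficient b is inherited, so a monic
  -- polynomial has a monic quotient.
  quotient : ∀ {d} → Carrier → (Fin (suc d) → Carrier) → Carrier → Fin d → Carrier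
  quotient b c y zero    = horner b (c ∘ suc) y
  quotient b c y (suc j) = quotient b (c ∘ suc) y j

  horner-quotient : ∀ {d} b (c : Fin (suc d) → Carrier) x y →
                    horner b c x ≈ horner b c y + (x - y) * horner b (quotient b c y) x
  horner-quotient {zero}  b c x y =
    solve 4 (λ c x y b → c :+ x :* b := c :+ y :* b :+ (x :- y) :* b) refl (c zero) x y b
  horner-quotient {suc d} b c x y = trans
    (+-congˡ (*-congˡ (horner-quotient b (c ∘ suc) x y)))
    (solve 5 (λ c x y h q → c :+ x :* (h :+ (x :- y) :* q) := c :+ y :* h :+ (x :- y) :* (h :+ x :* q)) refl
      (c zero) x y (horner b (c ∘ suc) y) (horner b (quotient b (c ∘ suc) y) x))

  -- Generation by ring operations only, so that maps out of it have no inverses to respect. Over ℚ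
  -- nothing is lost, by `inverse-in`.
  data ⟪_⟫ {s : Level} (S : Pred Carrier s) : Pred Carrier (c ⊔ ℓ ⊔ s) where
    gen  : ∀ {x} → S x → ⟪ S ⟫ x
    one  : ⟪ S ⟫ 1#
    add  : ∀ {x y} → ⟪ S ⟫ x → ⟪ S ⟫ y → ⟪ S ⟫ (x + y)
    neg  : ∀ {x} → ⟪ S ⟫ x → ⟪ S ⟫ (- x)
    mul  : ∀ {x y} → ⟪ S ⟫ x → ⟪ S ⟫ y → ⟪ S ⟫ (x * y)
    resp : ∀ {x y} → x ≈ y → ⟪ S ⟫ x → ⟪ S ⟫ y

  record IsSubring {p : Level} (C : Pred Carrier p) : Set (c ⊔ ℓ ⊔ p) where
    field
      one-in   : C 1#
      add-in   : ∀ {x y} → C x → C y → C (x + y)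
      neg-in   : ∀ {x} → C x → C (- x)
      mul-in   : ∀ {x y} → C x → C y → C (x * y)
      resp-in  : ∀ {x y} → x ≈ y → C x → C y

    zero-in : C 0#
    zero-in = resp-in (-‿inverseʳ 1#) (add-in one-in (neg-in one-in))

    sub-in : ∀ {x y} → C x → C y → C (x - y)
    sub-in x y = add-in x (neg-in y)

    pow-in : ∀ {x} m → C x → C (x ^ m)
    pow-in zero    x = one-in
    pow-in (suc m) x = mul-in x (pow-in m x)

    shift-in : ∀ {d} {r : Fin d → Carrier} → (∀ j → C (r j)) → ∀ j → C (shift r j)
    shift-in r zero    = zero-in
    shift-in r (suc j) = r (inject₁ j)

    horner-in : ∀ {d b x} {r : Fin d → Carrier} → C b → (∀ j → C (r j)) → C x → C (horner b r x)
    horner-in {zero}  b r x = b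
    horner-in {suc d} b r x = add-in (r zero) (mul-in x (horner-in b (r ∘ suc) x))

  ⟪⟫-isSubring : ∀ {s} {S : Pred Carrier s} → IsSubring ⟪ S ⟫
  ⟪⟫-isSubring = record
    { one-in = one ; add-in = add ; neg-in = neg ; mul-in = mul ; resp-in = resp }

  ⟪⟫-least : ∀ {s p} {S : Pred Carrier s} {C : Pred Carrier p} → IsSubring C → S ⊆ C → ⟪ S ⟫ ⊆ C
  ⟪⟫-least isC S⊆C (gen x)    = S⊆C x
  ⟪⟫-least isC S⊆C one        = IsSubring.one-in isC
  ⟪⟫-least isC S⊆C (add x y)  = IsSubring.add-in isC (⟪⟫-least isC S⊆C x) (⟪⟫-least isC S⊆C y)
  ⟪⟫-least isC S⊆C (neg x)    = IsSubring.neg-in isC (⟪⟫-least isC S⊆C x)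
  ⟪⟫-least isC S⊆C (mul x y)  = IsSubring.mul-in isC (⟪⟫-least isC S⊆C x) (⟪⟫-least isC S⊆C y)
  ⟪⟫-least isC S⊆C (resp e x) = IsSubring.resp-in isC e (⟪⟫-least isC S⊆C x)

  module MonicExtension
    {p : Level} {C : Pred Carrier p} (C-isSubring : IsSubring C)
    {d : ℕ} (l : Fin (suc d) → Carrier) (l∈C : ∀ j → C (l j))
    (x : Carrier) (x-root : horner 1# l x ≈ 0#)
    where

    open IsSubring C-isSubring

    Reduced : Pred Carrier (c ⊔ ℓ ⊔ p)
    Reduced y = ∃[ r ] (∀ (j : Fin (suc d)) → C (r j)) × y ≈ horner 0# r x

    constants : ∀ {y} → C y → Reduced y
    constants {y} y∈C = r , r∈C , sym (trans
        (+-congˡ (trans (*-congˡ (horner-zero {c = r ∘ suc} (λ _ → refl) x)) (zeroʳ x)))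
        (+-identityʳ y))
      where
      r : Fin (suc d) → Carrier
      r zero    = y
      r (suc j) = 0#
      r∈C : ∀ j → C (r j)
      r∈C zero    = y∈C
      r∈C (suc j) = zero-in

    sums : ∀ {y z} → Reduced y → Reduced z → Reduced (y + z)
    sums (r , r∈C , y≈) (r′ , r′∈C , z≈) =
      (λ j → r j + r′ j) , (λ j → add-in (r∈C j) (r′∈C j)) ,
      trans (+-cong y≈ z≈) (sym (horner₀-+ r r′ x))

    scalars : ∀ {t y} → C t → Reduced y → Reduced (t * y)
    scalars {t} t∈C (r , r∈C , y≈) =
      (λ j → t * r j) , (λ j → mul-in t∈C (r∈C j)) , trans (*-congˡ y≈) (sym (horner₀-* t r x))

    resps : ∀ {y z} → y ≈ z → Reduced y → Reduced z
    resps y≈z (r , r∈C , y≈) = r , r∈C , trans (sym y≈z) y≈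

    -- Multiplication by x raises the top coefficient t to the power x^(d+1), and this overflow is
    -- cancelled by subtracting t times the monic relation for x.
    multiples : ∀ {y} → Reduced y → Reduced (x * y)
    multiples (r , r∈C , y≈) =
      r′ ,
      (λ j → add-in (shift-in r∈C j) (mul-in (neg-in (r∈C (fromℕ d))) (l∈C j))) , (begin
        _                                                    ≈⟨ *-congˡ y≈ ⟩
        x * horner 0# r x                                    ≈⟨ horner-shift r x ⟩
        horner t (shift r) x                                 ≈⟨ +-identityʳ _ ⟨
        horner t (shift r) x + 0# ≈⟨ +-congˡ (trans (*-congˡ x-root) (zeroʳ (- t))) ⟨
        horner t (shift r) x + - t * horner 1# l x           ≈⟨ +-congˡ (horner-* (- t) 1# l x) ⟨
        horner t (shift r) x + horner (- t * 1#) -tl x       ≈⟨ horner-+ t (- t * 1#) (shift r) -tl x ⟨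
        horner (t + - t * 1#) r′ x ≈⟨ horner-cong {c = r′} t-t≈0 (λ _ → refl) refl ⟩
        horner 0# r′ x                                       ∎)
      where
      t     = r (fromℕ d)
      -tl r′ : Fin (suc d) → Carrier
      -tl j = - t * l j
      r′ j  = shift r j + -tl j
      t-t≈0 : t + - t * 1# ≈ 0#
      t-t≈0 = solve 1 (λ t → t :+ :- t :* con 1ℤ := con 0ℤ) refl t

    -- The reduced elements form a module under C and x, hence under the whole ring C[x]. Applied to
    -- 1 this reduces every element, and no product of two reduced elements is ever computed.
    action : ∀ {y z} → ⟪ C ∪ (_≈ x) ⟫ y → Reduced z → Reduced (y * z)
    action (gen (inj₁ t∈C)) m = scalars t∈C m
    action (gen (inj₂ y≈x)) m = resps (*-congʳ (sym y≈x)) (multiples m)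
    action one              m = resps (sym (*-identityˡ _)) m
    action (add y y′)       m = resps (sym (distribʳ _ _ _)) (sums (action y m) (action y′ m))
    action (neg {y} y∈)     m =
      resps (solve 2 (λ y z → :- con 1ℤ :* (y :* z) := :- y :* z) refl y _)
        (scalars (neg-in one-in) (action y∈ m))
    action (mul y y′)       m = resps (sym (*-assoc _ _ _)) (action y (action y′ m))
    action (resp e y)       m = resps (*-congʳ e) (action y m)

    reduce : ⟪ C ∪ (_≈ x) ⟫ ⊆ Reduced
    reduce y = resps (*-identityʳ _) (action y (constants one-in))

-- Divisibility, binomial coefficients and residue classes.

∣m+n∣n⇒∣m : ∀ {i m n} → i ℕ.∣ m ℕ.+ n → i ℕ.∣ n → i ℕ.∣ m
∣m+n∣n⇒∣m {i} {m} {n} i∣m+n = ℕ.∣m+n∣m⇒∣n (≡.subst (i ℕ.∣_) (ℕ.+-comm m n) i∣m+n)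

prime∣! : ∀ {r} → Prime r → ∀ {A} → r ℕ.≤ A → r ℕ.∣ A ℕ.!
prime∣! {zero}  r-prime r≤A = contradiction r-prime ¬prime[0]
prime∣! {suc r} r-prime r≤A = ℕ.∣-trans (ℕ.m∣m*n (r ℕ.!)) (ℕ.m≤n⇒m!∣n! r≤A)

prime∣!⇒≤ : ∀ {r} → Prime r → ∀ A → r ℕ.∣ A ℕ.! → r ℕ.≤ A
prime∣!⇒≤ r-prime zero    r∣1 = contradiction (≡.subst Prime (ℕ.∣1⇒≡1 r∣1) r-prime) ¬prime[1]
prime∣!⇒≤ r-prime (suc A) r∣  with euclidsLemma (suc A) (A ℕ.!) r-prime r∣
... | inj₁ r∣1+A = ℕ.∣⇒≤ r∣1+A
... | inj₂ r∣A!  = ℕ.m≤n⇒m≤1+n (prime∣!⇒≤ r-prime A r∣A!)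

-- q divides q! = C · k! (q-k)!, while all factors of k! and (q-k)! are smaller than q.
prime∣binomial : ∀ {q} → Prime q → ∀ {k} → 0 ℕ.< k → k ℕ.< q → q ℕ.∣ (q C k)
prime∣binomial {q} q-prime {k} 0<k k<q
  with euclidsLemma (q C k) (k ℕ.! ℕ.* (q ℕ.∸ k) ℕ.!) q-prime (≡.subst (q ℕ.∣_) (≡.sym C*≡q!) q∣q!)
  where
  instance
    _ = k ℕ.!* (q ℕ.∸ k) !≢0
  C*≡q! : (q C k) ℕ.* (k ℕ.! ℕ.* (q ℕ.∸ k) ℕ.!) ≡ q ℕ.!
  C*≡q! = ≡.trans (≡.cong (ℕ._* (k ℕ.! ℕ.* (q ℕ.∸ k) ℕ.!)) (nCk≡n!/k![n-k]! (ℕ.<⇒≤ k<q)))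
                   (ℕ.m/n*n≡m (k![n∸k]!∣n! (ℕ.<⇒≤ k<q)))
  q∣q! : q ℕ.∣ q ℕ.!
  q∣q! = prime∣! q-prime ℕ.≤-refl
... | inj₁ q∣C = q∣C
... | inj₂ q∣  with euclidsLemma (k ℕ.!) ((q ℕ.∸ k) ℕ.!) q-prime q∣
...   | inj₁ q∣k!     = contradiction (prime∣!⇒≤ q-prime k q∣k!) (ℕ.<⇒≱ k<q)
...   | inj₂ q∣[q-k]! = contradiction (prime∣!⇒≤ q-prime (q ℕ.∸ k) q∣[q-k]!)
                          (ℕ.<⇒≱ (ℕ.∸-monoʳ-< 0<k (ℕ.<⇒≤ k<q)))

-- An elementary substitute for Dirichlet's theorem: the class of t gets a representative without
-- small prime factors instead of a prime. If the prime A + 1 divides t + jn, adding A! n changes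
-- nothing modulo the primes up to A, and it removes the divisibility by A + 1, which divides
-- neither A! nor n.
avoid-small-primes : ∀ t n → ℕ.Coprime t n → ∀ A → ∃[ j ] ∀ {r} → Prime r → r ℕ.≤ A → ¬ r ℕ.∣ t ℕ.+ j ℕ.* n
avoid-small-primes t n t⊥n zero    = 0 , λ { r-prime ℕ.z≤n _ → ¬prime[0] r-prime }
avoid-small-primes t n t⊥n (suc A) with avoid-small-primes t n t⊥n A
... | j , small with prime? (suc A) | suc A ℕ.∣? t ℕ.+ j ℕ.* n
...   | no ¬prime | _ = j , λ r-prime r≤1+A → λ r∣ → small r-prime
          (ℕ.s≤s⁻¹ (ℕ.≤∧≢⇒< r≤1+A λ r≡1+A → ¬prime (≡.subst Prime r≡1+A r-prime))) r∣
...   | yes _ | no 1+A∤ = j , λ r-prime r≤1+A r∣ → small r-prime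
          (ℕ.s≤s⁻¹ (ℕ.≤∧≢⇒< r≤1+A λ r≡1+A → 1+A∤ (≡.subst (ℕ._∣ _) r≡1+A r∣))) r∣
...   | yes 1+A-prime | yes 1+A∣ = j ℕ.+ A ℕ.! , λ {r} → large {r}
  where
  expand : t ℕ.+ (j ℕ.+ A ℕ.!) ℕ.* n ≡ t ℕ.+ j ℕ.* n ℕ.+ A ℕ.! ℕ.* n
  expand = ≡.trans (≡.cong (t ℕ.+_) (ℕ.*-distribʳ-+ n j (A ℕ.!))) (≡.sym (ℕ.+-assoc t (j ℕ.* n) (A ℕ.! ℕ.* n)))
  large : ∀ {r} → Prime r → r ℕ.≤ suc A → ¬ r ℕ.∣ t ℕ.+ (j ℕ.+ A ℕ.!) ℕ.* n
  large {r} r-prime r≤1+A r∣ with ℕ.m≤n⇒m<n∨m≡n r≤1+A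
  ... | inj₁ r<1+A = small r-prime r≤A
          (∣m+n∣n⇒∣m (≡.subst (r ℕ.∣_) expand r∣) (ℕ.∣m⇒∣m*n n (prime∣! r-prime r≤A)))
    where r≤A = ℕ.s≤s⁻¹ r<1+A
  ... | inj₂ ≡.refl with euclidsLemma (A ℕ.!) n r-prime (ℕ.∣m+n∣m⇒∣n (≡.subst (r ℕ.∣_) expand r∣) 1+A∣)
  ...   | inj₁ r∣A! = ℕ.<⇒≱ (ℕ.n<1+n A) (prime∣!⇒≤ r-prime A r∣A!)
  ...   | inj₂ r∣n  = ¬prime[1] (≡.subst Prime (t⊥n (∣m+n∣n⇒∣m 1+A∣ (ℕ.∣n⇒∣m*n j r∣n) , r∣n)) r-prime)

prime>2⇒odd : ∀ {q} → Prime q → 2 ℕ.< q → ¬ 2 ℕ.∣ q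
prime>2⇒odd q-prime 2<q 2∣q with prime⇒irreducible q-prime 2∣q
... | inj₂ ≡.refl = ℕ.<-irrefl ≡.refl 2<q

coprime-* : ∀ {t m p} → ℕ.Coprime t m → ℕ.Coprime t p → ℕ.Coprime t (m ℕ.* p)
coprime-* {t} {m} t⊥m t⊥p {d} (d∣t , d∣mp) = t⊥p (d∣t , ℕ.coprime-divisor d⊥m d∣mp)
  where
  d⊥m : ℕ.Coprime d m
  d⊥m (e∣d , e∣m) = t⊥m (ℕ.∣-trans e∣d d∣t , e∣m)

1+m*k⊥m : ∀ m k → ℕ.Coprime (1 ℕ.+ m ℕ.* k) m
1+m*k⊥m m k (d∣t , d∣m) = ℕ.∣1⇒≡1 (∣m+n∣n⇒∣m d∣t (ℕ.∣m⇒∣m*n k d∣m))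

prime-coprime : ∀ {p w} → Prime p → ¬ p ℕ.∣ w → ℕ.Coprime w p
prime-coprime p-prime p∤w (d∣w , d∣p) with prime⇒irreducible p-prime d∣p
... | inj₁ d≡1    = d≡1
... | inj₂ ≡.refl = contradiction d∣w p∤w

-- Stated as a splitting n = Np with N prime to p, the form in which each step of the tower consumes
-- it.
Squarefree : ℕ → Set
Squarefree n = ∀ {p N} → Prime p → N ℕ.* p ≡ n → ℕ.Coprime N p

-- By the Chinese remainder theorem: t ≡ 1 mod m and t ≡ 1 + w mod p.
conjugating-exponent : ∀ {m p} → ℕ.Coprime m p → Prime p → ∀ w → suc w ℕ.< p →
  ∃[ t ] ℕ.Coprime t (m ℕ.* p) × (∃[ k ] t ≡ 1 ℕ.+ m ℕ.* k) ×
    ∃[ a ] ∃[ b ] t ℕ.+ p ℕ.* a ≡ suc w ℕ.+ p ℕ.* b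
conjugating-exponent {m} {p} m⊥p p-prime w 1+w<p = t , coprime-* (1+m*k⊥m m (x ℕ.* w)) (prime-coprime p-prime p∤t) , (x ℕ.* w , ≡.refl) , a ℕ.* w , b ℕ.* w , eq
  where
  inverse-mod : ∃[ x ] ∃[ a ] ∃[ b ] m ℕ.* x ℕ.+ p ℕ.* a ≡ 1 ℕ.+ p ℕ.* b
  inverse-mod with ℕ.coprime-Bézout m⊥p
  ... | Bézout.+- x y 1+yp≡xm = x , 0 , y , (begin
    m ℕ.* x ℕ.+ p ℕ.* 0   ≡⟨ ≡.cong₂ ℕ._+_ (ℕ.*-comm m x) (ℕ.*-zeroʳ p) ⟩
    x ℕ.* m ℕ.+ 0         ≡⟨ ℕ.+-identityʳ _ ⟩
    x ℕ.* m               ≡⟨ 1+yp≡xm ⟨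
    1 ℕ.+ y ℕ.* p         ≡⟨ ≡.cong (1 ℕ.+_) (ℕ.*-comm y p) ⟩
    1 ℕ.+ p ℕ.* y         ∎)
    where open ≡.≡-Reasoning
  -- Here mx ≡ -1 modulo p, so the inverse of m is x(p - 1).
  ... | Bézout.-+ x y 1+xm≡yp = x ℕ.* p′ , 1 , y ℕ.* p′ , (begin
    m ℕ.* (x ℕ.* p′) ℕ.+ p ℕ.* 1         ≡⟨ ≡.cong (λ z → m ℕ.* (x ℕ.* p′) ℕ.+ z ℕ.* 1) (≡.sym p≡) ⟩
    m ℕ.* (x ℕ.* p′) ℕ.+ suc p′ ℕ.* 1    ≡⟨ rearrange m x p′ ⟩
    1 ℕ.+ (1 ℕ.+ x ℕ.* m) ℕ.* p′         ≡⟨ ≡.cong (λ z → 1 ℕ.+ z ℕ.* p′) 1+xm≡yp ⟩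
    1 ℕ.+ y ℕ.* p ℕ.* p′                 ≡⟨ ≡.cong (1 ℕ.+_) (rearrange′ y p p′) ⟩
    1 ℕ.+ p ℕ.* (y ℕ.* p′)               ∎)
    where
    open ≡.≡-Reasoning
    p′ = ℕ.pred p
    p≡ : suc p′ ≡ p
    p≡ = ℕ.suc-pred p {{prime⇒nonZero p-prime}}
    rearrange : ∀ m x p′ → m ℕ.* (x ℕ.* p′) ℕ.+ suc p′ ℕ.* 1 ≡ 1 ℕ.+ (1 ℕ.+ x ℕ.* m) ℕ.* p′
    rearrange = ℕ-solve-∀
    rearrange′ : ∀ y p p′ → y ℕ.* p ℕ.* p′ ≡ p ℕ.* (y ℕ.* p′)
    rearrange′ = ℕ-solve-∀
  x = proj₁ inverse-mod
  a = proj₁ (proj₂ inverse-mod)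
  b = proj₁ (proj₂ (proj₂ inverse-mod))
  t = 1 ℕ.+ m ℕ.* (x ℕ.* w)
  eq : t ℕ.+ p ℕ.* (a ℕ.* w) ≡ suc w ℕ.+ p ℕ.* (b ℕ.* w)
  eq = begin
    1 ℕ.+ m ℕ.* (x ℕ.* w) ℕ.+ p ℕ.* (a ℕ.* w)     ≡⟨ rearrange m x w p a ⟩
    1 ℕ.+ (m ℕ.* x ℕ.+ p ℕ.* a) ℕ.* w ≡⟨ ≡.cong (λ z → 1 ℕ.+ z ℕ.* w) (proj₂ (proj₂ (proj₂ inverse-mod))) ⟩
    1 ℕ.+ (1 ℕ.+ p ℕ.* b) ℕ.* w                   ≡⟨ rearrange′ p b w ⟩
    suc w ℕ.+ p ℕ.* (b ℕ.* w)                     ∎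
    where
    open ≡.≡-Reasoning
    rearrange : ∀ m x w p a → 1 ℕ.+ m ℕ.* (x ℕ.* w) ℕ.+ p ℕ.* (a ℕ.* w) ≡ 1 ℕ.+ (m ℕ.* x ℕ.+ p ℕ.* a) ℕ.* w
    rearrange = ℕ-solve-∀
    rearrange′ : ∀ p b w → 1 ℕ.+ (1 ℕ.+ p ℕ.* b) ℕ.* w ≡ suc w ℕ.+ p ℕ.* (b ℕ.* w)
    rearrange′ = ℕ-solve-∀
  p∤t : ¬ p ℕ.∣ t
  p∤t p∣t = ℕ.>⇒∤ 1+w<p (∣m+n∣n⇒∣m {n = p ℕ.* (b ℕ.* w)}
    (≡.subst (p ℕ.∣_) eq (ℕ.∣m∣n⇒∣m+n p∣t (ℕ.m∣m*n (a ℕ.* w)))) (ℕ.m∣m*n (b ℕ.* w)))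

-- Euler's totient function

private
  Σ : (ℕ → ℕ) → ℕ → ℕ → ℕ
  Σ b s zero    = 0
  Σ b s (suc N) = b s ℕ.+ Σ b (suc s) N

  Σ-cong : ∀ {b b′} → (∀ m → b m ≡ b′ m) → ∀ s N → Σ b s N ≡ Σ b′ s N
  Σ-cong e s zero    = ≡.refl
  Σ-cong e s (suc N) = ≡.cong₂ ℕ._+_ (e s) (Σ-cong e (suc s) N)

  Σ-split : ∀ b s M N → Σ b s (M ℕ.+ N) ≡ Σ b s M ℕ.+ Σ b (s ℕ.+ M) N
  Σ-split b s zero    N = ≡.cong (λ z → Σ b z N) (≡.sym (ℕ.+-identityʳ s))
  Σ-split b s (suc M) N = begin
    b s ℕ.+ Σ b (suc s) (M ℕ.+ N)                        ≡⟨ ≡.cong (b s ℕ.+_) (Σ-split b (suc s) M N) ⟩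
    b s ℕ.+ (Σ b (suc s) M ℕ.+ Σ b (suc s ℕ.+ M) N)      ≡⟨ ℕ.+-assoc (b s) _ _ ⟨
    b s ℕ.+ Σ b (suc s) M ℕ.+ Σ b (suc (s ℕ.+ M)) N ≡⟨ ≡.cong (λ z → b s ℕ.+ Σ b (suc s) M ℕ.+ Σ b z N) (ℕ.+-suc s M) ⟨
    b s ℕ.+ Σ b (suc s) M ℕ.+ Σ b (s ℕ.+ suc M) N        ∎
    where open ≡.≡-Reasoning

  Σ-+ : ∀ b b′ s N → Σ (λ m → b m ℕ.+ b′ m) s N ≡ Σ b s N ℕ.+ Σ b′ s N
  Σ-+ b b′ s zero    = ≡.refl
  Σ-+ b b′ s (suc N) = ≡.trans (≡.cong (b s ℕ.+ b′ s ℕ.+_) (Σ-+ b b′ (suc s) N)) (rearrange (b s) (b′ s) _ _)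
    where
    rearrange : ∀ x y z w → x ℕ.+ y ℕ.+ (z ℕ.+ w) ≡ x ℕ.+ z ℕ.+ (y ℕ.+ w)
    rearrange = ℕ-solve-∀

  Σ-zero : ∀ b s N → (∀ j → j ℕ.< N → b (s ℕ.+ j) ≡ 0) → Σ b s N ≡ 0
  Σ-zero b s zero    z = ≡.refl
  Σ-zero b s (suc N) z = ≡.cong₂ ℕ._+_ (≡.trans (≡.cong b (≡.sym (ℕ.+-identityʳ s))) (z 0 (ℕ.s≤s ℕ.z≤n)))
    (Σ-zero b (suc s) N λ j j<N → ≡.trans (≡.cong b (≡.sym (ℕ.+-suc s j))) (z (suc j) (ℕ.s≤s j<N)))

  Σ-shift : ∀ b d → (∀ m → b (m ℕ.+ d) ≡ b m) → ∀ s N → Σ b (s ℕ.+ d) N ≡ Σ b s N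
  Σ-shift b d period s zero    = ≡.refl
  Σ-shift b d period s (suc N) = ≡.cong₂ ℕ._+_ (period s) (Σ-shift b d period (suc s) N)

  Σ-period : ∀ b d → (∀ m → b (m ℕ.+ d) ≡ b m) → ∀ s k → Σ b s (k ℕ.* d) ≡ k ℕ.* Σ b s d
  Σ-period b d period s zero    = ≡.refl
  Σ-period b d period s (suc k) = ≡.trans (Σ-split b s d (k ℕ.* d))
    (≡.cong (Σ b s d ℕ.+_) (≡.trans (Σ-shift b d period s (k ℕ.* d)) (Σ-period b d period s k)))

  -- Starting at 1 + i(p+1) makes the only multiple of p + 1 in each block of p + 1 arguments its
  -- last entry; all others contribute 0.
  Σ-multiples : ∀ b p → (∀ m → ¬ suc p ℕ.∣ m → b m ≡ 0) →
                ∀ i k → Σ b (1 ℕ.+ i ℕ.* suc p) (k ℕ.* suc p) ≡ Σ (λ m → b (m ℕ.* suc p)) (1 ℕ.+ i) k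
  Σ-multiples b p multiples i zero    = ≡.refl
  Σ-multiples b p multiples i (suc k) = begin
    Σ b (1 ℕ.+ i ℕ.* suc p) (suc p ℕ.+ k ℕ.* suc p)
      ≡⟨ Σ-split b (1 ℕ.+ i ℕ.* suc p) (suc p) (k ℕ.* suc p) ⟩
    Σ b (1 ℕ.+ i ℕ.* suc p) (suc p) ℕ.+ Σ b (1 ℕ.+ i ℕ.* suc p ℕ.+ suc p) (k ℕ.* suc p)
      ≡⟨ ≡.cong₂ ℕ._+_ block (≡.cong (λ z → Σ b z (k ℕ.* suc p)) (next i p)) ⟩
    b ((1 ℕ.+ i) ℕ.* suc p) ℕ.+ Σ b (1 ℕ.+ (1 ℕ.+ i) ℕ.* suc p) (k ℕ.* suc p)
      ≡⟨ ≡.cong (b ((1 ℕ.+ i) ℕ.* suc p) ℕ.+_) (Σ-multiples b p multiples (1 ℕ.+ i) k) ⟩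
    b ((1 ℕ.+ i) ℕ.* suc p) ℕ.+ Σ (λ m → b (m ℕ.* suc p)) (2 ℕ.+ i) k
      ∎
    where
    open ≡.≡-Reasoning
    next : ∀ i p → 1 ℕ.+ i ℕ.* suc p ℕ.+ suc p ≡ 1 ℕ.+ (1 ℕ.+ i) ℕ.* suc p
    next = ℕ-solve-∀
    end : ∀ i p → 1 ℕ.+ i ℕ.* suc p ℕ.+ p ≡ (1 ℕ.+ i) ℕ.* suc p
    end = ℕ-solve-∀
    reorder : ∀ i p j → 1 ℕ.+ i ℕ.* suc p ℕ.+ j ≡ suc j ℕ.+ i ℕ.* suc p
    reorder = ℕ-solve-∀
    not-multiple : ∀ j → j ℕ.< p → ¬ suc p ℕ.∣ 1 ℕ.+ i ℕ.* suc p ℕ.+ j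
    not-multiple j j<p p∣ = ℕ.>⇒∤ (ℕ.s≤s j<p)
      (∣m+n∣n⇒∣m {m = suc j} (≡.subst (suc p ℕ.∣_) (reorder i p j) p∣) (ℕ.n∣m*n i))
    block : Σ b (1 ℕ.+ i ℕ.* suc p) (suc p) ≡ b ((1 ℕ.+ i) ℕ.* suc p)
    block = begin
      Σ b (1 ℕ.+ i ℕ.* suc p) (suc p)
        ≡⟨ ≡.cong (Σ b (1 ℕ.+ i ℕ.* suc p)) (ℕ.+-comm 1 p) ⟩
      Σ b (1 ℕ.+ i ℕ.* suc p) (p ℕ.+ 1)
        ≡⟨ Σ-split b (1 ℕ.+ i ℕ.* suc p) p 1 ⟩
      Σ b (1 ℕ.+ i ℕ.* suc p) p ℕ.+ (b (1 ℕ.+ i ℕ.* suc p ℕ.+ p) ℕ.+ 0)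
        ≡⟨ ≡.cong₂ ℕ._+_ (Σ-zero b _ p λ j j<p → multiples _ (not-multiple j j<p)) (ℕ.+-identityʳ _) ⟩
      b (1 ℕ.+ i ℕ.* suc p ℕ.+ p)
        ≡⟨ ≡.cong b (end i p) ⟩
      b ((1 ℕ.+ i) ℕ.* suc p)
        ∎

  χ : ∀ {P : Set} → Dec P → ℕ
  χ P? = if does P? then 1 else 0

  χ-true : ∀ {P : Set} (P? : Dec P) → P → χ P? ≡ 1
  χ-true P? p = ≡.cong (if_then 1 else 0) (dec-true P? p)

  χ-false : ∀ {P : Set} (P? : Dec P) → ¬ P → χ P? ≡ 0
  χ-false P? ¬p = ≡.cong (if_then 1 else 0) (dec-false P? ¬p)

  χ-cong : ∀ {P Q : Set} (P? : Dec P) (Q? : Dec Q) → (P → Q) → (Q → P) → χ P? ≡ χ Q?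
  χ-cong P? (yes q) P→Q Q→P = χ-true P? (Q→P q)
  χ-cong P? (no ¬q) P→Q Q→P = χ-false P? (¬q ∘ P→Q)

  length-filter-Σ : ∀ {P : ℕ → Set} (P? : ∀ m → Dec (P m)) f s N → (∀ j → f j ≡ s ℕ.+ j) →
                    List.length (List.filter P? (List.applyUpTo f N)) ≡ Σ (λ m → χ (P? m)) s N
  length-filter-Σ P? f s zero    f≡ = ≡.refl
  length-filter-Σ P? f s (suc N) f≡ rewrite ≡.trans (f≡ 0) (ℕ.+-identityʳ s)
    with P? s | length-filter-Σ P? (f ∘ suc) (suc s) N (λ j → ≡.trans (f≡ (suc j)) (ℕ.+-suc s j))
  ... | yes _ | ih = ≡.cong suc ih
  ... | no  _ | ih = ih

  χφ : ℕ → ℕ → ℕ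
  χφ d m = χ (ℕ.coprime? m d)

  φ-Σ : ∀ n → φ n ≡ Σ (χφ n) 1 n
  φ-Σ n = ≡.trans (≡.cong (List.length ∘ List.filter (λ m → ℕ.coprime? m n)) (List.map-upTo suc n))
    (length-filter-Σ (λ m → ℕ.coprime? m n) suc 1 n (λ _ → ≡.refl))

-- Among 1, ..., dp there are p φ(d) integers prime to d, by periodicity. Those divisible by p are
-- the mp with m ≤ d prime to d, φ(d) in number, and the others are the integers prime to dp. Adding
-- φ(d) to both sides avoids subtraction.
φ-*-prime : ∀ d {p} → Prime p → ℕ.Coprime d p → φ (d ℕ.* p) ≡ φ d ℕ.* (p ℕ.∸ 1)
φ-*-prime d {zero}  p-prime d⊥p = contradiction p-prime ¬prime[0]
φ-*-prime d {suc q} p-prime d⊥p = ℕ.+-cancelʳ-≡ (φ d) (φ (d ℕ.* p)) (φ d ℕ.* q) (begin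
  φ (d ℕ.* p) ℕ.+ φ d                                     ≡⟨ ≡.cong₂ ℕ._+_ (φ-Σ (d ℕ.* p)) (φ-Σ d) ⟩
  Σ (χφ (d ℕ.* p)) 1 (d ℕ.* p) ℕ.+ Σ (χφ d) 1 d ≡⟨ ≡.cong (Σ (χφ (d ℕ.* p)) 1 (d ℕ.* p) ℕ.+_) multiples ⟨
  Σ (χφ (d ℕ.* p)) 1 (d ℕ.* p) ℕ.+ Σ mult 1 (d ℕ.* p)     ≡⟨ Σ-+ (χφ (d ℕ.* p)) mult 1 (d ℕ.* p) ⟨
  Σ (λ m → χφ (d ℕ.* p) m ℕ.+ mult m) 1 (d ℕ.* p)         ≡⟨ Σ-cong partition 1 (d ℕ.* p) ⟩
  Σ (χφ d) 1 (d ℕ.* p)                                    ≡⟨ ≡.cong (Σ (χφ d) 1) (ℕ.*-comm d p) ⟩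
  Σ (χφ d) 1 (p ℕ.* d)                                    ≡⟨ Σ-period (χφ d) d period 1 p ⟩
  p ℕ.* Σ (χφ d) 1 d                                      ≡⟨ ≡.cong (p ℕ.*_) (φ-Σ d) ⟨
  p ℕ.* φ d                                               ≡⟨ ℕ.*-comm p (φ d) ⟩
  φ d ℕ.* p ≡⟨ ≡.trans (ℕ.*-suc (φ d) q) (ℕ.+-comm (φ d) _) ⟩
  φ d ℕ.* q ℕ.+ φ d                                       ∎)
  where
  open ≡.≡-Reasoning
  p = suc q
  mult : ℕ → ℕ
  mult m = χ (p ℕ.∣? m) ℕ.* χφ d m
  period : ∀ m → χφ d (m ℕ.+ d) ≡ χφ d m
  period m = χ-cong (ℕ.coprime? (m ℕ.+ d) d) (ℕ.coprime? m d)
    (λ m+d⊥d (e∣m , e∣d) → m+d⊥d (ℕ.∣m∣n⇒∣m+n e∣m e∣d , e∣d))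
    (λ m⊥d (e∣m+d , e∣d) → m⊥d (∣m+n∣n⇒∣m e∣m+d e∣d , e∣d))
  partition : ∀ m → χφ (d ℕ.* p) m ℕ.+ mult m ≡ χφ d m
  partition m = by (p ℕ.∣? m)
    where
    by : (p∣?m : Dec (p ℕ.∣ m)) → χφ (d ℕ.* p) m ℕ.+ χ p∣?m ℕ.* χφ d m ≡ χφ d m
    by (yes p∣m) = ≡.cong₂ ℕ._+_
      (χ-false (ℕ.coprime? m (d ℕ.* p)) (λ m⊥dp → ¬prime[1] (≡.subst Prime (m⊥dp (p∣m , ℕ.n∣m*n d)) p-prime)))
      (ℕ.+-identityʳ (χφ d m))
    by (no p∤m)  = ≡.trans (ℕ.+-identityʳ _) (χ-cong (ℕ.coprime? m (d ℕ.* p)) (ℕ.coprime? m d)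
      (λ m⊥dp (e∣m , e∣d) → m⊥dp (e∣m , ℕ.∣m⇒∣m*n p e∣d))
      (λ m⊥d → coprime-* m⊥d (prime-coprime p-prime p∤m)))
  multiples : Σ mult 1 (d ℕ.* p) ≡ Σ (χφ d) 1 d
  multiples = ≡.trans
    (Σ-multiples mult q (λ m p∤m → ≡.cong (ℕ._* χφ d m) (χ-false (p ℕ.∣? m) p∤m)) 0 d)
    (Σ-cong (λ m → ≡.trans (≡.cong (ℕ._* χφ d (m ℕ.* p)) (χ-true (p ℕ.∣? m ℕ.* p) (ℕ.n∣m*n m)))
      (≡.trans (ℕ.+-identityʳ _) (χ-cong (ℕ.coprime? (m ℕ.* p) d) (ℕ.coprime? m d)
        (λ mp⊥d (e∣m , e∣d) → mp⊥d (ℕ.∣m⇒∣m*n p e∣m , e∣d))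
        (λ m⊥d (e∣mp , e∣d) → ℕ.sym (coprime-* (ℕ.sym m⊥d) d⊥p) (e∣mp , e∣d)))))
      1 d)

-- Products of distinct primes

÷-* : ∀ {n d} → d ℕ.∣ n → .{{ℕ.NonZero d}} → (n ÷ d) ℕ.* d ≡ n
÷-* {d = suc d} d∣n = ℕ.m/n*n≡m d∣n

-- If q does not divide the head, q² is prime to it and divides the tail. If q is the head, q still
-- divides the tail, hence occurs there, against uniqueness.
prime²∤product : ∀ ps → Unique ps → All Prime ps → ∀ {q} → Prime q → ¬ q ℕ.* q ℕ.∣ product ps
prime²∤product [] _ _ {q} q-prime q²∣1 = ¬prime[1] (≡.subst Prime (ℕ.∣1⇒≡1 (ℕ.∣-trans (ℕ.m∣m*n q) q²∣1)) q-prime)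
prime²∤product (p ∷ ps) (p∉ps ∷ unique) (p-prime ∷ primes) {q} q-prime q²∣ with q ℕ.∣? p
... | no q∤p = prime²∤product ps unique primes q-prime
        (ℕ.coprime-divisor (ℕ.sym (coprime-* p⊥q p⊥q)) q²∣)
  where
  p⊥q : ℕ.Coprime p q
  p⊥q = prime-coprime q-prime q∤p
... | yes q∣p with prime⇒irreducible p-prime q∣p
...   | inj₁ ≡.refl = ¬prime[1] q-prime
...   | inj₂ ≡.refl = All.lookup p∉ps (factorisationHasAllPrimeFactors q-prime
          (ℕ.*-cancelˡ-∣ q {{prime⇒nonZero q-prime}} q²∣) primes) ≡.refl

module PrefixProducts {k : ℕ} (p : Fin k → ℕ) where

  P : ℕ → ℕ
  P = prefixProduct p

  P-suc : ∀ i → P (suc (toℕ i)) ≡ P (toℕ i) ℕ.* p i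
  P-suc = go p
    where
    go : ∀ {k} (p : Fin k → ℕ) i → prefixProduct p (suc (toℕ i)) ≡ prefixProduct p (toℕ i) ℕ.* p i
    go p zero    = ≡.trans (ℕ.*-identityʳ (p zero)) (≡.sym (ℕ.+-identityʳ (p zero)))
    go p (suc i) = ≡.trans (≡.cong (p zero ℕ.*_) (go (p ∘ suc) i)) (≡.sym (ℕ.*-assoc (p zero) _ _))

  P-all : P k ≡ product (List.tabulate p)
  P-all = ≡.cong product (List.take-all k (List.tabulate p) (ℕ.≤-reflexive (List.length-tabulate p)))

  P∣P : ∀ {i} → i ℕ.≤ k → P i ℕ.∣ P k
  P∣P {i} i≤k = ≡.subst₂ ℕ._∣_ ≡.refl (≡.sym P-all) (prefix i (List.tabulate p))
    where
    prefix : ∀ i xs → product (List.take i xs) ℕ.∣ product xs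
    prefix zero    xs       = ℕ.1∣ _
    prefix (suc i) []       = ℕ.∣-refl
    prefix (suc i) (x ∷ xs) = ℕ.*-monoʳ-∣ x (prefix i xs)

  module _ (p-injective : Injective _≡_ _≡_ p) (p-prime : ∀ j → Prime (p j)) where

    P-nonZero : ∀ {i} → i ℕ.≤ k → ℕ.NonZero (P i)
    P-nonZero {i} i≤k = go i (List.tabulate p) (All.tabulate⁺ p-prime)
      where
      go : ∀ i xs → All Prime xs → ℕ.NonZero (product (List.take i xs))
      go zero    xs       _              = _
      go (suc i) []       _              = _
      go (suc i) (x ∷ xs) (x-prime ∷ rest) = ℕ.m*n≢0 x _ {{prime⇒nonZero x-prime}} {{go i xs rest}}

    P-squarefree : Squarefree (P k)
    P-squarefree {q} {N} q-prime Nq≡n = prime-coprime q-prime λ q∣N →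
      prime²∤product (List.tabulate p) (Unique.tabulate⁺ p-injective) (All.tabulate⁺ p-prime) q-prime
        (≡.subst (q ℕ.* q ℕ.∣_) (≡.trans Nq≡n P-all) (ℕ.*-monoˡ-∣ q q∣N))

-- Arithmetic in the algebraic closure.

module AlgebraicNumbers {κ ℓ₁ ℓ₂ : Level} (Q̄ : AlgebraicClosureOfℚ κ ℓ₁ ℓ₂) where

  open Subfields Q̄ hiding (zero; _-_; sum) public
  open CommutativeRing commutativeRing using (_-_; ring; semiring; +-abelianGroup) public
  open Algebra.Properties.Ring ring using (-0#≈0#; -‿distribˡ-*; -‿distribʳ-*; -‿involutive) public
  open Algebra.Properties.AbelianGroup +-abelianGroup using (⁻¹-injective; x∙y⁻¹≈ε⇒x≈y; x≈y⇒x∙y⁻¹≈ε) public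
  open Algebra.Properties.CommutativeSemiring.Exp
    (CommutativeRing.commutativeSemiring commutativeRing) using (^-distrib-*) public
  open Algebra.Properties.Semiring.Sum semiring
    using (sum; sum-cong-≋; *-distribˡ-sum; *-distribʳ-sum; ∑-distrib-+; ∑-comm) public
  open Algebra.Properties.Semiring.Mult semiring
    using (×-homo-+; ×1-homo-*) renaming (_×_ to _·_) public
  open Horner commutativeRing hiding (_^_; one; add; neg; mul; resp) public
  open ℤ-Solver commutativeRing public
  open Relation.Binary.Reasoning.Setoid setoid
  open IsRingHomomorphism ι-homo using ()
    renaming (+-homo to ι-+; *-homo to ι-*; -‿homo to ι-neg; 0#-homo to ι-0; 1#-homo to ι-1; ⟦⟧-cong to ι-cong) public

  infix 4 _≟_ _≉_
  _≉_ : Carrier → Carrier → Set ℓ₁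
  x ≉ y = ¬ (x ≈ y)

  _≟_ : ∀ x y → Dec (x ≈ y)
  x ≟ y with x #? y
  ... | yes x#y = no λ x≈y → #-irrefl x≈y x#y
  ... | no ¬x#y = yes (proj₁ (tight x y) ¬x#y)

  x-0≈x : ∀ x → x - 0# ≈ x
  x-0≈x = solve 1 (λ x → x :- con 0ℤ := x) refl

  inverse : ∀ {x} → x ≉ 0# → ∃[ y ] x * y ≈ 1#
  inverse {x} x≉0 with x #? 0#
  ... | no ¬x#0 = contradiction (proj₁ (tight x 0#) ¬x#0) x≉0
  ... | yes x#0 with #⇒invertible x#0
  ...   | y , _ , e = y , trans (*-congʳ (sym (x-0≈x x))) e

  1≉0 : 1# ≉ 0#
  1≉0 e = proj₂ (tight 1# 0#) e (invertible⇒# (1# , d , trans (*-comm _ _) d))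
    where
    d : 1# * (1# - 0#) ≈ 1#
    d = solve 0 (con 1ℤ :* (con 1ℤ :- con 0ℤ) := con 1ℤ) refl

  invertible⇒≉0 : ∀ {x y} → x * y ≈ 1# → x ≉ 0#
  invertible⇒≉0 {x} {y} e x≈0 = 1≉0 (trans (sym e) (trans (*-congʳ x≈0) (zeroˡ y)))

  no-zero-divisors : ∀ {x y} → x ≉ 0# → x * y ≈ 0# → y ≈ 0#
  no-zero-divisors {x} {y} x≉0 xy≈0 with inverse x≉0
  ... | z , xz≈1 = begin
    y             ≈⟨ *-identityˡ y ⟨
    1# * y        ≈⟨ *-congʳ xz≈1 ⟨
    x * z * y     ≈⟨ solve 3 (λ x y z → x :* z :* y := z :* (x :* y)) refl x y z ⟩
    z * (x * y)   ≈⟨ *-congˡ xy≈0 ⟩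
    z * 0#        ≈⟨ zeroʳ z ⟩
    0#            ∎

  *-≉0 : ∀ {x y} → x ≉ 0# → y ≉ 0# → x * y ≉ 0#
  *-≉0 x≉0 y≉0 xy≈0 = y≉0 (no-zero-divisors x≉0 xy≈0)

  ^-≉0 : ∀ {x} m → x ≉ 0# → x ^ m ≉ 0#
  ^-≉0 zero    x≉0 = 1≉0
  ^-≉0 (suc m) x≉0 = *-≉0 x≉0 (^-≉0 m x≉0)

  x≈y⇒x-y≈0 : ∀ {x y} → x ≈ y → x - y ≈ 0#
  x≈y⇒x-y≈0 = x≈y⇒x∙y⁻¹≈ε

  x-y≈0⇒x≈y : ∀ {x y} → x - y ≈ 0# → x ≈ y
  x-y≈0⇒x≈y = x∙y⁻¹≈ε⇒x≈y _ _

  *-cancelˡ : ∀ {x y z} → x ≉ 0# → x * y ≈ x * z → y ≈ z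
  *-cancelˡ {x} {y} {z} x≉0 e = x-y≈0⇒x≈y (no-zero-divisors x≉0
    (trans (solve 3 (λ x y z → x :* (y :- z) := x :* y :- x :* z) refl x y z) (x≈y⇒x-y≈0 e)))

  1^ : ∀ m → 1# ^ m ≈ 1#
  1^ zero    = refl
  1^ (suc m) = trans (*-identityˡ _) (1^ m)

  0^ : ∀ m → 0 ℕ.< m → 0# ^ m ≈ 0#
  0^ (suc m) _ = zeroˡ _

  -- Rational numbers in Q̄

  ι-nonzero : ∀ {q} → ¬ q ≡ 0ℚ → ι q ≉ 0#
  ι-nonzero {q} q≢0 = invertible⇒≉0 (begin
    ι q * ι (ℚ.1/ q)    ≈⟨ ι-* q (ℚ.1/ q) ⟨
    ι (q ℚ.* ℚ.1/ q)    ≈⟨ ι-cong (ℚ.*-inverseʳ q) ⟩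
    ι 1ℚ                ≈⟨ ι-1 ⟩
    1#                  ∎)
    where instance _ = ℚ.≢-nonZero q≢0

  ι≈0⇒≡0 : ∀ {q} → ι q ≈ 0# → q ≡ 0ℚ
  ι≈0⇒≡0 {q} e with q ℚ.≟ 0ℚ
  ... | yes q≡0 = q≡0
  ... | no q≢0  = contradiction e (ι-nonzero q≢0)

  ι-^ : ∀ q m → ι (q ^ℚ m) ≈ ι q ^ m
  ι-^ q zero    = ι-1
  ι-^ q (suc m) = trans (ι-* q (q ^ℚ m)) (*-congˡ (ι-^ q m))

  nat : ℕ → Carrier
  nat m = m · 1#

  nat-nonzero : ∀ m → nat (suc m) ≉ 0#
  nat-nonzero m e = ℚ.<-irrefl (≡.sym (ι≈0⇒≡0 (trans (ι-nat (suc m)) e))) (positive m)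
    where
    ι-nat : ∀ m → ι (m ·ℚ 1ℚ) ≈ nat m
    ι-nat zero    = ι-0
    ι-nat (suc m) = trans (ι-+ 1ℚ (m ·ℚ 1ℚ)) (+-cong ι-1 (ι-nat m))
    nonneg : ∀ m → 0ℚ ℚ.≤ m ·ℚ 1ℚ
    nonneg zero    = ℚ.≤-refl
    nonneg (suc m) = ℚ.+-mono-≤ {0ℚ} {1ℚ} (ℚ.nonNegative⁻¹ 1ℚ) (nonneg m)
    positive : ∀ m → 0ℚ ℚ.< suc m ·ℚ 1ℚ
    positive m = ℚ.+-mono-<-≤ {0ℚ} {1ℚ} (ℚ.positive⁻¹ 1ℚ) (nonneg m)

  Rat : Pred Carrier ℓ₁
  Rat x = ∃[ q ] x ≈ ι q

  Rat-isSubring : IsSubring Rat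
  Rat-isSubring = record
    { one-in  = 1ℚ , sym ι-1
    ; add-in  = λ (p , x≈) (q , y≈) → p ℚ.+ q , trans (+-cong x≈ y≈) (sym (ι-+ p q))
    ; neg-in  = λ (p , x≈) → ℚ.- p , trans (-‿cong x≈) (sym (ι-neg p))
    ; mul-in  = λ (p , x≈) (q , y≈) → p ℚ.* q , trans (*-cong x≈ y≈) (sym (ι-* p q))
    ; resp-in = λ e (p , x≈) → p , trans (sym e) x≈
    }

  -- Roots of polynomials

  horner₀-vanishes : ∀ {d} (c : Fin d → Carrier) (r : Fin d → Carrier) →
                     (∀ {i j} → r i ≈ r j → i ≡ j) → (∀ i → horner 0# c (r i) ≈ 0#) →
                     ∀ j → c j ≈ 0#
  horner₀-vanishes {suc d} c r r-distinct root = c≈0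
    where
    r₀ = r zero
    q  = quotient 0# c r₀
    q≈0 : ∀ j → q j ≈ 0#
    q≈0 = horner₀-vanishes q (r ∘ suc) (Fin.suc-injective ∘ r-distinct) λ i →
      no-zero-divisors
        (λ e → Fin.0≢1+n (r-distinct (sym (x-y≈0⇒x≈y e))))
        (begin
          (r (suc i) - r₀) * horner 0# q (r (suc i))                     ≈⟨ +-identityˡ _ ⟨
          0# + (r (suc i) - r₀) * horner 0# q (r (suc i))                ≈⟨ +-congʳ (root zero) ⟨
          horner 0# c r₀ + (r (suc i) - r₀) * horner 0# q (r (suc i)) ≈⟨ horner-quotient 0# c (r (suc i)) r₀ ⟨
          horner 0# c (r (suc i))                                        ≈⟨ root (suc i) ⟩
          0#                                                             ∎)
    -- The j-th coefficient of the quotient is c_(j+1) plus x times a combination of higher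
    -- coefficients, so vanishing propagates from the top downwards.
    tail≈0 : ∀ {d} (c : Fin (suc d) → Carrier) x → (∀ j → quotient 0# c x j ≈ 0#) → ∀ j → c (suc j) ≈ 0#
    tail≈0 {suc d} c x q≈0 = λ where
        zero    → trans (sym head) (q≈0 zero)
        (suc j) → rest j
      where
      rest = tail≈0 (c ∘ suc) x (q≈0 ∘ suc)
      head : horner 0# (c ∘ suc) x ≈ c (suc zero)
      head = trans (+-congˡ (trans (*-congˡ (horner-zero rest x)) (zeroʳ x))) (+-identityʳ _)
    c≈0 : ∀ j → c j ≈ 0#
    c≈0 (suc j) = tail≈0 c r₀ q≈0 j
    c≈0 zero    = begin
      c zero                                  ≈⟨ +-identityʳ _ ⟨
      c zero + 0# ≈⟨ +-congˡ (trans (*-congˡ (horner-zero (tail≈0 c r₀ q≈0) r₀)) (zeroʳ r₀)) ⟨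
      c zero + r₀ * horner 0# (c ∘ suc) r₀    ≈⟨ root zero ⟩
      0#                                      ∎

  -- The coefficients of x^(d+1) − t below the leading one.
  pure : ∀ d → Carrier → Fin (suc d) → Carrier
  pure d t zero    = - t
  pure d t (suc j) = 0#

  horner-pure : ∀ d t x → horner 1# (pure d t) x ≈ x ^ suc d - t
  horner-pure d t x = begin
    - t + x * horner 1# (λ (_ : Fin d) → 0#) x ≈⟨ +-congˡ (*-congˡ (horner-leading {d} 1# (λ _ → 0#) x)) ⟩
    - t + x * (horner 0# (λ (_ : Fin d) → 0#) x + 1# * x ^ d) ≈⟨ +-congˡ (*-congˡ (+-congʳ (horner-zero {d} (λ _ → refl) x))) ⟩
    - t + x * (0# + 1# * x ^ d) ≈⟨ solve 3 (λ t x p → :- t :+ x :* (con 0ℤ :+ con 1ℤ :* p) := x :* p :- t) refl t x (x ^ d) ⟩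
    x * x ^ d - t                                              ∎

  pure-root : ∀ d {t x} → x ^ suc d ≈ t → horner 1# (pure d t) x ≈ 0#
  pure-root d e = trans (horner-pure d _ _) (x≈y⇒x-y≈0 e)

  module PowersOfPrimitiveRoot {n ζ} (prim : IsPrimitiveRootOfUnity n ζ) where

    ζ^n≈1 : ζ ^ n ≈ 1#
    ζ^n≈1 = proj₁ prim

    ζ^multiple : ∀ m → ζ ^ (m ℕ.* n) ≈ 1#
    ζ^multiple m = trans (trans (^-congʳ ζ (ℕ.*-comm m n)) (sym (^-assocʳ ζ n m)))
                         (trans (^-congˡ m ζ^n≈1) (1^ m))
      where open Algebra.Properties.Semiring.Exp semiring using (^-congʳ)

    ζ≉0 : .{{ℕ.NonZero n}} → ζ ≉ 0#
    ζ≉0 ζ≈0 = 1≉0 (trans (sym ζ^n≈1) (trans (^-congˡ n ζ≈0) (0^ n (ℕ.>-nonZero⁻¹ n))))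

    ζ^-% : .{{_ : ℕ.NonZero n}} → ∀ m → ζ ^ m ≈ ζ ^ (m ℕ.% n)
    ζ^-% m = begin
      ζ ^ m                                     ≡⟨ ≡.cong (ζ ^_) (ℕ.m≡m%n+[m/n]*n m n) ⟩
      ζ ^ (m ℕ.% n ℕ.+ m ℕ./ n ℕ.* n)           ≈⟨ ^-homo-* ζ (m ℕ.% n) (m ℕ./ n ℕ.* n) ⟩
      ζ ^ (m ℕ.% n) * ζ ^ (m ℕ./ n ℕ.* n)       ≈⟨ *-congˡ (ζ^multiple (m ℕ./ n)) ⟩
      ζ ^ (m ℕ.% n) * 1#                        ≈⟨ *-identityʳ _ ⟩
      ζ ^ (m ℕ.% n)                             ∎

    ζ^-≡% : .{{_ : ℕ.NonZero n}} → ∀ m m′ → m ℕ.% n ≡ m′ ℕ.% n → ζ ^ m ≈ ζ ^ m′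
    ζ^-≡% m m′ e = trans (ζ^-% m) (trans (reflexive (≡.cong (ζ ^_) e)) (sym (ζ^-% m′)))

    ζ^≈1⇒∣ : .{{_ : ℕ.NonZero n}} → ∀ m → ζ ^ m ≈ 1# → n ℕ.∣ m
    ζ^≈1⇒∣ m e with m ℕ.% n in eq
    ... | zero  = ℕ.m%n≡0⇒n∣m m n eq
    ... | suc r = contradiction
      (trans (reflexive (≡.cong (ζ ^_) (≡.sym eq))) (trans (sym (ζ^-% m)) e))
      (proj₂ prim (suc r) (ℕ.s≤s ℕ.z≤n) (≡.subst (ℕ._< n) eq (ℕ.m%n<n m n)))

    ζ^-injective-≤ : .{{_ : ℕ.NonZero n}} → ∀ {m m′} → m ℕ.≤ m′ → ζ ^ m ≈ ζ ^ m′ → n ℕ.∣ m′ ℕ.∸ m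
    ζ^-injective-≤ {m} {m′} m≤m′ e = ζ^≈1⇒∣ _ (*-cancelˡ (^-≉0 m ζ≉0) (begin
      ζ ^ m * ζ ^ (m′ ℕ.∸ m)   ≈⟨ ^-homo-* ζ m (m′ ℕ.∸ m) ⟨
      ζ ^ (m ℕ.+ (m′ ℕ.∸ m))   ≡⟨ ≡.cong (ζ ^_) (ℕ.m+[n∸m]≡n m≤m′) ⟩
      ζ ^ m′                   ≈⟨ e ⟨
      ζ ^ m                    ≈⟨ *-identityʳ _ ⟨
      ζ ^ m * 1#               ∎))

    ζ^-injective : .{{_ : ℕ.NonZero n}} → ∀ {m m′} → m ℕ.< n → m′ ℕ.< n → ζ ^ m ≈ ζ ^ m′ → m ≡ m′
    ζ^-injective {m} {m′} m<n m′<n e with ℕ.<-cmp m m′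
    ... | tri≈ _ m≡m′ _ = m≡m′
    ... | tri< m<m′ _ _ = contradiction (ζ^-injective-≤ (ℕ.<⇒≤ m<m′) e)
      (ℕ.>⇒∤ {{ℕ.>-nonZero (ℕ.m<n⇒0<n∸m m<m′)}} (ℕ.≤-<-trans (ℕ.m∸n≤m m′ m) m′<n))
    ... | tri> _ _ m>m′ = contradiction (ζ^-injective-≤ (ℕ.<⇒≤ m>m′) (sym e))
      (ℕ.>⇒∤ {{ℕ.>-nonZero (ℕ.m<n⇒0<n∸m m>m′)}} (ℕ.≤-<-trans (ℕ.m∸n≤m m m′) m<n))

    -- xⁿ − 1 has no more than the n roots ζˢ.
    root-of-unity : .{{_ : ℕ.NonZero n}} → ∀ {x} → x ^ n ≈ 1# → ∃[ s ] s ℕ.< n × x ≈ ζ ^ s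
    root-of-unity {x} x^n≈1 with Fin.any? {n = n} (λ s → x ≟ ζ ^ toℕ s)
    ... | yes (s , e) = toℕ s , Fin.toℕ<n s , e
    ... | no none = contradiction x^n≈1 (impossible n ≡.refl)
      where
      impossible : ∀ m → m ≡ n → ¬ (x ^ n ≈ 1#)
      impossible zero    m≡n _   = ℕ.≢-nonZero⁻¹ n (≡.sym m≡n)
      impossible (suc m) m≡n x^n≈1 = 1≉0 (trans (sym leading) (c≈0 (fromℕ (suc m))))
        where
        -- All n + 1 coefficients of xⁿ - 1, the leading 1 included: the n + 1 distinct roots x, 1,
        -- ζ, ..., ζ^(n-1) would force that 1 to vanish.
        c : Fin (suc (suc m)) → Carrier
        c j with Fin.view j
        ... | ‵fromℕ     = 1#
        ... | ‵inject₁ i = pure m 1# i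
        leading : c (fromℕ (suc m)) ≈ 1#
        leading rewrite Fin.view-fromℕ (suc m) = refl
        lower : ∀ j → c (inject₁ j) ≈ pure m 1# j
        lower j rewrite Fin.view-inject₁ j = refl
        root : ∀ {y} → y ^ n ≈ 1# → horner 0# c y ≈ 0#
        root {y} e = trans (horner-snoc c y) (trans (horner-cong leading lower refl)
          (pure-root m (trans (reflexive (≡.cong (y ^_) m≡n)) e)))
        r : Fin (suc (suc m)) → Carrier
        r zero    = x
        r (suc j) = ζ ^ toℕ j
        bound : ∀ (j : Fin (suc m)) → toℕ j ℕ.< n
        bound j = ≡.subst (toℕ j ℕ.<_) m≡n (Fin.toℕ<n j)
        r-distinct : ∀ {i j} → r i ≈ r j → i ≡ j
        r-distinct {zero}  {zero}  e = ≡.refl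
        r-distinct {zero}  {suc j} e = contradiction
          (Fin.cast m≡n j , trans e (reflexive (≡.cong (ζ ^_) (≡.sym (Fin.toℕ-cast m≡n j))))) none
        r-distinct {suc i} {zero}  e = contradiction
          (Fin.cast m≡n i , trans (sym e) (reflexive (≡.cong (ζ ^_) (≡.sym (Fin.toℕ-cast m≡n i))))) none
        r-distinct {suc i} {suc j} e = ≡.cong suc (Fin.toℕ-injective (ζ^-injective (bound i) (bound j) e))
        c≈0 : ∀ j → c j ≈ 0#
        c≈0 = horner₀-vanishes c r r-distinct λ where
          zero    → root x^n≈1
          (suc j) → root (trans (^-assocʳ ζ (toℕ j) n) (ζ^multiple (toℕ j)))

  eval-in : ∀ {p} {C : Pred Carrier p} → IsSubring C → Rat ⊆ C → ∀ g {x} → C x → C (K[x].eval (List.map ι g) x)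
  eval-in isC Rat⊆C []      x∈C = IsSubring.zero-in isC
  eval-in isC Rat⊆C (q ∷ g) x∈C =
    IsSubring.add-in isC (Rat⊆C (q , refl)) (IsSubring.mul-in isC x∈C (eval-in isC Rat⊆C g x∈C))

  -- Powers of x are divided out of the relation until its constant term is nonzero, which must
  -- happen because f has a nonzero coefficient. The result exhibits g(x)/q as the inverse of x.
  algebraic-relation : ∀ f → ¬ (f ℚ[x].≈ₚ []) → ∀ {x} → x ≉ 0# → IsRoot f x →
                       ∃[ q ] ∃[ g ] ¬ (q ≡ 0ℚ) × x * K[x].eval (List.map ι g) x ≈ ι q
  algebraic-relation []      f≉[] x≉0 root = contradiction (λ _ → ≡.refl) f≉[]
  algebraic-relation (q ∷ f) f≉[] {x} x≉0 root with q ℚ.≟ 0ℚ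
  ... | no q≢0 = ℚ.- q , f , (λ e → q≢0 (ℚ.neg-injective e)) , (begin
    x * K[x].eval (List.map ι f) x              ≈⟨ solve 2 (λ q y → y := q :+ y :- q) refl (ι q) _ ⟩
    ι q + x * K[x].eval (List.map ι f) x - ι q  ≈⟨ +-congʳ root ⟩
    0# - ι q                                    ≈⟨ +-identityˡ _ ⟩
    - ι q                                       ≈⟨ ι-neg q ⟨
    ι (ℚ.- q)                                   ∎)
  ... | yes ≡.refl = algebraic-relation f f≉[]′ x≉0 (no-zero-divisors x≉0 (begin
    x * K[x].eval (List.map ι f) x              ≈⟨ +-identityˡ _ ⟨
    0# + x * K[x].eval (List.map ι f) x         ≈⟨ +-congʳ ι-0 ⟨
    ι 0ℚ + x * K[x].eval (List.map ι f) x       ≈⟨ root ⟩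
    0#                                          ∎))
    where
    f≉[]′ : ¬ (f ℚ[x].≈ₚ [])
    f≉[]′ e = f≉[] λ where
      zero    → ≡.refl
      (suc i) → e i

  -- The inverse of an algebraic number is a polynomial in it.
  inverse-in : ∀ {p} {C : Pred Carrier p} → IsSubring C → Rat ⊆ C → ∀ {x y} → C x → x * y ≈ 1# → C y
  inverse-in isC Rat⊆C {x} {y} x∈C xy≈1 with algebraic x
  ... | f , f≉[] , root with algebraic-relation f f≉[] (invertible⇒≉0 xy≈1) root
  ...   | q , g , q≢0 , xh≈q =
    resp-in (begin
      ι (ℚ.1/ q) * h                 ≈⟨ *-identityʳ _ ⟨
      ι (ℚ.1/ q) * h * 1#            ≈⟨ *-congˡ xy≈1 ⟨
      ι (ℚ.1/ q) * h * (x * y) ≈⟨ solve 4 (λ i h x y → i :* h :* (x :* y) := i :* (x :* h) :* y) refl (ι (ℚ.1/ q)) h x y ⟩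
      ι (ℚ.1/ q) * (x * h) * y       ≈⟨ *-congʳ (*-congˡ xh≈q) ⟩
      ι (ℚ.1/ q) * ι q * y           ≈⟨ *-congʳ (ι-* (ℚ.1/ q) q) ⟨
      ι (ℚ.1/ q ℚ.* q) * y           ≈⟨ *-congʳ (trans (ι-cong (ℚ.*-inverseˡ q)) ι-1) ⟩
      1# * y                         ≈⟨ *-identityˡ y ⟩
      y                              ∎)
    (mul-in (Rat⊆C (ℚ.1/ q , refl)) (eval-in isC Rat⊆C g x∈C))
    where
    open IsSubring isC
    instance _ = ℚ.≢-nonZero q≢0
    h = K[x].eval (List.map ι g) x

  ℚ⟨⟩-isSubring : ∀ {s} {S : Pred Carrier s} → IsSubring ℚ⟨ S ⟩
  ℚ⟨⟩-isSubring = record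
    { one-in = resp ι-1 (rational 1ℚ) ; add-in = add ; neg-in = neg ; mul-in = mul ; resp-in = resp }

  Rat⊆ℚ⟨⟩ : ∀ {s} {S : Pred Carrier s} → Rat ⊆ ℚ⟨ S ⟩
  Rat⊆ℚ⟨⟩ (q , e) = resp (sym e) (rational q)

  -- The clause for `inv` is where algebraicity enters: a subring that contains ℚ is already closed
  -- under inverses. Fields can therefore be compared with subrings and with domains of graphs.
  ℚ⟨⟩-least : ∀ {s p} {S : Pred Carrier s} {C : Pred Carrier p} → IsSubring C → Rat ⊆ C → S ⊆ C → ℚ⟨ S ⟩ ⊆ C
  ℚ⟨⟩-least isC Rat⊆C S⊆C (rational q)  = Rat⊆C (q , refl)
  ℚ⟨⟩-least isC Rat⊆C S⊆C (generator x) = S⊆C x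
  ℚ⟨⟩-least isC Rat⊆C S⊆C (add x y) = IsSubring.add-in isC (ℚ⟨⟩-least isC Rat⊆C S⊆C x) (ℚ⟨⟩-least isC Rat⊆C S⊆C y)
  ℚ⟨⟩-least isC Rat⊆C S⊆C (neg x)       = IsSubring.neg-in isC (ℚ⟨⟩-least isC Rat⊆C S⊆C x)
  ℚ⟨⟩-least isC Rat⊆C S⊆C (mul x y) = IsSubring.mul-in isC (ℚ⟨⟩-least isC Rat⊆C S⊆C x) (ℚ⟨⟩-least isC Rat⊆C S⊆C y)
  ℚ⟨⟩-least isC Rat⊆C S⊆C (inv x e)     = inverse-in isC Rat⊆C (ℚ⟨⟩-least isC Rat⊆C S⊆C x) e
  ℚ⟨⟩-least isC Rat⊆C S⊆C (resp e x)    = IsSubring.resp-in isC e (ℚ⟨⟩-least isC Rat⊆C S⊆C x)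

  ℚ⟨⟩-mono : ∀ {s p} {S : Pred Carrier s} {T : Pred Carrier p} → S ⊆ ℚ⟨ T ⟩ → ℚ⟨ S ⟩ ⊆ ℚ⟨ T ⟩
  ℚ⟨⟩-mono = ℚ⟨⟩-least ℚ⟨⟩-isSubring Rat⊆ℚ⟨⟩

  -- The ring of pairs: subrings of Q̄ × Q̄ play the role of graphs of
  -- homomorphisms between subfields of Q̄.
  Q̄² : CommutativeRing κ ℓ₁
  Q̄² = DirectProduct.commutativeRing commutativeRing commutativeRing

  module Q̄² = CommutativeRing Q̄²
  module Horner² = Horner Q̄²

  horner²₁ : ∀ {d} b (c : Fin d → Carrier × Carrier) x →
             proj₁ (Horner².horner b c x) ≡ horner (proj₁ b) (proj₁ ∘ c) (proj₁ x)
  horner²₁ {zero}  b c x = ≡.refl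
  horner²₁ {suc d} b c x = ≡.cong (λ h → proj₁ (c zero) + proj₁ x * h) (horner²₁ b (c ∘ suc) x)

  horner²₂ : ∀ {d} b (c : Fin d → Carrier × Carrier) x →
             proj₂ (Horner².horner b c x) ≡ horner (proj₂ b) (proj₂ ∘ c) (proj₂ x)
  horner²₂ {zero}  b c x = ≡.refl
  horner²₂ {suc d} b c x = ≡.cong (λ h → proj₂ (c zero) + proj₂ x * h) (horner²₂ b (c ∘ suc) x)

  ^²₁ : ∀ x m → proj₁ (x Horner².^ m) ≡ proj₁ x ^ m
  ^²₁ x zero    = ≡.refl
  ^²₁ x (suc m) = ≡.cong (proj₁ x *_) (^²₁ x m)

  ^²₂ : ∀ x m → proj₂ (x Horner².^ m) ≡ proj₂ x ^ m
  ^²₂ x zero    = ≡.refl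
  ^²₂ x (suc m) = ≡.cong (proj₂ x *_) (^²₂ x m)

  Diagonal : ∀ {s} → Pred Carrier s → Pred (Carrier × Carrier) _
  Diagonal S (x , y) = ∃[ z ] S z × x ≈ z × y ≈ z

  diagonal-isSubring : ∀ {c} {C : Pred Carrier c} → IsSubring C → Horner².IsSubring (Diagonal C)
  diagonal-isSubring isC = record
    { one-in  = 1# , one-in , refl , refl
    ; add-in  = λ (z , z∈ , e , e′) (w , w∈ , f , f′) → z + w , add-in z∈ w∈ , +-cong e f , +-cong e′ f′
    ; neg-in  = λ (z , z∈ , e , e′) → - z , neg-in z∈ , -‿cong e , -‿cong e′
    ; mul-in  = λ (z , z∈ , e , e′) (w , w∈ , f , f′) → z * w , mul-in z∈ w∈ , *-cong e f , *-cong e′ f′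
    ; resp-in = λ (e , e′) (z , z∈ , f , f′) → z , z∈ , trans (sym e) f , trans (sym e′) f′
    }
    where open IsSubring isC

  -- Together with `ℚ⟨⟩-least`, this shows that a graph is defined on a whole field once it is
  -- defined on ℚ and on the generators.
  domain-isSubring : ∀ {g} {G : Pred (Carrier × Carrier) g} → Horner².IsSubring G → IsSubring (λ x → ∃[ y ] G (x , y))
  domain-isSubring isG = record
    { one-in  = 1# , one-in
    ; add-in  = λ (y , p) (z , q) → y + z , add-in p q
    ; neg-in  = λ (y , p) → - y , neg-in p
    ; mul-in  = λ (y , p) (z , q) → y * z , mul-in p q
    ; resp-in = λ e (y , p) → y , resp-in (e , refl) p
    }
    where open Horner².IsSubring isG

  -- Reduction modulo a monic polynomial, simultaneously at two of its roots.
  reduce² : ∀ {p} {C : Pred (Carrier × Carrier) p} → Horner².IsSubring C →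
            ∀ {d} (l l′ : Fin (suc d) → Carrier) → (∀ j → C (l j , l′ j)) →
            ∀ {x x′} → horner 1# l x ≈ 0# → horner 1# l′ x′ ≈ 0# →
            ∀ {y y′} → Horner².⟪ C ∪ (Q̄²._≈ (x , x′)) ⟫ (y , y′) →
            ∃[ r ] ∃[ r′ ] (∀ (j : Fin (suc d)) → C (r j , r′ j)) × y ≈ horner 0# r x × y′ ≈ horner 0# r′ x′
  reduce² isC l l′ l∈C {x} {x′} root root′ y∈
    with Horner².MonicExtension.reduce isC (λ j → l j , l′ j) l∈C (x , x′)
      ( trans (reflexive (horner²₁ Q̄².1# (λ j → l j , l′ j) (x , x′))) root
      , trans (reflexive (horner²₂ Q̄².1# (λ j → l j , l′ j) (x , x′))) root′) y∈
  ... | r , r∈C , e , e′ =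
    proj₁ ∘ r , proj₂ ∘ r , r∈C ,
    trans e (reflexive (horner²₁ Q̄².0# r (x , x′))) ,
    trans e′ (reflexive (horner²₂ Q̄².0# r (x , x′)))

  foldr-horner : ∀ {d} (l : Fin d → Carrier) x →
                 K[x].eval (K[x].monicWith (List.tabulate l)) x ≈ horner 1# l x
  foldr-horner {zero}  l x = trans (+-congˡ (zeroʳ x)) (+-identityʳ 1#)
  foldr-horner {suc d} l x = +-congˡ (*-congˡ (foldr-horner (l ∘ suc) x))

  root-of-monic : ∀ {d} (l : Fin (suc d) → Carrier) → ∃[ x ] horner 1# l x ≈ 0#
  root-of-monic l with algebraicallyClosed (List.tabulate l) (ℕ.s≤s ℕ.z≤n)
  ... | x , e = x , trans (sym (foldr-horner l x)) e

  -- The constant coefficient is, up to sign, the product of the roots.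
  constant-coefficient-power :
    ∀ n {γ} → (∀ x → (- x) ^ n ≈ - (x ^ n)) →
    ∀ {d} (l : Fin d → Carrier) → (∀ y → horner 1# l y ≈ 0# → y ^ n ≈ γ) →
    horner 1# l 0# ^ n ≈ (- γ) ^ d
  constant-coefficient-power n {γ} odd {zero}  l roots = 1^ n
  constant-coefficient-power n {γ} odd {suc d} l roots = begin
    horner 1# l 0# ^ n                ≈⟨ ^-congˡ n (factor 0#) ⟩
    ((0# - y) * horner 1# q 0#) ^ n   ≈⟨ ^-congˡ n (*-congʳ (+-identityˡ (- y))) ⟩
    (- y * horner 1# q 0#) ^ n        ≈⟨ ^-distrib-* (- y) _ n ⟩
    (- y) ^ n * horner 1# q 0# ^ n    ≈⟨ *-cong (trans (odd y) (-‿cong (roots y root)))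
                                                (constant-coefficient-power n odd q q-roots) ⟩
    - γ * (- γ) ^ d                   ∎
    where
    y    = proj₁ (root-of-monic l)
    root = proj₂ (root-of-monic l)
    q    = quotient 1# l y
    factor : ∀ x → horner 1# l x ≈ (x - y) * horner 1# q x
    factor x = trans (horner-quotient 1# l x y) (trans (+-congʳ root) (+-identityˡ _))
    q-roots : ∀ z → horner 1# q z ≈ 0# → z ^ n ≈ γ
    q-roots z e = roots z (trans (factor z) (trans (*-congˡ e) (zeroʳ _)))

  -- Independence of the powers of a radical over a field with the n-th roots of unity.

  module Subfield {p} {C : Pred Carrier p} (isC : IsSubring C) (Rat⊆C : Rat ⊆ C) where

    open IsSubring isC

    -- Decidable equality locates the leading coefficient t. The monic polynomial that remains has
    -- degree below d, which drives descents on the degree.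
    zero-or-monic : ∀ {d} (r : Fin d → Carrier) → (∀ j → C (r j)) →
      (∀ j → r j ≈ 0#) ⊎
      ∃[ e ] e ℕ.< d × ∃[ l ] (∀ (j : Fin e) → C (l j)) ×
        ∃[ t ] C t × t ≉ 0# × (∀ x → horner 0# r x ≈ t * horner 1# l x)
    zero-or-monic {zero}  r r∈C = inj₁ λ ()
    zero-or-monic {suc d} r r∈C with zero-or-monic (r ∘ suc) (r∈C ∘ suc)
    ... | inj₂ (e , e<d , l , l∈C , t , t∈C , t≉0 , eq) with inverse t≉0
    ...   | u , tu≈1 = inj₂ (suc e , ℕ.s≤s e<d , l′ , l′∈C , t , t∈C , t≉0 , λ x → begin
      r zero + x * horner 0# (r ∘ suc) x         ≈⟨ +-cong (sym (*-identityˡ _)) (*-congˡ (eq x)) ⟩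
      1# * r zero + x * (t * horner 1# l x)      ≈⟨ +-congʳ (*-congʳ tu≈1) ⟨
      t * u * r zero + x * (t * horner 1# l x) ≈⟨ solve 5 (λ t u r x h → t :* u :* r :+ x :* (t :* h) := t :* (u :* r :+ x :* h)) refl t u (r zero) x _ ⟩
      t * (u * r zero + x * horner 1# l x)       ∎)
      where
      l′ : Fin (suc e) → Carrier
      l′ zero    = u * r zero
      l′ (suc j) = l j
      l′∈C : ∀ j → C (l′ j)
      l′∈C zero    = mul-in (inverse-in isC Rat⊆C t∈C tu≈1) (r∈C zero)
      l′∈C (suc j) = l∈C j
    zero-or-monic {suc d} r r∈C | inj₁ tail≈0 with r zero ≟ 0#
    ... | yes r₀≈0 = inj₁ λ where
      zero    → r₀≈0
      (suc j) → tail≈0 j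
    ... | no r₀≉0 = inj₂ (0 , ℕ.s≤s ℕ.z≤n , (λ ()) , (λ ()) , r zero , r∈C zero , r₀≉0 , λ x → begin
      r zero + x * horner 0# (r ∘ suc) x ≈⟨ +-congˡ (trans (*-congˡ (horner-zero tail≈0 x)) (zeroʳ x)) ⟩
      r zero + 0#                          ≈⟨ +-identityʳ _ ⟩
      r zero                               ≈⟨ *-identityʳ _ ⟨
      r zero * 1#                          ∎)

  module _ {p} {F : Pred Carrier p} (isC : IsSubring F) (Rat⊆F : Rat ⊆ F)
    {m : ℕ} {γ a ζ : Carrier}
    (odd : ∀ x → (- x) ^ suc m ≈ - (x ^ suc m))
    (a≉0 : a ≉ 0#) (aⁿ≈γ : a ^ suc m ≈ γ) (γ∈F : F γ)
    (prim : IsPrimitiveRootOfUnity (suc m) ζ) (ζ∈F : F ζ)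
    (aᵉ∉F : ∀ e → 0 ℕ.< e → e ℕ.< suc m → ¬ F (a ^ e))
    where

    open IsSubring isC
    open Subfield isC Rat⊆F
    open PowersOfPrimitiveRoot prim

    private
      n = suc m

      ζ^-inverse : ∀ s → ∃[ y ] F y × ζ ^ s * y ≈ 1#
      ζ^-inverse s = ζ ^ (s ℕ.* m) , pow-in (s ℕ.* m) ζ∈F , (begin
        ζ ^ s * ζ ^ (s ℕ.* m)   ≈⟨ ^-homo-* ζ s (s ℕ.* m) ⟨
        ζ ^ (s ℕ.+ s ℕ.* m)     ≡⟨ ≡.cong (ζ ^_) (ℕ.*-suc s m) ⟨
        ζ ^ (s ℕ.* n)           ≈⟨ ζ^multiple s ⟩
        1#                      ∎)

      -- Over F, the constant coefficient of a monic divisor of xⁿ − γ of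
      -- degree d is ±a^d times a root of unity.
      power-in : ∀ d → (l : Fin d → Carrier) → (∀ j → F (l j)) →
                 (∀ y → horner 1# l y ≈ 0# → y ^ n ≈ γ) → F (a ^ d)
      power-in d l l∈F roots = resp-in a^d≈ (mul-in (pow-in d (neg-in one-in)) (mul-in ζ^-s∈F m₀∈F))
        where
        m₀ = horner 1# l 0#
        m₀∈F : F m₀
        m₀∈F = horner-in one-in l∈F zero-in
        -a^d≉0 : (- a) ^ d ≉ 0#
        -a^d≉0 = ^-≉0 d λ e → a≉0 (⁻¹-injective (trans e (sym -0#≈0#)))
        u = proj₁ (inverse -a^d≉0)
        inv-eq : (- a) ^ d * u ≈ 1#
        inv-eq = proj₂ (inverse -a^d≉0)
        m₀ⁿ : m₀ ^ n ≈ ((- a) ^ d) ^ n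
        m₀ⁿ = begin
          m₀ ^ n                   ≈⟨ constant-coefficient-power n odd l roots ⟩
          (- γ) ^ d                ≈⟨ ^-congˡ d (trans (odd a) (-‿cong aⁿ≈γ)) ⟨
          ((- a) ^ n) ^ d          ≈⟨ ^-assocʳ (- a) n d ⟩
          (- a) ^ (n ℕ.* d)        ≡⟨ ≡.cong ((- a) ^_) (ℕ.*-comm n d) ⟩
          (- a) ^ (d ℕ.* n)        ≈⟨ ^-assocʳ (- a) d n ⟨
          ((- a) ^ d) ^ n          ∎
        z = m₀ * u
        zⁿ≈1 : z ^ n ≈ 1#
        zⁿ≈1 = begin
          (m₀ * u) ^ n                    ≈⟨ ^-distrib-* m₀ u n ⟩
          m₀ ^ n * u ^ n                  ≈⟨ *-congʳ m₀ⁿ ⟩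
          ((- a) ^ d) ^ n * u ^ n         ≈⟨ ^-distrib-* _ u n ⟨
          ((- a) ^ d * u) ^ n             ≈⟨ ^-congˡ n inv-eq ⟩
          1# ^ n                          ≈⟨ 1^ n ⟩
          1#                              ∎
        s = proj₁ (root-of-unity zⁿ≈1)
        z≈ζˢ : z ≈ ζ ^ s
        z≈ζˢ = proj₂ (proj₂ (root-of-unity zⁿ≈1))
        v = proj₁ (ζ^-inverse s)
        ζ^-s∈F : F v
        ζ^-s∈F = proj₁ (proj₂ (ζ^-inverse s))
        vm₀≈ : v * m₀ ≈ (- a) ^ d
        vm₀≈ = begin
          v * m₀                            ≈⟨ *-identityʳ _ ⟨
          v * m₀ * 1#                       ≈⟨ *-congˡ inv-eq ⟨
          v * m₀ * ((- a) ^ d * u) ≈⟨ solve 4 (λ v m b u → v :* m :* (b :* u) := (m :* u) :* v :* b) refl v m₀ _ u ⟩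
          z * v * (- a) ^ d                 ≈⟨ *-congʳ (*-congʳ z≈ζˢ) ⟩
          ζ ^ s * v * (- a) ^ d             ≈⟨ *-congʳ (proj₂ (proj₂ (ζ^-inverse s))) ⟩
          1# * (- a) ^ d                    ≈⟨ *-identityˡ _ ⟩
          (- a) ^ d                         ∎
        a^d≈ : (- 1#) ^ d * (v * m₀) ≈ a ^ d
        a^d≈ = begin
          (- 1#) ^ d * (v * m₀)             ≈⟨ *-congˡ vm₀≈ ⟩
          (- 1#) ^ d * (- a) ^ d            ≈⟨ ^-distrib-* (- 1#) (- a) d ⟨
          (- 1# * - a) ^ d ≈⟨ ^-congˡ d (solve 1 (λ a → (:- con 1ℤ) :* (:- a) := a) refl a) ⟩
          a ^ d                             ∎

      -- A monic polynomial over F of least degree with root a divides xⁿ − γ.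
      no-monic : ∀ d → d ℕ.< n → (l : Fin d → Carrier) → (∀ j → F (l j)) → ¬ (horner 1# l a ≈ 0#)
      no-monic = ℕ.<-rec _ step
        where
        step : ∀ d → (∀ {e} → e ℕ.< d → e ℕ.< n → (l : Fin e → Carrier) → (∀ j → F (l j)) → ¬ (horner 1# l a ≈ 0#)) →
               d ℕ.< n → (l : Fin d → Carrier) → (∀ j → F (l j)) → ¬ (horner 1# l a ≈ 0#)
        step zero    ih d<n l l∈F root = 1≉0 root
        step (suc d) ih d<n l l∈F root =
          aᵉ∉F (suc d) (ℕ.s≤s ℕ.z≤n) d<n (power-in (suc d) l l∈F roots)
          where
          -- A nonzero r would normalise to a monic polynomial of smaller degree with root a,
          -- excluded by the induction hypothesis.
          vanishes : (r : Fin (suc d) → Carrier) → (∀ j → F (r j)) → horner 0# r a ≈ 0# → ∀ j → r j ≈ 0#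
          vanishes r r∈F e with zero-or-monic r r∈F
          ... | inj₁ r≈0 = r≈0
          ... | inj₂ (e′ , e′<d , l′ , l′∈F , t , _ , t≉0 , eq) =
            contradiction (no-zero-divisors t≉0 (trans (sym (eq a)) e)) (ih e′<d (ℕ.<-trans e′<d d<n) l′ l′∈F)
          roots : ∀ y → horner 1# l y ≈ 0# → y ^ n ≈ γ
          roots y y-root = begin
            y ^ n                     ≡⟨ ^²₂ (a , y) n ⟨
            _                         ≈⟨ proj₂ (proj₂ (proj₂ (proj₂ reduced))) ⟩
            horner 0# r′ y ≈⟨ horner-cong refl (λ j → let _ , _ , e , e′ = r∈D j in trans e′ (sym e)) refl ⟩
            horner 0# r y             ≈⟨ s-horner y ⟨
            horner 0# s y + γ         ≈⟨ +-congʳ (horner-zero s≈0 y) ⟩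
            0# + γ                    ≈⟨ +-identityˡ γ ⟩
            γ                         ∎
            where
            aⁿ,yⁿ∈ : Horner².⟪ Diagonal F ∪ (Q̄²._≈ (a , y)) ⟫ ((a , y) Horner².^ n)
            aⁿ,yⁿ∈ = Horner².IsSubring.pow-in Horner².⟪⟫-isSubring n (Horner².gen (inj₂ (refl , refl)))
            -- The remainder of xⁿ modulo l, computed at the roots a and y of l together; the
            -- diagonal makes it the same remainder r at both. As r - γ vanishes at a and has degree
            -- below that of l, it is zero, and so yⁿ = γ.
            reduced = reduce² (diagonal-isSubring isC) l l (λ j → _ , l∈F j , refl , refl) root y-root aⁿ,yⁿ∈
            r r′ : Fin (suc d) → Carrier
            r  = proj₁ reduced
            r′ = proj₁ (proj₂ reduced)
            r∈D : ∀ j → Diagonal F (r j , r′ j)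
            r∈D = proj₁ (proj₂ (proj₂ reduced))
            r∈F : ∀ j → F (r j)
            r∈F j = let _ , z∈ , e , _ = r∈D j in resp-in (sym e) z∈
            aⁿ≈ : a ^ n ≈ horner 0# r a
            aⁿ≈ = trans (reflexive (≡.sym (^²₁ (a , y) n))) (proj₁ (proj₂ (proj₂ (proj₂ reduced))))
            s : Fin (suc d) → Carrier
            s zero    = r zero - γ
            s (suc j) = r (suc j)
            s∈F : ∀ j → F (s j)
            s∈F zero    = sub-in (r∈F zero) γ∈F
            s∈F (suc j) = r∈F (suc j)
            s-horner : ∀ x → horner 0# s x + γ ≈ horner 0# r x
            s-horner x = solve 3 (λ r γ h → r :- γ :+ h :+ γ := r :+ h) refl (r zero) γ (x * horner 0# (r ∘ suc) x)
            s≈0 : ∀ j → s j ≈ 0#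
            s≈0 = vanishes s s∈F (begin
              horner 0# s a               ≈⟨ solve 2 (λ h γ → h := h :+ γ :- γ) refl (horner 0# s a) γ ⟩
              horner 0# s a + γ - γ       ≈⟨ +-congʳ (s-horner a) ⟩
              horner 0# r a - γ           ≈⟨ x≈y⇒x-y≈0 (trans (sym aⁿ≈) aⁿ≈γ) ⟩
              0#                          ∎)

    powers-independent : (r : Fin n → Carrier) → (∀ j → F (r j)) → horner 0# r a ≈ 0# → ∀ j → r j ≈ 0#
    powers-independent r r∈F e with zero-or-monic r r∈F
    ... | inj₁ r≈0 = r≈0
    ... | inj₂ (d , d<n , l , l∈F , t , _ , t≉0 , eq) =
      contradiction (no-zero-divisors t≉0 (trans (sym (eq a)) e)) (no-monic d d<n l l∈F)

  -- The integers in Q̄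

  Int : Pred Carrier ℓ₁
  Int x = ∃[ i ] x ≈ ⟦ i ⟧ℤ

  Int-isSubring : IsSubring Int
  Int-isSubring = record
    { one-in  = 1ℤ , refl
    ; add-in  = λ (i , x≈) (j , y≈) → i ℤ.+ j , trans (+-cong x≈ y≈) (sym (ℤ-+-homo i j))
    ; neg-in  = λ (i , x≈) → ℤ.- i , trans (-‿cong x≈) (sym (ℤ-neg-homo i))
    ; mul-in  = λ (i , x≈) (j , y≈) → i ℤ.* j , trans (*-cong x≈ y≈) (sym (ℤ-*-homo i j))
    ; resp-in = λ e (i , x≈) → i , trans (sym e) x≈
    }

  -- Built with the constructor so that numerators and negation compute; `neg-eq` and `⟦⟧ℤ-nonzero`
  -- rely on it.
  fromℤ : ℤ → ℚ
  fromℤ i = ℚ.mkℚ i 0 (ℕ.sym (ℕ.1-coprimeTo ℤ.∣ i ∣))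

  fromℤ-suc : ∀ k → fromℤ (+ suc k) ≡ 1ℚ ℚ.+ fromℤ (+ k)
  fromℤ-suc k = ℚ.toℚᵘ-injective (ℚᵘ.≃-trans (ℚᵘ.*≡* (ℤ-eq (+ k))) (ℚᵘ.≃-sym (ℚ.toℚᵘ-homo-+ 1ℚ (fromℤ (+ k)))))
    where
    ℤ-eq : ∀ i → (1ℤ ℤ.+ i) ℤ.* 1ℤ ≡ (1ℤ ℤ.* 1ℤ ℤ.+ i ℤ.* 1ℤ) ℤ.* 1ℤ
    ℤ-eq = ℤ-solve-∀

  ι-fromℕ : ∀ k → ι (fromℤ (+ k)) ≈ k · 1#
  ι-fromℕ zero    = trans (ι-cong fromℤ-0) ι-0
    where
    fromℤ-0 : fromℤ (+ 0) ≡ 0ℚ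
    fromℤ-0 = ≡.refl
  ι-fromℕ (suc k) = trans (ι-cong (fromℤ-suc k)) (trans (ι-+ 1ℚ (fromℤ (+ k))) (+-cong ι-1 (ι-fromℕ k)))

  ·≈⟦⟧ℤ : ∀ k → k · 1# ≈ ⟦ + k ⟧ℤ
  ·≈⟦⟧ℤ k = Algebra.Properties.Semiring.Mult.TCOptimised.×ᵤ≈× semiring k 1#

  ι-fromℤ : ∀ i → ι (fromℤ i) ≈ ⟦ i ⟧ℤ
  ι-fromℤ (+ k)      = trans (ι-fromℕ k) (·≈⟦⟧ℤ k)
  ι-fromℤ -[1+ k ]   = begin
    ι (fromℤ -[1+ k ])              ≡⟨ ≡.cong ι neg-eq ⟩
    ι (ℚ.- fromℤ (+ suc k))         ≈⟨ ι-neg _ ⟩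
    - ι (fromℤ (+ suc k))           ≈⟨ -‿cong (ι-fromℤ (+ suc k)) ⟩
    - ⟦ + suc k ⟧ℤ                  ∎
    where
    neg-eq : fromℤ -[1+ k ] ≡ ℚ.- fromℤ (+ suc k)
    neg-eq = ≡.refl

  ⟦⟧ℤ-nonzero : ∀ {i} → ¬ i ≡ ℤ.0ℤ → ⟦ i ⟧ℤ ≉ 0#
  ⟦⟧ℤ-nonzero {i} i≢0 e = i≢0 (≡.cong ℚ.ℚ.numerator (ι≈0⇒≡0 (trans (ι-fromℤ i) e)))

  denominator-times : ∀ q → ∃[ k ] ∃[ i ] ⟦ + suc k ⟧ℤ * ι q ≈ ⟦ i ⟧ℤ
  denominator-times q@(ℚ.mkℚ i k _) = k , i , (begin
    ⟦ + suc k ⟧ℤ * ι q                   ≈⟨ *-congʳ (ι-fromℤ (+ suc k)) ⟨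
    ι (fromℤ (+ suc k)) * ι q            ≈⟨ ι-* (fromℤ (+ suc k)) q ⟨
    ι (fromℤ (+ suc k) ℚ.* q) ≈⟨ ι-cong (ℚ.toℚᵘ-injective (ℚᵘ.≃-trans (ℚ.toℚᵘ-homo-* (fromℤ (+ suc k)) q) (ℚᵘ.*≡* (ℤ-eq (+ suc k) i)))) ⟩
    ι (fromℤ i)                          ≈⟨ ι-fromℤ i ⟩
    ⟦ i ⟧ℤ                               ∎)
    where
    ℤ-eq : ∀ d i → (d ℤ.* i) ℤ.* 1ℤ ≡ i ℤ.* (1ℤ ℤ.* d)
    ℤ-eq = ℤ-solve-∀

  ℤ[_] : Carrier → Pred Carrier (κ ⊔ ℓ₁)
  ℤ[ z ] = ⟪ Int ∪ (_≈ z) ⟫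

  module ℤ[] {z} = IsSubring (⟪⟫-isSubring {S = Int ∪ (_≈ z)})

  int-in : ∀ {z} i → ℤ[ z ] ⟦ i ⟧ℤ
  int-in i = gen (inj₁ (i , refl))

  var-in : ∀ {z} → ℤ[ z ] z
  var-in = gen (inj₂ refl)

  ℤ[]-mono : ∀ {y z} → ℤ[ z ] y → ℤ[ y ] ⊆ ℤ[ z ]
  ℤ[]-mono y∈ = ⟪⟫-least ⟪⟫-isSubring λ where
    (inj₁ x∈Int) → gen (inj₁ x∈Int)
    (inj₂ x≈y)   → ℤ[].resp-in (sym x≈y) y∈

  clear-denominators : ∀ g x → ∃[ k ] ¬ (k ≡ ℤ.0ℤ) × ℤ[ x ] (⟦ k ⟧ℤ * K[x].eval (List.map ι g) x)
  clear-denominators []      x = 1ℤ , (λ ()) , ℤ[].resp-in (sym (zeroʳ _)) ℤ[].zero-in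
  clear-denominators (q ∷ g) x with denominator-times q | clear-denominators g x
  ... | d , i , e | k , k≢0 , h∈ =
    + suc d ℤ.* k , (λ e → case-⊎ (ℤ.i*j≡0⇒i≡0∨j≡0 (+ suc d) e)) ,
    ℤ[].resp-in (begin
      ⟦ k ⟧ℤ * ⟦ i ⟧ℤ + ⟦ + suc d ⟧ℤ * (x * (⟦ k ⟧ℤ * h))     ≈⟨ +-congʳ (*-congˡ e) ⟨
      ⟦ k ⟧ℤ * (⟦ + suc d ⟧ℤ * ι q) + ⟦ + suc d ⟧ℤ * (x * (⟦ k ⟧ℤ * h))
        ≈⟨ solve 5 (λ d k q x h → k :* (d :* q) :+ d :* (x :* (k :* h)) := d :* k :* (q :+ x :* h)) refl ⟦ + suc d ⟧ℤ ⟦ k ⟧ℤ (ι q) x h ⟩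
      ⟦ + suc d ⟧ℤ * ⟦ k ⟧ℤ * (ι q + x * h)                   ≈⟨ *-congʳ (ℤ-*-homo (+ suc d) k) ⟨
      ⟦ + suc d ℤ.* k ⟧ℤ * (ι q + x * h)                      ∎)
      (ℤ[].add-in (ℤ[].mul-in (int-in k) (int-in i)) (ℤ[].mul-in (int-in (+ suc d)) (ℤ[].mul-in var-in h∈)))
    where
    h = K[x].eval (List.map ι g) x
    case-⊎ : (+ suc d ≡ ℤ.0ℤ) ⊎ (k ≡ ℤ.0ℤ) → _
    case-⊎ (inj₂ k≡0) = k≢0 k≡0

  -- A substitute for the norm: a positive integer in vℤ[v]. Whatever divides v in a larger ring
  -- divides this integer, which bounds the primes to be feared. It comes from an algebraic relation
  -- vh = q with denominators cleared and the sign adjusted.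
  integer-multiple : ∀ {v} → v ≉ 0# → ∃[ k ] ∃[ u ] ℤ[ v ] u × v * u ≈ ⟦ + suc k ⟧ℤ
  integer-multiple {v} v≉0 with algebraic v
  ... | f , f≉[] , root with algebraic-relation f f≉[] v≉0 root
  ...   | q , g , q≢0 , vh≈q with clear-denominators g v | denominator-times q
  ... | k , k≢0 , kh∈ | d , i , dq≈i = positive (k ℤ.* i) ki≢0 (ℤ[].mul-in (int-in (+ suc d)) kh∈) (begin
    v * (⟦ + suc d ⟧ℤ * (⟦ k ⟧ℤ * h)) ≈⟨ solve 4 (λ v d k h → v :* (d :* (k :* h)) := k :* (d :* (v :* h))) refl v ⟦ + suc d ⟧ℤ ⟦ k ⟧ℤ h ⟩
    ⟦ k ⟧ℤ * (⟦ + suc d ⟧ℤ * (v * h))    ≈⟨ *-congˡ (*-congˡ vh≈q) ⟩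
    ⟦ k ⟧ℤ * (⟦ + suc d ⟧ℤ * ι q)        ≈⟨ *-congˡ dq≈i ⟩
    ⟦ k ⟧ℤ * ⟦ i ⟧ℤ                      ≈⟨ ℤ-*-homo k i ⟨
    ⟦ k ℤ.* i ⟧ℤ                         ∎)
    where
    h = K[x].eval (List.map ι g) v
    i≢0 : ¬ i ≡ ℤ.0ℤ
    i≢0 ≡.refl = *-≉0 (⟦⟧ℤ-nonzero {+ suc d} λ ()) (ι-nonzero q≢0) dq≈i
    ki≢0 : ¬ k ℤ.* i ≡ ℤ.0ℤ
    ki≢0 e with ℤ.i*j≡0⇒i≡0∨j≡0 k e
    ... | inj₁ k≡0 = k≢0 k≡0
    ... | inj₂ i≡0 = i≢0 i≡0
    positive : ∀ i → ¬ i ≡ ℤ.0ℤ → ∀ {u} → ℤ[ v ] u → v * u ≈ ⟦ i ⟧ℤ → ∃[ k ] ∃[ u ] ℤ[ v ] u × v * u ≈ ⟦ + suc k ⟧ℤ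
    positive (+ zero)  i≢0 u∈ e = contradiction ≡.refl i≢0
    positive (+ suc k) i≢0 u∈ e = k , _ , u∈ , e
    positive -[1+ k ]  i≢0 u∈ e = k , _ , ℤ[].neg-in u∈ ,
      trans (sym (-‿distribʳ-* _ _)) (trans (-‿cong e) (-‿involutive _))

  -- No integer q ≥ 2 is invertible in ℤ[ζ]: the matrix I − qH is invertible over ℚ,
  -- by elimination, since pivots stay congruent to 1 modulo q.

  module _ {q : ℕ} (2≤q : 2 ℕ.≤ q) where

    private Q = ⟦ + q ⟧ℤ

    ≡1modQ : Pred Carrier ℓ₁
    ≡1modQ x = ∃[ i ] x ≈ 1# + Q * ⟦ i ⟧ℤ

    ≡1modQ⇒≉0 : ∀ {x} → ≡1modQ x → x ≉ 0#
    ≡1modQ⇒≉0 (i , x≈) x≈0 = ⟦⟧ℤ-nonzero {1ℤ ℤ.+ + q ℤ.* i} ≢0 (begin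
      ⟦ 1ℤ ℤ.+ + q ℤ.* i ⟧ℤ       ≈⟨ ℤ-+-homo 1ℤ (+ q ℤ.* i) ⟩
      1# + ⟦ + q ℤ.* i ⟧ℤ         ≈⟨ +-congˡ (ℤ-*-homo (+ q) i) ⟩
      1# + Q * ⟦ i ⟧ℤ             ≈⟨ x≈ ⟨
      _                           ≈⟨ x≈0 ⟩
      0#                          ∎)
      where
      ≢0 : ¬ 1ℤ ℤ.+ + q ℤ.* i ≡ ℤ.0ℤ
      ≢0 e = ℕ.<⇒≢ 2≤q (≡.sym (ℕ.m*n≡1⇒m≡1 q ℤ.∣ i ∣
        (≡.trans (≡.sym (ℤ.abs-* (+ q) i)) (≡.trans (≡.cong ℤ.∣_∣ qi≡-1) ≡.refl))))
        where
        qi≡-1 : + q ℤ.* i ≡ ℤ.-1ℤ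
        qi≡-1 = ≡.trans (lemma (+ q ℤ.* i)) (≡.cong (ℤ._+ ℤ.-1ℤ) e)
          where
          lemma : ∀ x → x ≡ 1ℤ ℤ.+ x ℤ.+ ℤ.-1ℤ
          lemma = ℤ-solve-∀

    ≡1modQ-* : ∀ {x y} → ≡1modQ x → ≡1modQ y → ≡1modQ (x * y)
    ≡1modQ-* {x} {y} (i , x≈) (j , y≈) = i ℤ.+ j ℤ.+ + q ℤ.* (i ℤ.* j) , (begin
      x * y                                       ≈⟨ *-cong x≈ y≈ ⟩
      (1# + Q * I) * (1# + Q * J) ≈⟨ solve 3 (λ q i j → (con 1ℤ :+ q :* i) :* (con 1ℤ :+ q :* j) := con 1ℤ :+ q :* (i :+ j :+ q :* (i :* j))) refl Q I J ⟩
      1# + Q * (I + J + Q * (I * J)) ≈⟨ +-congˡ (*-congˡ (+-cong (ℤ-+-homo i j) (trans (ℤ-*-homo (+ q) (i ℤ.* j)) (*-congˡ (ℤ-*-homo i j))))) ⟨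
      1# + Q * (⟦ i ℤ.+ j ⟧ℤ + ⟦ + q ℤ.* (i ℤ.* j) ⟧ℤ)  ≈⟨ +-congˡ (*-congˡ (ℤ-+-homo (i ℤ.+ j) _)) ⟨
      1# + Q * ⟦ i ℤ.+ j ℤ.+ + q ℤ.* (i ℤ.* j) ⟧ℤ ∎)
      where I = ⟦ i ⟧ℤ ; J = ⟦ j ⟧ℤ

    ≡1modQ-sub : ∀ {x h} → ≡1modQ x → Int h → ≡1modQ (x - Q * h)
    ≡1modQ-sub {x} {h} (i , x≈) (j , h≈) = i ℤ.- j , (begin
      x - Q * h                               ≈⟨ +-cong x≈ (-‿cong (*-congˡ h≈)) ⟩
      1# + Q * ⟦ i ⟧ℤ - Q * ⟦ j ⟧ℤ ≈⟨ solve 3 (λ q i j → con 1ℤ :+ q :* i :- q :* j := con 1ℤ :+ q :* (i :+ :- j)) refl Q ⟦ i ⟧ℤ ⟦ j ⟧ℤ ⟩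
      1# + Q * (⟦ i ⟧ℤ + - ⟦ j ⟧ℤ)            ≈⟨ +-congˡ (*-congˡ (+-congˡ (ℤ-neg-homo j))) ⟨
      1# + Q * (⟦ i ⟧ℤ + ⟦ ℤ.- j ⟧ℤ)          ≈⟨ +-congˡ (*-congˡ (ℤ-+-homo i (ℤ.- j))) ⟨
      1# + Q * ⟦ i ℤ.- j ⟧ℤ                   ∎)

    kernel-trivial : ∀ d (y u : Fin d → Carrier) (H : Fin d → Fin d → Carrier) →
                     (∀ i → ≡1modQ (u i)) → (∀ i j → Int (H i j)) →
                     (∀ i → u i * y i ≈ Q * sum (λ j → H i j * y j)) → ∀ i → y i ≈ 0#
    kernel-trivial (suc d) y u H u∈ H∈ eq = y≈0
      where
      open IsSubring Int-isSubring using () renaming (add-in to int-+; mul-in to int-*)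
      Q∈ : Int Q
      Q∈ = + q , refl
      H₀₀ = H zero zero
      w = u zero - Q * H₀₀
      w∈ : ≡1modQ w
      w∈ = ≡1modQ-sub (u∈ zero) (H∈ zero zero)
      w∈Int : Int w
      w∈Int = IsSubring.resp-in Int-isSubring (sym (proj₂ w∈))
        (int-+ (1ℤ , refl) (int-* Q∈ (proj₁ w∈ , refl)))
      y₀ = y zero
      S : Fin (suc d) → Carrier
      S i = sum (λ j → H i (suc j) * y (suc j))
      pivot : w * y₀ ≈ Q * S zero
      pivot = begin
        (u zero - Q * H₀₀) * y₀ ≈⟨ solve 4 (λ u q h y → (u :- q :* h) :* y := u :* y :- q :* (h :* y)) refl (u zero) Q H₀₀ y₀ ⟩
        u zero * y₀ - Q * (H₀₀ * y₀)                ≈⟨ +-congʳ (eq zero) ⟩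
        Q * (H₀₀ * y₀ + S zero) - Q * (H₀₀ * y₀) ≈⟨ solve 3 (λ q x s → q :* (x :+ s) :- q :* x := q :* s) refl Q (H₀₀ * y₀) (S zero) ⟩
        Q * S zero                                  ∎
      -- Fraction-free elimination: a row is multiplied by the pivot w and w y₀ is replaced using
      -- the first row. Entries stay integral, and the new diagonal factor w uᵢ is again 1 modulo q.
      H′ : Fin d → Fin d → Carrier
      H′ i j = Q * H (suc i) zero * H zero (suc j) + w * H (suc i) (suc j)
      row : ∀ i → w * u (suc i) * y (suc i) ≈ Q * sum (λ j → H′ i j * y (suc j))
      row i = begin
        w * u (suc i) * y (suc i)                   ≈⟨ *-assoc _ _ _ ⟩
        w * (u (suc i) * y (suc i))                 ≈⟨ *-congˡ (eq (suc i)) ⟩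
        w * (Q * (h * y₀ + S (suc i))) ≈⟨ solve 5 (λ w q h y s → w :* (q :* (h :* y :+ s)) := q :* (h :* (w :* y) :+ w :* s)) refl w Q h y₀ (S (suc i)) ⟩
        Q * (h * (w * y₀) + w * S (suc i))          ≈⟨ *-congˡ (+-congʳ (*-congˡ pivot)) ⟩
        Q * (h * (Q * S zero) + w * S (suc i)) ≈⟨ *-congˡ (+-congʳ (solve 3 (λ h q s → h :* (q :* s) := q :* h :* s) refl h Q (S zero))) ⟩
        Q * (Q * h * S zero + w * S (suc i)) ≈⟨ *-congˡ (+-cong (*-distribˡ-sum (Q * h) t₀) (*-distribˡ-sum w tᵢ)) ⟩
        Q * (sum (λ j → Q * h * t₀ j) + sum (λ j → w * tᵢ j))
                                                    ≈⟨ *-congˡ (∑-distrib-+ (λ j → Q * h * t₀ j) (λ j → w * tᵢ j)) ⟨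
        Q * sum (λ j → Q * h * t₀ j + w * tᵢ j) ≈⟨ *-congˡ (sum-cong-≋ λ j → solve 5 (λ a b c w y → a :* (b :* y) :+ w :* (c :* y) := (a :* b :+ w :* c) :* y) refl (Q * h) (H zero (suc j)) (H (suc i) (suc j)) w (y (suc j))) ⟩
        Q * sum (λ j → H′ i j * y (suc j))          ∎
        where
        h = H (suc i) zero
        t₀ tᵢ : Fin d → Carrier
        t₀ j = H zero (suc j) * y (suc j)
        tᵢ j = H (suc i) (suc j) * y (suc j)
      rest≈0 : ∀ i → y (suc i) ≈ 0#
      rest≈0 = kernel-trivial d (y ∘ suc) (λ i → w * u (suc i)) H′
        (λ i → ≡1modQ-* w∈ (u∈ (suc i)))
        (λ i j → int-+ (int-* (int-* Q∈ (H∈ (suc i) zero)) (H∈ zero (suc j))) (int-* w∈Int (H∈ (suc i) (suc j))))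
        row
      sum≈0 : ∀ {d} (t : Fin d → Carrier) → (∀ j → t j ≈ 0#) → sum t ≈ 0#
      sum≈0 {zero}  t t≈0 = refl
      sum≈0 {suc d} t t≈0 = trans (+-cong (t≈0 zero) (sum≈0 (t ∘ suc) (t≈0 ∘ suc))) (+-identityʳ 0#)
      y≈0 : ∀ i → y i ≈ 0#
      y≈0 (suc i) = rest≈0 i
      y≈0 zero    = no-zero-divisors (≡1modQ⇒≉0 w∈)
        (trans pivot (trans (*-congˡ (sum≈0 _ λ j → trans (*-congˡ (rest≈0 j)) (zeroʳ _))) (zeroʳ Q)))

    -- Expanding w ζⁱ in the spanning set 1, ζ, ..., ζ^m turns qw = 1 into ζⁱ = q Σ Hᵢⱼ ζʲ with
    -- integral H. The vector of powers of ζ is then in the kernel of I - qH, yet its first entry is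
    -- 1.
    not-invertible : ∀ {m ζ} → ζ ^ suc m ≈ 1# → ∀ {w} → ℤ[ ζ ] w → ¬ (Q * w ≈ 1#)
    not-invertible {m} {ζ} ζⁿ≈1 {w} w∈ Qw≈1 =
      1≉0 (kernel-trivial (suc m) (λ i → ζ ^ toℕ i) (λ _ → 1#) (λ i → proj₁ (reduced i))
        (λ _ → ℤ.0ℤ , sym (trans (+-congˡ (zeroʳ Q)) (+-identityʳ 1#)))
        (λ i → proj₁ (proj₂ (reduced i)))
        (λ i → begin
          1# * ζ ^ toℕ i                                              ≈⟨ *-congʳ Qw≈1 ⟨
          Q * w * ζ ^ toℕ i                                           ≈⟨ *-assoc _ _ _ ⟩
          Q * (w * ζ ^ toℕ i) ≈⟨ *-congˡ (proj₂ (proj₂ (reduced i))) ⟩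
          Q * horner 0# (proj₁ (reduced i)) ζ ≈⟨ *-congˡ (horner-sum (proj₁ (reduced i)) ζ) ⟩
          Q * sum (λ j → proj₁ (reduced i) j * ζ ^ toℕ j)             ∎)
        zero)
      where
      pure∈ : ∀ j → Int (pure m 1# j)
      pure∈ zero    = ℤ.-1ℤ , refl
      pure∈ (suc j) = ℤ.0ℤ , refl
      open MonicExtension Int-isSubring (pure m 1#) pure∈ ζ (pure-root m ζⁿ≈1)
      reduced : ∀ (i : Fin (suc m)) → Reduced (w * ζ ^ toℕ i)
      reduced i = reduce (ℤ[].mul-in w∈ (ℤ[].pow-in (toℕ i) var-in))

  -- The Frobenius congruence modulo an odd prime.

  odd-power : ∀ m → ¬ 2 ℕ.∣ m → ∀ x → (- x) ^ m ≈ - (x ^ m)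
  odd-power zero          2∤m x = contradiction (2 ℕ.∣0) 2∤m
  odd-power (suc zero)    2∤m x = sym (-‿distribˡ-* x 1#)
  odd-power (suc (suc m)) 2∤m x = begin
    - x * (- x * (- x) ^ m) ≈⟨ *-congˡ (*-congˡ (odd-power m (λ 2∣m → 2∤m (ℕ.∣m∣n⇒∣m+n ℕ.∣-refl 2∣m)) x)) ⟩
    - x * (- x * - (x ^ m)) ≈⟨ solve 2 (λ x p → (:- x) :* ((:- x) :* (:- p)) := :- (x :* (x :* p))) refl x (x ^ m) ⟩
    - (x * (x * x ^ m))       ∎

  module _ {p} {D : Pred Carrier p} (isC : IsSubring D) where

    open IsSubring isC

    ·-in : ∀ k {x} → D x → D (k · x)
    ·-in zero    x∈ = zero-in
    ·-in (suc k) x∈ = add-in x∈ (·-in k x∈)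

    MultipleOf : Carrier → Pred Carrier _
    MultipleOf Q x = ∃[ r ] D r × x ≈ Q * r

    sum-multiple : ∀ {Q d} (t : Fin d → Carrier) → (∀ j → MultipleOf Q (t j)) → MultipleOf Q (sum t)
    sum-multiple {Q} {zero}  t t∈ = 0# , zero-in , sym (zeroʳ Q)
    sum-multiple {Q} {suc d} t t∈ with t∈ zero | sum-multiple (t ∘ suc) (t∈ ∘ suc)
    ... | r , r∈ , e | r′ , r′∈ , e′ = r + r′ , add-in r∈ r′∈ , trans (+-cong e e′) (sym (distribˡ Q r r′))

    -- The inner binomial coefficients are divisible by q. The quotient r is kept in D, since a
    -- congruence modulo q has content only inside a ring where q is not a unit.
    freshman : ∀ {q} → Prime q → ∀ {x y} → D x → D y → ∃[ r ] D r × (x + y) ^ q ≈ x ^ q + y ^ q + ⟦ + q ⟧ℤ * r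
    freshman {zero}  q-prime = contradiction q-prime ¬prime[0]
    freshman {suc m} q-prime {x} {y} x∈ y∈ = r , r∈ , (begin
      (x + y) ^ q                                       ≈⟨ Binomial.theorem q x y ⟩
      term zero + sum (term ∘ suc)                      ≈⟨ +-cong first (sum-init-last (term ∘ suc)) ⟩
      y ^ q + (sum (init (term ∘ suc)) + last (term ∘ suc))  ≈⟨ +-congˡ (+-cong middle final) ⟩
      y ^ q + (Q * r + x ^ q) ≈⟨ solve 3 (λ a b c → b :+ (c :+ a) := a :+ b :+ c) refl (x ^ q) (y ^ q) (Q * r) ⟩
      x ^ q + y ^ q + Q * r                             ∎)
      where
      module Binomial = Algebra.Properties.CommutativeSemiring.Binomial
        (CommutativeRing.commutativeSemiring commutativeRing)
      open Algebra.Properties.Semiring.Sum semiring using (sum-init-last)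
      open Vector using (init; last)
      q = suc m
      Q = ⟦ + q ⟧ℤ
      term : Fin (suc q) → Carrier
      term = Binomial.binomialTerm x y q
      first : term zero ≈ y ^ q
      first = trans (+-identityʳ _) (*-identityˡ _)
      final : last (term ∘ suc) ≈ x ^ q
      final = begin
        (q C (toℕ (suc (fromℕ m)))) · (x ^ toℕ (suc (fromℕ m)) * y ^ (q ℕ.∸ toℕ (suc (fromℕ m))))
          ≡⟨ ≡.cong (λ k → (q C (suc k)) · (x ^ suc k * y ^ (m ℕ.∸ k))) (Fin.toℕ-fromℕ m) ⟩
        (q C q) · (x ^ q * y ^ (m ℕ.∸ m)) ≡⟨ ≡.cong₂ (λ c k → c · (x ^ q * y ^ k)) (nCn≡1 q) (ℕ.n∸n≡0 m) ⟩
        x ^ q * 1# + 0#                     ≈⟨ trans (+-identityʳ _) (*-identityʳ _) ⟩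
        x ^ q                               ∎
      inner : ∀ (j : Fin m) → MultipleOf Q (term (suc (inject₁ j)))
      inner j with prime∣binomial q-prime {suc (toℕ (inject₁ j))} (ℕ.s≤s ℕ.z≤n)
                     (ℕ.s≤s (≡.subst (ℕ._< m) (≡.sym (Fin.toℕ-inject₁ j)) (Fin.toℕ<n j)))
      ... | ℕ.divides k e = k · z , ·-in k (mul-in (pow-in (suc (toℕ (inject₁ j))) x∈) (pow-in (q ℕ.∸ suc (toℕ (inject₁ j))) y∈)) , (begin
        (q C (suc (toℕ (inject₁ j)))) · z   ≡⟨ ≡.cong (_· z) (≡.trans e (ℕ.*-comm k q)) ⟩
        (q ℕ.* k) · z                     ≈⟨ ·-assoc q k z ⟨
        q · (k · z)                       ≈⟨ ·-congʳ q (*-identityˡ _) ⟨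
        q · (1# * (k · z))                ≈⟨ ·-*-assoc q 1# (k · z) ⟨
        q · 1# * (k · z)                  ≈⟨ *-congʳ (·≈⟦⟧ℤ q) ⟩
        Q * (k · z)                       ∎)
        where
        z = x ^ suc (toℕ (inject₁ j)) * y ^ (q ℕ.∸ suc (toℕ (inject₁ j)))
        open Algebra.Properties.Semiring.Mult semiring using ()
          renaming (×-assocˡ to ·-assocˡ; ×-congʳ to ·-congʳ; ×-assoc-* to ·-*-assoc)
        ·-assoc : ∀ m n x → m · (n · x) ≈ (m ℕ.* n) · x
        ·-assoc m n x = ·-assocˡ x m n
      multiple = sum-multiple (init (term ∘ suc)) inner
      r = proj₁ multiple
      r∈ : D r
      r∈ = proj₁ (proj₂ multiple)
      middle : sum (init (term ∘ suc)) ≈ Q * r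
      middle = proj₂ (proj₂ multiple)

  -- Terms rather than coefficient lists: the Frobenius congruence is then an
  -- induction on the term.
  data ℤ[X] : Set where
    𝟙 X     : ℤ[X]
    ⊝_      : ℤ[X] → ℤ[X]
    _⊕_ _⊗_ : ℤ[X] → ℤ[X] → ℤ[X]

  ⟦_⟧ : ℤ[X] → Carrier → Carrier
  ⟦ 𝟙 ⟧     z = 1#
  ⟦ X ⟧     z = z
  ⟦ ⊝ e ⟧   z = - ⟦ e ⟧ z
  ⟦ e ⊕ f ⟧ z = ⟦ e ⟧ z + ⟦ f ⟧ z
  ⟦ e ⊗ f ⟧ z = ⟦ e ⟧ z * ⟦ f ⟧ z

  ⟦⟧-cong : ∀ e {y z} → y ≈ z → ⟦ e ⟧ y ≈ ⟦ e ⟧ z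
  ⟦⟧-cong 𝟙       y≈z = refl
  ⟦⟧-cong X       y≈z = y≈z
  ⟦⟧-cong (⊝ e)   y≈z = -‿cong (⟦⟧-cong e y≈z)
  ⟦⟧-cong (e ⊕ f) y≈z = +-cong (⟦⟧-cong e y≈z) (⟦⟧-cong f y≈z)
  ⟦⟧-cong (e ⊗ f) y≈z = *-cong (⟦⟧-cong e y≈z) (⟦⟧-cong f y≈z)

  ⟦⟧-in : ∀ e {z} → ℤ[ z ] (⟦ e ⟧ z)
  ⟦⟧-in 𝟙       = ℤ[].one-in
  ⟦⟧-in X       = var-in
  ⟦⟧-in (⊝ e)   = ℤ[].neg-in (⟦⟧-in e)
  ⟦⟧-in (e ⊕ f) = ℤ[].add-in (⟦⟧-in e) (⟦⟧-in f)
  ⟦⟧-in (e ⊗ f) = ℤ[].mul-in (⟦⟧-in e) (⟦⟧-in f)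

  -- The generators 𝟙 and X satisfy it with w = 0. Sums use `freshman`, products multiply the
  -- congruences, and the oddness of q lets the sign pass through the power.
  frobenius : ∀ {q} → Prime q → ¬ 2 ℕ.∣ q → ∀ e z →
              ∃[ w ] ℤ[ z ] w × ⟦ e ⟧ (z ^ q) ≈ ⟦ e ⟧ z ^ q + ⟦ + q ⟧ℤ * w
  frobenius {q} q-prime 2∤q 𝟙 z = 0# , ℤ[].zero-in ,
    sym (trans (+-cong (1^ q) (zeroʳ _)) (+-identityʳ _))
  frobenius {q} q-prime 2∤q X z = 0# , ℤ[].zero-in ,
    sym (trans (+-congˡ (zeroʳ _)) (+-identityʳ _))
  frobenius {q} q-prime 2∤q (⊝ e) z with frobenius q-prime 2∤q e z
  ... | w , w∈ , eq = - w , ℤ[].neg-in w∈ , (begin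
    - ⟦ e ⟧ (z ^ q)                        ≈⟨ -‿cong eq ⟩
    - (⟦ e ⟧ z ^ q + ⟦ + q ⟧ℤ * w) ≈⟨ solve 3 (λ x q w → :- (x :+ q :* w) := :- x :+ q :* (:- w)) refl (⟦ e ⟧ z ^ q) ⟦ + q ⟧ℤ w ⟩
    - (⟦ e ⟧ z ^ q) + ⟦ + q ⟧ℤ * - w       ≈⟨ +-congʳ (odd-power q 2∤q (⟦ e ⟧ z)) ⟨
    (- ⟦ e ⟧ z) ^ q + ⟦ + q ⟧ℤ * - w       ∎)
  frobenius {q} q-prime 2∤q (e ⊕ f) z
    with frobenius q-prime 2∤q e z | frobenius q-prime 2∤q f z
       | freshman ⟪⟫-isSubring q-prime (⟦⟧-in e {z}) (⟦⟧-in f {z})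
  ... | w , w∈ , eq | v , v∈ , eq′ | r , r∈ , eq″ = w + v - r , ℤ[].sub-in (ℤ[].add-in w∈ v∈) r∈ , (begin
    ⟦ e ⟧ (z ^ q) + ⟦ f ⟧ (z ^ q)          ≈⟨ +-cong eq eq′ ⟩
    A + Q * w + (B + Q * v) ≈⟨ solve 6 (λ a b q w v r → a :+ q :* w :+ (b :+ q :* v) := a :+ b :+ q :* r :+ q :* (w :+ v :- r)) refl A B Q w v r ⟩
    A + B + Q * r + Q * (w + v - r)        ≈⟨ +-congʳ eq″ ⟨
    (⟦ e ⟧ z + ⟦ f ⟧ z) ^ q + Q * (w + v - r)  ∎)
    where
    A = ⟦ e ⟧ z ^ q ; B = ⟦ f ⟧ z ^ q ; Q = ⟦ + q ⟧ℤ
  frobenius {q} q-prime 2∤q (e ⊗ f) z with frobenius q-prime 2∤q e z | frobenius q-prime 2∤q f z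
  ... | w , w∈ , eq | v , v∈ , eq′ =
    A * v + w * B + Q * (w * v) ,
    ℤ[].add-in (ℤ[].add-in (ℤ[].mul-in (ℤ[].pow-in q (⟦⟧-in e)) v∈) (ℤ[].mul-in w∈ (ℤ[].pow-in q (⟦⟧-in f))))
               (ℤ[].mul-in (int-in (+ q)) (ℤ[].mul-in w∈ v∈)) , (begin
    ⟦ e ⟧ (z ^ q) * ⟦ f ⟧ (z ^ q)                       ≈⟨ *-cong eq eq′ ⟩
    (A + Q * w) * (B + Q * v) ≈⟨ solve 5 (λ a b q w v → (a :+ q :* w) :* (b :+ q :* v) := a :* b :+ q :* (a :* v :+ w :* b :+ q :* (w :* v))) refl A B Q w v ⟩
    A * B + Q * (A * v + w * B + Q * (w * v))           ≈⟨ +-congʳ (^-distrib-* (⟦ e ⟧ z) (⟦ f ⟧ z) q) ⟨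
    (⟦ e ⟧ z * ⟦ f ⟧ z) ^ q + Q * (A * v + w * B + Q * (w * v))  ∎)
    where
    A = ⟦ e ⟧ z ^ q ; B = ⟦ f ⟧ z ^ q ; Q = ⟦ + q ⟧ℤ

  -- Landau's argument: a prime q larger than the integers N below cannot
  -- divide a nonzero conjugate, so it maps zeros to zeros.
  module _ {m ζ} (prim : IsPrimitiveRootOfUnity (suc m) ζ) where

    open PowersOfPrimitiveRoot prim

    private n = suc m

    -- Vacuous where the value is zero, so that a single A can serve all exponents s.
    Bounded : ℤ[X] → ℕ → Pred ℕ _
    Bounded e A s = ⟦ e ⟧ (ζ ^ s) ≉ 0# → ∃[ N ] N ℕ.< A × ∃[ u ] ℤ[ ζ ] u × ⟦ e ⟧ (ζ ^ s) * u ≈ ⟦ + suc N ⟧ℤ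

    bounded-mono : ∀ e {A B s} → A ℕ.≤ B → Bounded e A s → Bounded e B s
    bounded-mono e A≤B small v≉0 = let N , N<A , rest = small v≉0 in N , ℕ.<-≤-trans N<A A≤B , rest

    bounded : ∀ e s → ∃[ A ] Bounded e A s
    bounded e s = decide (⟦ e ⟧ (ζ ^ s) ≟ 0#)
      where
      decide : Dec (⟦ e ⟧ (ζ ^ s) ≈ 0#) → ∃[ A ] Bounded e A s
      decide (yes v≈0) = 0 , λ v≉0 → contradiction v≈0 v≉0
      decide (no v≉0)  =
        let N , u , u∈ , eq = integer-multiple v≉0
        in suc N , λ _ → N , ℕ.n<1+n N , u , ℤ[]-mono (ℤ[]-mono (ℤ[].pow-in s var-in) (⟦⟧-in e)) u∈ , eq

    -- The start at 2 makes every prime above A odd, as `frobenius` demands, and it lets the prime 2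
    -- rule out the representative 0 of a residue class. Exponents below n are enough later, because
    -- ζˢ depends on s modulo n only.
    uniform-bound : ∀ e k → ∃[ A ] 2 ℕ.≤ A × (∀ s → s ℕ.< k → Bounded e A s)
    uniform-bound e zero    = 2 , ℕ.≤-refl , λ s ()
    uniform-bound e (suc k) =
      let A , 2≤A , small = uniform-bound e k
          B , small-k     = bounded e k
      in A ℕ.+ B , ℕ.≤-trans 2≤A (ℕ.m≤m+n A B) , λ s s<1+k → extend s (ℕ.m≤n⇒m<n∨m≡n (ℕ.s≤s⁻¹ s<1+k)) small small-k
      where
      extend : ∀ {A B} s → s ℕ.< k ⊎ s ≡ k → (∀ s → s ℕ.< k → Bounded e A s) → Bounded e B k → Bounded e (A ℕ.+ B) s
      extend {A} {B} s (inj₁ s<k)    small small-k = bounded-mono e {s = s} (ℕ.m≤m+n A B) (small s s<k)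
      extend {A} {B} s (inj₂ ≡.refl) small small-k = bounded-mono e {s = s} (ℕ.m≤n+m B A) small-k

    large-prime-step : ∀ e {A q} → 2 ℕ.≤ A →
      (∀ s → s ℕ.< n → Bounded e A s) →
      Prime q → A ℕ.< q → ∀ s → ⟦ e ⟧ (ζ ^ s) ≈ 0# → ⟦ e ⟧ (ζ ^ (s ℕ.* q)) ≈ 0#
    large-prime-step e {A} {q} 2≤A small q-prime A<q s v≈0 with ⟦ e ⟧ (ζ ^ (s ℕ.* q)) ≟ 0#
    ... | yes v′≈0 = v′≈0
    ... | no v′≉0 with small (s ℕ.* q ℕ.% n) (ℕ.m%n<n (s ℕ.* q) n)
                         (λ e≈0 → v′≉0 (trans (⟦⟧-cong e (ζ^-% (s ℕ.* q))) e≈0))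
                     | frobenius q-prime (prime>2⇒odd q-prime (ℕ.≤-<-trans 2≤A A<q)) e (ζ ^ s)
    ...   | N , N<A , u , u∈ , eq | w , w∈ , frob = contradiction Q∣1 (λ (z , z∈ , Qz≈1) →
              not-invertible (ℕ.≤-trans 2≤A (ℕ.<⇒≤ A<q)) {m} ζ^n≈1 z∈ Qz≈1)
      where
      Q = ⟦ + q ⟧ℤ
      M = ⟦ + suc N ⟧ℤ
      0<q : 0 ℕ.< q
      0<q = ℕ.≤-<-trans ℕ.z≤n A<q
      wu∈ : ℤ[ ζ ] (w * u)
      wu∈ = ℤ[].mul-in (ℤ[]-mono (ℤ[].pow-in s var-in) w∈) u∈
      Qwu≈M : Q * (w * u) ≈ M
      Qwu≈M = begin
        Q * (w * u)                                        ≈⟨ *-assoc Q w u ⟨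
        Q * w * u                                          ≈⟨ *-congʳ (+-identityˡ _) ⟨
        (0# + Q * w) * u ≈⟨ *-congʳ (+-congʳ (trans (^-congˡ q v≈0) (0^ q 0<q))) ⟨
        (⟦ e ⟧ (ζ ^ s) ^ q + Q * w) * u                    ≈⟨ *-congʳ frob ⟨
        ⟦ e ⟧ ((ζ ^ s) ^ q) * u ≈⟨ *-congʳ (⟦⟧-cong e (trans (^-assocʳ ζ s q) (ζ^-% (s ℕ.* q)))) ⟩
        ⟦ e ⟧ (ζ ^ (s ℕ.* q ℕ.% n)) * u                    ≈⟨ eq ⟩
        M                                                  ∎
      nat-* : ∀ x y → ⟦ + (x ℕ.* y) ⟧ℤ ≈ ⟦ + x ⟧ℤ * ⟦ + y ⟧ℤ
      nat-* x y = trans (reflexive (≡.cong ⟦_⟧ℤ (ℤ.pos-* x y))) (ℤ-*-homo (+ x) (+ y))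
      -- q divides the integer `suc N` in ℤ[ζ], and `suc N` is below q, hence prime to it; Bézout
      -- makes q a unit.
      Q∣1 : ∃[ z ] ℤ[ ζ ] z × Q * z ≈ 1#
      Q∣1 with ℕ.coprime-Bézout (ℕ.sym (ℕ.prime⇒coprime q-prime (ℕ.≤-<-trans N<A A<q)))
      ... | Bézout.+- x y 1+yq≡xM = ⟦ + x ⟧ℤ * (w * u) - ⟦ + y ⟧ℤ ,
        ℤ[].sub-in (ℤ[].mul-in (int-in (+ x)) wu∈) (int-in (+ y)) , (begin
          Q * (⟦ + x ⟧ℤ * (w * u) - ⟦ + y ⟧ℤ) ≈⟨ solve 4 (λ q x y v → q :* (x :* v :- y) := x :* (q :* v) :- y :* q) refl Q ⟦ + x ⟧ℤ ⟦ + y ⟧ℤ (w * u) ⟩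
          ⟦ + x ⟧ℤ * (Q * (w * u)) - ⟦ + y ⟧ℤ * Q      ≈⟨ +-congʳ (*-congˡ Qwu≈M) ⟩
          ⟦ + x ⟧ℤ * M - ⟦ + y ⟧ℤ * Q ≈⟨ +-congʳ (trans (sym (nat-* x (suc N))) (reflexive (≡.cong (λ k → ⟦ + k ⟧ℤ) (≡.sym 1+yq≡xM)))) ⟩
          ⟦ + (1 ℕ.+ y ℕ.* q) ⟧ℤ - ⟦ + y ⟧ℤ * Q ≈⟨ +-congʳ (trans (ℤ-+-homo (+ 1) (+ (y ℕ.* q))) (+-congˡ (nat-* y q))) ⟩
          1# + ⟦ + y ⟧ℤ * Q - ⟦ + y ⟧ℤ * Q ≈⟨ solve 1 (λ x → con 1ℤ :+ x :- x := con 1ℤ) refl (⟦ + y ⟧ℤ * Q) ⟩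
          1#                                           ∎)
      ... | Bézout.-+ x y 1+xM≡yq = ⟦ + y ⟧ℤ - ⟦ + x ⟧ℤ * (w * u) ,
        ℤ[].sub-in (int-in (+ y)) (ℤ[].mul-in (int-in (+ x)) wu∈) , (begin
          Q * (⟦ + y ⟧ℤ - ⟦ + x ⟧ℤ * (w * u)) ≈⟨ solve 4 (λ q x y v → q :* (y :- x :* v) := y :* q :- x :* (q :* v)) refl Q ⟦ + x ⟧ℤ ⟦ + y ⟧ℤ (w * u) ⟩
          ⟦ + y ⟧ℤ * Q - ⟦ + x ⟧ℤ * (Q * (w * u)) ≈⟨ +-cong (trans (sym (nat-* y q)) (reflexive (≡.cong (λ k → ⟦ + k ⟧ℤ) (≡.sym 1+xM≡yq)))) (-‿cong (*-congˡ Qwu≈M)) ⟩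
          ⟦ + (1 ℕ.+ x ℕ.* suc N) ⟧ℤ - ⟦ + x ⟧ℤ * M ≈⟨ +-congʳ (trans (ℤ-+-homo (+ 1) (+ (x ℕ.* suc N))) (+-congˡ (nat-* x (suc N)))) ⟩
          1# + ⟦ + x ⟧ℤ * M - ⟦ + x ⟧ℤ * M ≈⟨ solve 1 (λ x → con 1ℤ :+ x :- x := con 1ℤ) refl (⟦ + x ⟧ℤ * M) ⟩
          1#                                           ∎)

    conjugate-vanishes : ∀ e t → ℕ.Coprime t n → ⟦ e ⟧ ζ ≈ 0# → ⟦ e ⟧ (ζ ^ t) ≈ 0#
    conjugate-vanishes e t t⊥n e≈0 with uniform-bound e n
    ... | A , 2≤A , small with avoid-small-primes t n t⊥n A
    ...   | j , avoid = trans (⟦⟧-cong e (ζ^-≡% t t′ (≡.sym (ℕ.[m+kn]%n≡m%n t j n)))) vanish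
      where
      t′ = t ℕ.+ j ℕ.* n
      t′≢0 : ¬ t′ ≡ 0
      t′≢0 t′≡0 = avoid prime[2] 2≤A (≡.subst (2 ℕ.∣_) (≡.sym t′≡0) (2 ℕ.∣0))
      open PrimeFactorisation (factorise t′ {{ℕ.≢-nonZero t′≢0}})
      along : ∀ qs → All Prime qs → product qs ℕ.∣ t′ → ∀ s → ⟦ e ⟧ (ζ ^ s) ≈ 0# → ⟦ e ⟧ (ζ ^ (s ℕ.* product qs)) ≈ 0#
      along [] _ _ s v≈0 = trans (⟦⟧-cong e (reflexive (≡.cong (ζ ^_) (ℕ.*-identityʳ s)))) v≈0
      along (q ∷ qs) (q-prime ∷ primes) qs∣ s v≈0 =
        trans (⟦⟧-cong e (reflexive (≡.cong (ζ ^_) (≡.sym (ℕ.*-assoc s q (product qs))))))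
          (along qs primes (ℕ.∣-trans (ℕ.n∣m*n q) qs∣) (s ℕ.* q)
            (large-prime-step e 2≤A small q-prime (ℕ.≰⇒> λ q≤A → avoid q-prime q≤A (ℕ.∣-trans (ℕ.m∣m*n (product qs)) qs∣)) s v≈0))
      vanish : ⟦ e ⟧ (ζ ^ t′) ≈ 0#
      vanish = trans (⟦⟧-cong e (reflexive (≡.cong (ζ ^_) (≡.trans isFactorisation (≡.sym (ℕ.*-identityˡ _))))))
        (along factors factorsPrime (ℕ.∣-reflexive (≡.sym isFactorisation)) 1
          (trans (⟦⟧-cong e (*-identityʳ ζ)) e≈0))

  -- Conjugations of ζ as graphs.

  Functional : ∀ {g} → Pred (Carrier × Carrier) g → Set _
  Functional G = ∀ {x y} → G (x , y) → x ≈ 0# → y ≈ 0#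

  -- A graph that is closed under subtraction is single-valued as soon as it is so at 0, which is
  -- why `Functional` speaks of 0 alone.
  functional⇒unique : ∀ {g} {G : Pred (Carrier × Carrier) g} → Horner².IsSubring G → Functional G →
                      ∀ {x y x′ y′} → G (x , y) → G (x′ , y′) → x ≈ x′ → y ≈ y′
  functional⇒unique isG functional xy xy′ x≈x′ =
    x-y≈0⇒x≈y (functional (Horner².IsSubring.sub-in isG xy xy′) (x≈y⇒x-y≈0 x≈x′))

  module _ {m ζ} (prim : IsPrimitiveRootOfUnity (suc m) ζ) where

    open PowersOfPrimitiveRoot prim

    private n = suc m

    -- The graph of the conjugation that fixes S and maps ζ to ζᵗ.
    Conj : ∀ {s} → Pred Carrier s → ℕ → Pred (Carrier × Carrier) _
    Conj S t = Horner².⟪ (Diagonal (Rat ∪ S)) ∪ (Q̄²._≈ (ζ , ζ ^ t)) ⟫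

    module Conj {s} {S : Pred Carrier s} {t} = Horner².IsSubring (Horner².⟪⟫-isSubring {S = (Diagonal (Rat ∪ S)) ∪ (Q̄²._≈ (ζ , ζ ^ t))})

    conj-ζ : ∀ {s} {S : Pred Carrier s} {t} → Conj S t (ζ , ζ ^ t)
    conj-ζ = Horner².gen (inj₂ (refl , refl))

    conj-ζ^ : ∀ {s} {S : Pred Carrier s} {t} k → Conj S t (ζ ^ k , (ζ ^ t) ^ k)
    conj-ζ^ {t = t} k = Conj.resp-in {t = t} (reflexive (^²₁ (ζ , ζ ^ t) k) , reflexive (^²₂ (ζ , ζ ^ t) k)) (Conj.pow-in {t = t} k (conj-ζ {t = t}))

    conj-fixed : ∀ {s} {S : Pred Carrier s} {t x} → (Rat ∪ S) x → Conj S t (x , x)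
    conj-fixed x∈ = Horner².gen (inj₁ (_ , x∈ , refl , refl))

    conj-domain : ∀ {s} {S : Pred Carrier s} {t x y} → Conj S t (x , y) → ℚ⟨ S ∪ (_≈ ζ) ⟩ x
    conj-domain = Horner².⟪⟫-least isD λ where
        (inj₁ (_ , inj₁ q , e , _)) → resp (sym e) (Rat⊆ℚ⟨⟩ q)
        (inj₁ (_ , inj₂ z , e , _)) → resp (sym e) (generator (inj₁ z))
        (inj₂ (e , _))              → generator (inj₂ e)
      where
      isD : Horner².IsSubring (λ xy → ℚ⟨ _ ∪ (_≈ ζ) ⟩ (proj₁ xy))
      isD = record
        { one-in  = one-in ; add-in = add ; neg-in = neg ; mul-in = mul ; resp-in = λ (e , _) → resp e }
        where open IsSubring ℚ⟨⟩-isSubring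

    private
      lit⁺ : ℕ → ℤ[X]
      lit⁺ zero    = 𝟙 ⊕ (⊝ 𝟙)
      lit⁺ (suc k) = 𝟙 ⊕ lit⁺ k

      lit : ℤ → ℤ[X]
      lit (+ k)    = lit⁺ k
      lit -[1+ k ] = ⊝ lit⁺ (suc k)

      ⟦lit⁺⟧ : ∀ k z → ⟦ lit⁺ k ⟧ z ≈ k · 1#
      ⟦lit⁺⟧ zero    z = -‿inverseʳ 1#
      ⟦lit⁺⟧ (suc k) z = +-congˡ (⟦lit⁺⟧ k z)

      ⟦lit⟧ : ∀ i z → ⟦ lit i ⟧ z ≈ ⟦ i ⟧ℤ
      ⟦lit⟧ (+ k)    z = trans (⟦lit⁺⟧ k z) (·≈⟦⟧ℤ k)
      ⟦lit⟧ -[1+ k ] z = -‿cong (trans (⟦lit⁺⟧ (suc k) z) (·≈⟦⟧ℤ (suc k)))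

      -- Passes from rational to integral relations: one integer k clears the denominators of both
      -- components, and one term e describes both at ζ and ζᵗ.
      Evaluated : ℕ → Pred (Carrier × Carrier) _
      Evaluated t (x , y) = ∃[ k ] ∃[ e ] ⟦ k ⟧ℤ ≉ 0# × ⟦ k ⟧ℤ * x ≈ ⟦ e ⟧ ζ × ⟦ k ⟧ℤ * y ≈ ⟦ e ⟧ (ζ ^ t)

      *-homo-≉0 : ∀ {k l} → ⟦ k ⟧ℤ ≉ 0# → ⟦ l ⟧ℤ ≉ 0# → ⟦ k ℤ.* l ⟧ℤ ≉ 0#
      *-homo-≉0 {k} {l} k≉0 l≉0 e = *-≉0 k≉0 l≉0 (trans (sym (ℤ-*-homo k l)) e)

      evaluated-+ : ∀ k l {e f z x y} → ⟦ k ⟧ℤ * x ≈ ⟦ e ⟧ z → ⟦ l ⟧ℤ * y ≈ ⟦ f ⟧ z →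
                    ⟦ k ℤ.* l ⟧ℤ * (x + y) ≈ ⟦ (lit l ⊗ e) ⊕ (lit k ⊗ f) ⟧ z
      evaluated-+ k l {e} {f} {z} {x} {y} eq eq′ = begin
        ⟦ k ℤ.* l ⟧ℤ * (x + y)                              ≈⟨ *-congʳ (ℤ-*-homo k l) ⟩
        ⟦ k ⟧ℤ * ⟦ l ⟧ℤ * (x + y) ≈⟨ solve 4 (λ k l x y → k :* l :* (x :+ y) := l :* (k :* x) :+ k :* (l :* y)) refl ⟦ k ⟧ℤ ⟦ l ⟧ℤ x y ⟩
        ⟦ l ⟧ℤ * (⟦ k ⟧ℤ * x) + ⟦ k ⟧ℤ * (⟦ l ⟧ℤ * y) ≈⟨ +-cong (*-cong (sym (⟦lit⟧ l z)) eq) (*-cong (sym (⟦lit⟧ k z)) eq′) ⟩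
        ⟦ lit l ⟧ z * ⟦ e ⟧ z + ⟦ lit k ⟧ z * ⟦ f ⟧ z       ∎

      evaluated-* : ∀ k l {e f z x y} → ⟦ k ⟧ℤ * x ≈ ⟦ e ⟧ z → ⟦ l ⟧ℤ * y ≈ ⟦ f ⟧ z →
                    ⟦ k ℤ.* l ⟧ℤ * (x * y) ≈ ⟦ e ⊗ f ⟧ z
      evaluated-* k l {e} {f} {z} {x} {y} eq eq′ = begin
        ⟦ k ℤ.* l ⟧ℤ * (x * y)          ≈⟨ *-congʳ (ℤ-*-homo k l) ⟩
        ⟦ k ⟧ℤ * ⟦ l ⟧ℤ * (x * y) ≈⟨ solve 4 (λ k l x y → k :* l :* (x :* y) := k :* x :* (l :* y)) refl ⟦ k ⟧ℤ ⟦ l ⟧ℤ x y ⟩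
        ⟦ k ⟧ℤ * x * (⟦ l ⟧ℤ * y)       ≈⟨ *-cong eq eq′ ⟩
        ⟦ e ⟧ z * ⟦ f ⟧ z               ∎

      Evaluated-isSubring : ∀ t → Horner².IsSubring (Evaluated t)
      Evaluated-isSubring t = record
        { one-in  = 1ℤ , 𝟙 , 1≉0 , *-identityˡ _ , *-identityˡ _
        ; add-in  = λ (k , e , k≉0 , eq , eq′) (l , f , l≉0 , eq″ , eq‴) →
            k ℤ.* l , ((lit l ⊗ e) ⊕ (lit k ⊗ f)) , *-homo-≉0 {k} {l} k≉0 l≉0 ,
            evaluated-+ k l {e} {f} eq eq″ , evaluated-+ k l {e} {f} eq′ eq‴
        ; neg-in  = λ (k , e , k≉0 , eq , eq′) → k , ⊝ e , k≉0 ,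
            trans (sym (-‿distribʳ-* _ _)) (-‿cong eq) , trans (sym (-‿distribʳ-* _ _)) (-‿cong eq′)
        ; mul-in  = λ (k , e , k≉0 , eq , eq′) (l , f , l≉0 , eq″ , eq‴) →
            k ℤ.* l , (e ⊗ f) , *-homo-≉0 {k} {l} k≉0 l≉0 ,
            evaluated-* k l {e} {f} eq eq″ , evaluated-* k l {e} {f} eq′ eq‴
        ; resp-in = λ (x≈ , y≈) (k , e , k≉0 , eq , eq′) → k , e , k≉0 ,
            trans (*-congˡ (sym x≈)) eq , trans (*-congˡ (sym y≈)) eq′
        }

    -- Well-definedness of ζ ↦ ζᵗ on ℚ(ζ): a pair over x ≈ 0 scales to an integral relation for ζ,
    -- and `conjugate-vanishes` carries it to ζᵗ.
    conj-functional : ∀ {t} → ℕ.Coprime t n → Functional (Conj ∅ t)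
    conj-functional {t} t⊥n {x} {y} xy x≈0 = no-zero-divisors k≉0
      (trans eq′ (conjugate-vanishes prim e t t⊥n (trans (sym eq) (trans (*-congˡ x≈0) (zeroʳ _)))))
      where
      evaluate : Conj ∅ t ⊆ Evaluated t
      evaluate = Horner².⟪⟫-least (Evaluated-isSubring t) λ where
        (inj₂ (e , e′)) → 1ℤ , X , 1≉0 , trans (*-identityˡ _) e , trans (*-identityˡ _) e′
        (inj₁ (_ , inj₁ (q , z≈) , x≈ , y≈)) → let d , i , eq = denominator-times q in
          + suc d , lit i , ⟦⟧ℤ-nonzero {+ suc d} (λ ()) ,
          trans (*-congˡ (trans x≈ z≈)) (trans eq (sym (⟦lit⟧ i _))) ,
          trans (*-congˡ (trans y≈ z≈)) (trans eq (sym (⟦lit⟧ i _)))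
      evaluated = evaluate xy
      k   = proj₁ evaluated
      e   = proj₁ (proj₂ evaluated)
      k≉0 : ⟦ k ⟧ℤ ≉ 0#
      k≉0 = proj₁ (proj₂ (proj₂ evaluated))
      eq  : ⟦ k ⟧ℤ * x ≈ ⟦ e ⟧ ζ
      eq  = proj₁ (proj₂ (proj₂ (proj₂ evaluated)))
      eq′ : ⟦ k ⟧ℤ * y ≈ ⟦ e ⟧ (ζ ^ t)
      eq′ = proj₂ (proj₂ (proj₂ (proj₂ evaluated)))

  -- Adjoining a root of unity of prime order.

  geometric-sum : ∀ d x → (x - 1#) * horner {d} 1# (λ _ → 1#) x ≈ x ^ suc d - 1#
  geometric-sum zero    x = solve 1 (λ x → (x :- con 1ℤ) :* con 1ℤ := x :* con 1ℤ :- con 1ℤ) refl x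
  geometric-sum (suc d) x = begin
    (x - 1#) * (1# + x * h) ≈⟨ solve 2 (λ x h → (x :- con 1ℤ) :* (con 1ℤ :+ x :* h) := x :- con 1ℤ :+ x :* ((x :- con 1ℤ) :* h)) refl x h ⟩
    x - 1# + x * ((x - 1#) * h)      ≈⟨ +-congˡ (*-congˡ (geometric-sum d x)) ⟩
    x - 1# + x * (x ^ suc d - 1#) ≈⟨ solve 2 (λ x p → x :- con 1ℤ :+ x :* (p :- con 1ℤ) := x :* p :- con 1ℤ) refl x (x ^ suc d) ⟩
    x * x ^ suc d - 1#               ∎
    where h = horner {d} 1# (λ _ → 1#) x

  -- The prime is p = d + 2, so that 1 + ω + ⋯ + ω^(p-1) = 0 is a monic relation with d + 1 lower
  -- coefficients.
  module PrimeStep {m ζ} (prim : IsPrimitiveRootOfUnity (suc m) ζ)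
    (d N : ℕ) (p-prime : Prime (suc (suc d))) (n≡ : N ℕ.* suc (suc d) ≡ suc m) (N⊥p : ℕ.Coprime N (suc (suc d)))
    where

    open PowersOfPrimitiveRoot prim

    private
      n p : ℕ
      n = suc m
      p = suc (suc d)

      instance
        N-nonZero : ℕ.NonZero N
        N-nonZero = ℕ.m*n≢0⇒m≢0 N {{≡.subst ℕ.NonZero (≡.sym n≡) (ℕ.nonZero {m})}}

    ω : Carrier
    ω = ζ ^ N

    ω^p≈1 : ω ^ p ≈ 1#
    ω^p≈1 = trans (^-assocʳ ζ N p) (trans (reflexive (≡.cong (ζ ^_) n≡)) ζ^n≈1)

    ω^-injective : ∀ {i j} → i ℕ.< p → j ℕ.< p → ω ^ i ≈ ω ^ j → i ≡ j
    ω^-injective {i} {j} i<p j<p e = ℕ.*-cancelˡ-≡ i j N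
      (ζ^-injective (bound i<p) (bound j<p) (trans (sym (^-assocʳ ζ N i)) (trans e (^-assocʳ ζ N j))))
      where
      bound : ∀ {i} → i ℕ.< p → N ℕ.* i ℕ.< n
      bound {i} i<p = ≡.subst (N ℕ.* i ℕ.<_) n≡ (ℕ.*-monoʳ-< N i<p)

    ω≉1 : ω ≉ 1#
    ω≉1 ω≈1 = contradiction (ω^-injective {1} {0} (ℕ.s≤s (ℕ.s≤s ℕ.z≤n)) (ℕ.s≤s ℕ.z≤n) (trans (*-identityʳ ω) ω≈1)) λ ()

    ω-root : horner {suc d} 1# (λ _ → 1#) ω ≈ 0#
    ω-root = no-zero-divisors (ω≉1 ∘ x-y≈0⇒x≈y) (trans (geometric-sum (suc d) ω) (x≈y⇒x-y≈0 ω^p≈1))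

    module _ {s} {S : Pred Carrier s} where

      -- ω has order p, so ζ ↦ ζᵗ acts on it through t modulo p. The multiples of p on both sides
      -- express that congruence in the natural numbers.
      conj-ω : ∀ t a b i → t ℕ.+ p ℕ.* a ≡ i ℕ.+ p ℕ.* b → Conj prim S t (ω , ω ^ i)
      conj-ω t a b i eq = Conj.resp-in prim {t = t} (refl , ζ^tN≈ω^i) (conj-ζ^ prim {t = t} N)
        where
        drop : ∀ t a → ζ ^ ((t ℕ.+ p ℕ.* a) ℕ.* N) ≈ ζ ^ (t ℕ.* N)
        drop t a = ζ^-≡% ((t ℕ.+ p ℕ.* a) ℕ.* N) (t ℕ.* N) (≡.trans (≡.cong (ℕ._% n) (≡.trans (lemma t N a p) (≡.cong (λ z → t ℕ.* N ℕ.+ a ℕ.* z) n≡))) (ℕ.[m+kn]%n≡m%n (t ℕ.* N) a n))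
          where
          lemma : ∀ t N a p → (t ℕ.+ p ℕ.* a) ℕ.* N ≡ t ℕ.* N ℕ.+ a ℕ.* (N ℕ.* p)
          lemma = ℕ-solve-∀
        ζ^tN≈ω^i : (ζ ^ t) ^ N ≈ ω ^ i
        ζ^tN≈ω^i = begin
          (ζ ^ t) ^ N                          ≈⟨ ^-assocʳ ζ t N ⟩
          ζ ^ (t ℕ.* N)                        ≈⟨ drop t a ⟨
          ζ ^ ((t ℕ.+ p ℕ.* a) ℕ.* N)          ≡⟨ ≡.cong (λ z → ζ ^ (z ℕ.* N)) eq ⟩
          ζ ^ ((i ℕ.+ p ℕ.* b) ℕ.* N)          ≈⟨ drop i b ⟩
          ζ ^ (i ℕ.* N)                        ≡⟨ ≡.cong (ζ ^_) (ℕ.*-comm i N) ⟩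
          ζ ^ (N ℕ.* i)                        ≈⟨ ^-assocʳ ζ N i ⟨
          ω ^ i                                ∎

      -- The exponents t ≡ 1 modulo N are those for which ζᵗ and ζ have the same p-th power, so
      -- these conjugations fix ζ^p along with S.
      Fixed : Pred Carrier _
      Fixed x = ∀ k → ℕ.Coprime (1 ℕ.+ N ℕ.* k) n → Conj prim S (1 ℕ.+ N ℕ.* k) (x , x)

      -- A relation of degree p − 2 for ω has all p − 1 conjugates of ω as roots.
      vanishing-relation : (∀ {t} → ℕ.Coprime t n → Functional (Conj prim S t)) →
                           (r : Fin (suc d) → Carrier) → (∀ j → Fixed (r j)) →
                           horner 0# r ω ≈ 0# → ∀ j → r j ≈ 0#
      vanishing-relation functional r r-fixed root =
        horner₀-vanishes r (λ i → ω ^ suc (toℕ i)) distinct roots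
        where
        bound : ∀ (i : Fin (suc d)) → suc (toℕ i) ℕ.< p
        bound i = ℕ.s≤s (Fin.toℕ<n i)
        distinct : ∀ {i j : Fin (suc d)} → ω ^ suc (toℕ i) ≈ ω ^ suc (toℕ j) → i ≡ j
        distinct {i} {j} e = Fin.toℕ-injective (ℕ.suc-injective (ω^-injective (bound i) (bound j) e))
        roots : ∀ i → horner 0# r (ω ^ suc (toℕ i)) ≈ 0#
        roots i = functional t⊥n pair root
          where
          exponent = conjugating-exponent N⊥p p-prime (toℕ i) (bound i)
          t = proj₁ exponent
          congruence = proj₂ (proj₂ (proj₂ exponent))
          k = proj₁ (proj₁ (proj₂ (proj₂ exponent)))
          t≡ : t ≡ 1 ℕ.+ N ℕ.* k
          t≡ = proj₂ (proj₁ (proj₂ (proj₂ exponent)))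
          t⊥n : ℕ.Coprime t n
          t⊥n = ≡.subst (ℕ.Coprime t) n≡ (proj₁ (proj₂ exponent))
          fixed : ∀ j → Conj prim S t (r j , r j)
          fixed j = ≡.subst (λ t → ℕ.Coprime t n → Conj prim S t (r j , r j)) (≡.sym t≡) (r-fixed j k) t⊥n
          ω∈ : Conj prim S t (ω , ω ^ suc (toℕ i))
          ω∈ = conj-ω t (proj₁ congruence) (proj₁ (proj₂ congruence)) (suc (toℕ i)) (proj₂ (proj₂ congruence))
          pair : Conj prim S t (horner 0# r ω , horner 0# r (ω ^ suc (toℕ i)))
          pair = Conj.resp-in prim {t = t}
            ( reflexive (horner²₁ Q̄².0# (λ j → r j , r j) (ω , ω ^ suc (toℕ i)))
            , reflexive (horner²₂ Q̄².0# (λ j → r j , r j) (ω , ω ^ suc (toℕ i))))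
            (Conj.horner-in prim {t = t} (Conj.zero-in prim {t = t}) fixed ω∈)

      module _ (M R : ℕ) (N≡ : M ℕ.* R ≡ N) (M⊥p : ℕ.Coprime M p) where

        -- From n = MRp, the element ζ^(pR) has order M and ζ^R has order Mp: `Top` enlarges the
        -- order by the factor p.
        Base Top : Pred Carrier _
        Base = ℚ⟨ S ∪ (_≈ ζ ^ (p ℕ.* R)) ⟩
        Top  = ℚ⟨ S ∪ (_≈ ζ ^ R) ⟩

        Base-fixed : Base ⊆ Fixed
        Base-fixed x∈ k _ = ℚ⟨⟩-least isD (λ q → conj-fixed prim {t = t} (inj₁ q)) (λ where
            (inj₁ x∈S) → conj-fixed prim {t = t} (inj₂ x∈S)
            (inj₂ x≈) → Conj.resp-in prim {t = t} (sym x≈ , trans η-fixed (sym x≈)) (conj-ζ^ prim {t = t} (p ℕ.* R))) x∈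
          where
          t = 1 ℕ.+ N ℕ.* k
          D : Pred Carrier _
          D x = Conj prim S t (x , x)
          isD : IsSubring D
          isD = record
            { one-in  = Conj.one-in prim {t = t}
            ; add-in  = Conj.add-in prim {t = t}
            ; neg-in  = Conj.neg-in prim {t = t}
            ; mul-in  = Conj.mul-in prim {t = t}
            ; resp-in = λ e → Conj.resp-in prim {t = t} (e , e)
            }
          η-fixed : (ζ ^ t) ^ (p ℕ.* R) ≈ ζ ^ (p ℕ.* R)
          η-fixed = trans (^-assocʳ ζ t (p ℕ.* R)) (ζ^-≡% (t ℕ.* (p ℕ.* R)) (p ℕ.* R)
            (≡.trans (≡.cong (ℕ._% n) (≡.trans (lemma N k p R) (≡.cong (λ z → p ℕ.* R ℕ.+ k ℕ.* R ℕ.* z) n≡)))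
                     (ℕ.[m+kn]%n≡m%n (p ℕ.* R) (k ℕ.* R) n)))
            where
            lemma : ∀ N k p R → (1 ℕ.+ N ℕ.* k) ℕ.* (p ℕ.* R) ≡ p ℕ.* R ℕ.+ k ℕ.* R ℕ.* (N ℕ.* p)
            lemma = ℕ-solve-∀

        private
          Extended : Pred Carrier _
          Extended = ⟪ Base ∪ (_≈ ω) ⟫

          module Extended = IsSubring (⟪⟫-isSubring {S = Base ∪ (_≈ ω)})

          ω∈ : Extended ω
          ω∈ = gen (inj₂ refl)

          η^∈ : ∀ y → Base ((ζ ^ (p ℕ.* R)) ^ y)
          η^∈ y = IsSubring.pow-in ℚ⟨⟩-isSubring y (generator (inj₂ refl))

          ζ^R : ∀ y → (ζ ^ R) ^ (y ℕ.* p) ≈ (ζ ^ (p ℕ.* R)) ^ y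
          ζ^R y = begin
            (ζ ^ R) ^ (y ℕ.* p)       ≈⟨ ^-assocʳ ζ R (y ℕ.* p) ⟩
            ζ ^ (R ℕ.* (y ℕ.* p))     ≡⟨ ≡.cong (ζ ^_) (lemma R y p) ⟩
            ζ ^ (p ℕ.* R ℕ.* y)       ≈⟨ ^-assocʳ ζ (p ℕ.* R) y ⟨
            (ζ ^ (p ℕ.* R)) ^ y       ∎
            where
            lemma : ∀ R y p → R ℕ.* (y ℕ.* p) ≡ p ℕ.* R ℕ.* y
            lemma = ℕ-solve-∀

          ζ^R-ω : ∀ x → (ζ ^ R) ^ (x ℕ.* M) ≈ ω ^ x
          ζ^R-ω x = begin
            (ζ ^ R) ^ (x ℕ.* M)       ≈⟨ ^-assocʳ ζ R (x ℕ.* M) ⟩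
            ζ ^ (R ℕ.* (x ℕ.* M))     ≡⟨ ≡.cong (ζ ^_) (≡.trans (lemma R x M) (≡.cong (ℕ._* x) N≡)) ⟩
            ζ ^ (N ℕ.* x)             ≈⟨ ^-assocʳ ζ N x ⟨
            ω ^ x                     ∎
            where
            lemma : ∀ R x M → R ℕ.* (x ℕ.* M) ≡ M ℕ.* R ℕ.* x
            lemma = ℕ-solve-∀

          power-inverse : ∀ i → ζ ^ i * ζ ^ (i ℕ.* m) ≈ 1#
          power-inverse i = trans (sym (^-homo-* ζ i (i ℕ.* m)))
            (trans (reflexive (≡.cong (ζ ^_) (≡.sym (ℕ.*-suc i m)))) (ζ^multiple i))

          divide : ∀ {x y z} w → y * w ≈ 1# → x * y ≈ z → x ≈ z * w
          divide {x} {y} {z} w yw≈1 xy≈z = begin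
            x              ≈⟨ *-identityʳ x ⟨
            x * 1#         ≈⟨ *-congˡ yw≈1 ⟨
            x * (y * w)    ≈⟨ *-assoc x y w ⟨
            x * y * w      ≈⟨ *-congʳ xy≈z ⟩
            z * w          ∎

          -- Both ω = (ζ^R)^M and (ζ^R)^p are available, and M and p are coprime. Bézout writes ζ^R
          -- as a power of one times the inverse of a power of the other.
          θ∈ : Extended (ζ ^ R)
          θ∈ with ℕ.coprime-Bézout M⊥p
          ... | Bézout.+- x y 1+yp≡xM = Extended.resp-in (sym (divide (η⁻¹) ηη⁻¹ (begin
              ζ ^ R * (ζ ^ (p ℕ.* R)) ^ y      ≈⟨ *-congˡ (ζ^R y) ⟨
              (ζ ^ R) ^ (1 ℕ.+ y ℕ.* p)        ≡⟨ ≡.cong ((ζ ^ R) ^_) 1+yp≡xM ⟩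
              (ζ ^ R) ^ (x ℕ.* M)              ≈⟨ ζ^R-ω x ⟩
              ω ^ x                            ∎)))
              (Extended.mul-in (Extended.pow-in x ω∈) (gen (inj₁ (inv (η^∈ y) ηη⁻¹))))
            where
            η⁻¹ = ζ ^ (p ℕ.* R ℕ.* y ℕ.* m)
            ηη⁻¹ : (ζ ^ (p ℕ.* R)) ^ y * η⁻¹ ≈ 1#
            ηη⁻¹ = trans (*-congʳ (^-assocʳ ζ (p ℕ.* R) y)) (power-inverse (p ℕ.* R ℕ.* y))
          ... | Bézout.-+ x y 1+xM≡yp = Extended.resp-in (sym (divide (ω ^ (x ℕ.* suc d)) ωω⁻¹ (begin
              ζ ^ R * ω ^ x                    ≈⟨ *-congˡ (ζ^R-ω x) ⟨
              (ζ ^ R) ^ (1 ℕ.+ x ℕ.* M)        ≡⟨ ≡.cong ((ζ ^ R) ^_) 1+xM≡yp ⟩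
              (ζ ^ R) ^ (y ℕ.* p)              ≈⟨ ζ^R y ⟩
              (ζ ^ (p ℕ.* R)) ^ y              ∎)))
              (Extended.mul-in (gen (inj₁ (η^∈ y))) (Extended.pow-in (x ℕ.* suc d) ω∈))
            where
            ωω⁻¹ : ω ^ x * ω ^ (x ℕ.* suc d) ≈ 1#
            ωω⁻¹ = begin
              ω ^ x * ω ^ (x ℕ.* suc d)      ≈⟨ ^-homo-* ω x (x ℕ.* suc d) ⟨
              ω ^ (x ℕ.+ x ℕ.* suc d) ≡⟨ ≡.cong (ω ^_) (≡.trans (≡.sym (ℕ.*-suc x (suc d))) (ℕ.*-comm x p)) ⟩
              ω ^ (p ℕ.* x)                  ≈⟨ ^-assocʳ ω p x ⟨
              (ω ^ p) ^ x                    ≈⟨ ^-congˡ x ω^p≈1 ⟩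
              1# ^ x                         ≈⟨ 1^ x ⟩
              1#                             ∎

        Top-spanned : ∀ {x} → Top x → ∃[ r ] (∀ (j : Fin (suc d)) → Base (r j)) × x ≈ horner 0# r ω
        Top-spanned x∈ = MonicExtension.reduce ℚ⟨⟩-isSubring (λ _ → 1#) (λ _ → IsSubring.one-in ℚ⟨⟩-isSubring) ω ω-root
          (ℚ⟨⟩-least ⟪⟫-isSubring (λ q → gen (inj₁ (Rat⊆ℚ⟨⟩ q))) (λ where
            (inj₁ x∈S) → gen (inj₁ (generator (inj₁ x∈S)))
            (inj₂ x≈)  → Extended.resp-in (sym x≈) θ∈) x∈)

  -- Degrees



  sum-++ : ∀ m {n} (f : Fin (m ℕ.+ n) → Carrier) → sum f ≈ sum (λ i → f (i Fin.↑ˡ n)) + sum (λ i → f (m Fin.↑ʳ i))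
  sum-++ zero    f = sym (+-identityˡ _)
  sum-++ (suc m) f = trans (+-congˡ (sum-++ m (f ∘ suc))) (sym (+-assoc _ _ _))

  sum-combine : ∀ d e (f : Fin (d ℕ.* e) → Carrier) → sum f ≈ sum (λ j → sum (λ l → f (Fin.combine {d} j l)))
  sum-combine zero    e f = refl
  sum-combine (suc d) e f = trans (sum-++ e f) (+-congˡ (sum-combine d e (λ i → f (e Fin.↑ʳ i))))

  module _ {f g} {F : Pred Carrier f} {G : Pred Carrier g} (F-isSubring : IsSubring F) (Rat⊆F : Rat ⊆ F)
    {d} (F-degree : HasDegree F d) {e} (x : Carrier)
    (multiples : ∀ {y} → F y → ∀ (j : Fin e) → G (y * x ^ toℕ j))
    (spanned : ∀ {y} → G y → ∃[ r ] (∀ (j : Fin e) → F (r j)) × y ≈ horner 0# r x)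
    (independent : (r : Fin e → Carrier) → (∀ j → F (r j)) → horner 0# r x ≈ 0# → ∀ j → r j ≈ 0#)
    where

    private
      module F = HasDegree F-degree

      combine : Fin d → Fin e → Fin (d ℕ.* e)
      combine = Fin.combine

      b : Fin (d ℕ.* e) → Carrier
      b i = F.basis (proj₁ (Fin.remQuot {d} e i)) * x ^ toℕ (proj₂ (Fin.remQuot {d} e i))

      coefficients : (Fin (d ℕ.* e) → ℚ) → Fin e → Carrier
      coefficients q l = linearCombination (λ j → q (combine j l)) F.basis

      combination : ∀ q → linearCombination q b ≈ horner 0# (coefficients q) x
      combination q = begin
        sum (λ i → ι (q i) * b i)                             ≈⟨ sum-combine d e (λ i → ι (q i) * b i) ⟩
        sum (λ j → sum (λ l → ι (q (combine j l)) * b (combine j l)))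
          ≈⟨ sum-cong-≋ {d} (λ j → sum-cong-≋ {e} λ l → *-congˡ (reflexive (≡.cong (λ (j , l) → F.basis j * x ^ toℕ l) (Fin.remQuot-combine {d} {e} j l)))) ⟩
        sum (λ j → sum (λ l → t (j , l)))                     ≈⟨ ∑-comm (λ j l → t (j , l)) ⟩
        sum (λ l → sum (λ j → t (j , l)))
          ≈⟨ sum-cong-≋ {e} (λ l → sum-cong-≋ {d} λ j → sym (*-assoc _ _ _)) ⟩
        sum (λ l → sum (λ j → ι (q (combine j l)) * F.basis j * x ^ toℕ l))
          ≈⟨ sum-cong-≋ {e} (λ l → sym (*-distribʳ-sum (x ^ toℕ l) (λ j → ι (q (combine j l)) * F.basis j))) ⟩
        sum (λ l → coefficients q l * x ^ toℕ l)              ≈⟨ horner-sum (coefficients q) x ⟨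
        horner 0# (coefficients q) x                          ∎
        where
        t : Fin d × Fin e → Carrier
        t (j , l) = ι (q (combine j l)) * (F.basis j * x ^ toℕ l)

      combination-in : ∀ {d} q (c : Fin d → Carrier) → (∀ j → F (c j)) → F (linearCombination q c)
      combination-in {zero}  q c c∈ = IsSubring.zero-in F-isSubring
      combination-in {suc d} q c c∈ = IsSubring.add-in F-isSubring
        (IsSubring.mul-in F-isSubring (Rat⊆F (q zero , refl)) (c∈ zero))
        (combination-in (q ∘ suc) (c ∘ suc) (c∈ ∘ suc))

    -- The tower law with the products of the basis of F and the powers of x. The double sum is
    -- regrouped as a polynomial in x whose coefficients lie in F, so independence is applied first
    -- over F and then over ℚ.
    degree-extension : HasDegree G (d ℕ.* e)
    degree-extension = record
      { basis       = b
      ; basis-in = λ i → multiples (F.basis-in (proj₁ (Fin.remQuot {d} e i))) (proj₂ (Fin.remQuot {d} e i))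
      ; independent = λ q e≈0 i → ≡.trans (≡.cong q (≡.sym (Fin.combine-remQuot {d} e i)))
          (F.independent (λ j → q (combine j (proj₂ (Fin.remQuot {d} e i))))
            (independent (coefficients q) (λ l → combination-in (λ j → q (combine j l)) F.basis F.basis-in)
              (trans (sym (combination q)) e≈0) (proj₂ (Fin.remQuot {d} e i)))
            (proj₁ (Fin.remQuot {d} e i)))
      ; spanning    = λ y∈ →
          let r , r∈ , y≈ = spanned y∈
              s : Fin e → Fin d → ℚ
              s l = proj₁ (F.spanning (r∈ l))
              q : Fin (d ℕ.* e) → ℚ
              q i = s (proj₂ (Fin.remQuot {d} e i)) (proj₁ (Fin.remQuot {d} e i))
          in q , trans y≈ (trans
            (horner-cong {c = r} refl (λ l → trans (proj₂ (F.spanning (r∈ l))) (sum-cong-≋ {d} λ j → *-congʳ (ι-cong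
              (≡.cong (λ (j , l) → s l j) (≡.sym (Fin.remQuot-combine {d} {e} j l)))))) refl)
            (sym (combination q)))
      }

  Rat-degree : HasDegree Rat 1
  Rat-degree = record
    { basis       = λ _ → 1#
    ; basis-in    = λ _ → IsSubring.one-in Rat-isSubring
    ; independent = λ { q e zero → ι≈0⇒≡0 (trans (sym (simplify q)) e) }
    ; spanning    = λ (q , x≈) → (λ _ → q) , trans x≈ (sym (simplify (λ _ → q)))
    }
    where
    simplify : ∀ q → linearCombination q (λ (_ : Fin 1) → 1#) ≈ ι (q zero)
    simplify q = trans (+-identityʳ _) (*-identityʳ _)

  degree-≐ : ∀ {f g} {F : Pred Carrier f} {G : Pred Carrier g} → F ≐ G → ∀ {d} → HasDegree F d → HasDegree G d
  degree-≐ (F⊆G , G⊆F) F-degree = record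
    { basis = basis ; basis-in = λ j → F⊆G (basis-in j) ; independent = independent ; spanning = spanning ∘ G⊆F }
    where open HasDegree F-degree

  -- Rational polynomials


  open ℚ[x] using (Poly; coeff; _≈ₚ_; _+ₚ_; _*ₚ_; monicWith; binomial)

  eval : Poly → Carrier → Carrier
  eval p x = K[x].eval (List.map ι p) x

  eval-+ : ∀ p q x → eval (p +ₚ q) x ≈ eval p x + eval q x
  eval-+ []      q       x = sym (+-identityˡ _)
  eval-+ (a ∷ p) []      x = sym (+-identityʳ _)
  eval-+ (a ∷ p) (b ∷ q) x = trans (+-cong (ι-+ a b) (*-congˡ (eval-+ p q x)))
    (solve 5 (λ a b x h h′ → a :+ b :+ x :* (h :+ h′) := a :+ x :* h :+ (b :+ x :* h′)) refl (ι a) (ι b) x (eval p x) (eval q x))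

  eval-scale : ∀ a p x → eval (List.map (a ℚ.*_) p) x ≈ ι a * eval p x
  eval-scale a []      x = sym (zeroʳ _)
  eval-scale a (b ∷ p) x = trans (+-cong (ι-* a b) (*-congˡ (eval-scale a p x)))
    (solve 4 (λ a b x h → a :* b :+ x :* (a :* h) := a :* (b :+ x :* h)) refl (ι a) (ι b) x (eval p x))

  eval-* : ∀ p q x → eval (p *ₚ q) x ≈ eval p x * eval q x
  eval-* []      q x = sym (zeroˡ _)
  eval-* (a ∷ p) q x = begin
    eval (List.map (a ℚ.*_) q +ₚ (0ℚ ∷ (p *ₚ q))) x ≈⟨ eval-+ (List.map (a ℚ.*_) q) (0ℚ ∷ (p *ₚ q)) x ⟩
    eval (List.map (a ℚ.*_) q) x + (ι 0ℚ + x * eval (p *ₚ q) x) ≈⟨ +-cong (eval-scale a q x) (+-cong ι-0 (*-congˡ (eval-* p q x))) ⟩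
    ι a * eval q x + (0# + x * (eval p x * eval q x)) ≈⟨ solve 4 (λ a x p q → a :* q :+ (con 0ℤ :+ x :* (p :* q)) := (a :+ x :* p) :* q) refl (ι a) x (eval p x) (eval q x) ⟩
    (ι a + x * eval p x) * eval q x                                  ∎

  eval-power : ∀ m p x → eval (List.replicate m 0ℚ List.++ p) x ≈ x ^ m * eval p x
  eval-power zero    p x = sym (*-identityˡ _)
  eval-power (suc m) p x = begin
    ι 0ℚ + x * eval (List.replicate m 0ℚ List.++ p) x   ≈⟨ +-cong ι-0 (*-congˡ (eval-power m p x)) ⟩
    0# + x * (x ^ m * eval p x)                         ≈⟨ trans (+-identityˡ _) (sym (*-assoc _ _ _)) ⟩
    x * x ^ m * eval p x                                ∎

  eval-constant : ∀ a x → eval (a ∷ []) x ≈ ι a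
  eval-constant a x = trans (+-congˡ (zeroʳ x)) (+-identityʳ _)

  eval-binomial : ∀ m a x → eval (binomial m a) x ≈ x ^ m - ι a
  eval-binomial m a x = begin
    eval (binomial m a) x ≈⟨ eval-+ (monicWith (List.replicate m 0ℚ)) (ℚ.- a ∷ []) x ⟩
    eval (monicWith (List.replicate m 0ℚ)) x + eval (ℚ.- a ∷ []) x ≈⟨ +-cong (eval-power m (1ℚ ∷ []) x) (eval-constant (ℚ.- a) x) ⟩
    x ^ m * eval (1ℚ ∷ []) x + ι (ℚ.- a) ≈⟨ +-cong (trans (*-congˡ (trans (eval-constant 1ℚ x) ι-1)) (*-identityʳ _)) (ι-neg a) ⟩
    x ^ m - ι a                                                            ∎

  nat-injective : ∀ {j k} → nat j ≈ nat k → j ≡ k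
  nat-injective {zero}  {zero}  e = ≡.refl
  nat-injective {zero}  {suc k} e = contradiction (sym e) (nat-nonzero k)
  nat-injective {suc j} {zero}  e = contradiction e (nat-nonzero j)
  nat-injective {suc j} {suc k} e = ≡.cong suc (nat-injective (begin
    nat j                 ≈⟨ solve 1 (λ x → x := con 1ℤ :+ x :- con 1ℤ) refl (nat j) ⟩
    nat (suc j) - 1#      ≈⟨ +-congʳ e ⟩
    nat (suc k) - 1#      ≈⟨ solve 1 (λ x → con 1ℤ :+ x :- con 1ℤ := x) refl (nat k) ⟩
    nat k                 ∎))

  eval-horner : ∀ p x → eval p x ≈ horner 0# (ι ∘ List.lookup p) x
  eval-horner []      x = refl
  eval-horner (a ∷ p) x = +-congˡ (*-congˡ (eval-horner p x))

  -- In characteristic 0 the integers 0, 1, 2, ... are distinct, which gives as many roots as p has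
  -- coefficients.
  vanishing : ∀ p → (∀ x → eval p x ≈ 0#) → ∀ i → coeff p i ≡ 0ℚ
  vanishing p p≈0 = coefficients p λ j → ι≈0⇒≡0 (horner₀-vanishes (ι ∘ List.lookup p) (nat ∘ toℕ)
      (Fin.toℕ-injective ∘ nat-injective) (λ j → trans (sym (eval-horner p (nat (toℕ j)))) (p≈0 (nat (toℕ j)))) j)
    where
    coefficients : ∀ p → (∀ j → List.lookup p j ≡ 0ℚ) → ∀ i → coeff p i ≡ 0ℚ
    coefficients []      e i       = ≡.refl
    coefficients (a ∷ p) e zero    = e zero
    coefficients (a ∷ p) e (suc i) = coefficients p (e ∘ suc) i

  -- Polynomials are determined by their values, as Q̄ is infinite.
  extensionality : ∀ p q → (∀ x → eval p x ≈ eval q x) → p ≈ₚ q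
  extensionality p q p≈q i = Algebra.Properties.AbelianGroup.x∙y⁻¹≈ε⇒x≈y ℚ.+-0-abelianGroup _ _ (≡.trans
      (≡.cong (coeff p i ℚ.+_) (≡.sym (coeff-negate q i)))
      (≡.trans (≡.sym (coeff-+ p (negate q) i)) (vanishing (p +ₚ negate q) difference i)))
    where
    negate : Poly → Poly
    negate = List.map (λ a → ℚ.- a)
    coeff-negate : ∀ q i → coeff (negate q) i ≡ ℚ.- coeff q i
    coeff-negate []      i       = ≡.refl
    coeff-negate (a ∷ q) zero    = ≡.refl
    coeff-negate (a ∷ q) (suc i) = coeff-negate q i
    coeff-+ : ∀ p q i → coeff (p +ₚ q) i ≡ coeff p i ℚ.+ coeff q i
    coeff-+ []      q       i       = ≡.sym (ℚ.+-identityˡ _)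
    coeff-+ (a ∷ p) []      i       = ≡.sym (ℚ.+-identityʳ _)
    coeff-+ (a ∷ p) (b ∷ q) zero    = ≡.refl
    coeff-+ (a ∷ p) (b ∷ q) (suc i) = coeff-+ p q i
    eval-negate : ∀ q x → eval (negate q) x ≈ - eval q x
    eval-negate []      x = sym -0#≈0#
    eval-negate (a ∷ q) x = trans (+-cong (ι-neg a) (*-congˡ (eval-negate q x)))
      (solve 3 (λ a x h → :- a :+ x :* (:- h) := :- (a :+ x :* h)) refl (ι a) x (eval q x))
    difference : ∀ x → eval (p +ₚ negate q) x ≈ 0#
    difference x = trans (eval-+ p (negate q) x) (trans (+-congˡ (eval-negate q x)) (x≈y⇒x-y≈0 (p≈q x)))

  binomial-root : ∀ m a {x} → x ^ m ≈ ι a → IsRoot (binomial m a) x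
  binomial-root m a e = trans (eval-binomial m a _) (x≈y⇒x-y≈0 e)

  root-binomial : ∀ m a {x} → IsRoot (binomial m a) x → x ^ m ≈ ι a
  root-binomial m a root = x-y≈0⇒x≈y (trans (sym (eval-binomial m a _)) root)

  binomial-monic : ∀ m a → ℚ[x].Monic (binomial (suc m) a)
  binomial-monic m a = (ℚ.- a ∷ List.replicate m 0ℚ) , extensionality (binomial (suc m) a) (monicWith (ℚ.- a ∷ List.replicate m 0ℚ)) λ x → begin
    eval (binomial (suc m) a) x ≈⟨ eval-binomial (suc m) a x ⟩
    x ^ suc m - ι a ≈⟨ solve 3 (λ x p a → x :* p :- a := :- a :+ x :* (p :* con 1ℤ)) refl x (x ^ m) (ι a) ⟩
    - ι a + x * (x ^ m * 1#) ≈⟨ +-cong (ι-neg a) (*-congˡ (*-congˡ (trans (eval-constant 1ℚ x) ι-1))) ⟨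
    ι (ℚ.- a) + x * (x ^ m * eval (1ℚ ∷ []) x) ≈⟨ +-congˡ (*-congˡ (eval-power m (1ℚ ∷ []) x)) ⟨
    eval (monicWith (ℚ.- a ∷ List.replicate m 0ℚ)) x                         ∎

  -- Recursion from the constant term upwards: multiplying the previous remainder by x overflows
  -- into t x^(m+1), and replacing x^(m+1) by (x^(m+1) - γ) + γ moves t to the quotient and tγ to
  -- the constant coefficient.
  divide : ∀ m γ p → ∃[ q ] ∃[ r ] ∀ x → eval p x ≈ eval q x * (x ^ suc m - ι γ) + horner 0# (λ (j : Fin (suc m)) → ι (r j)) x
  divide m γ [] = [] , (λ _ → 0ℚ) , λ x → sym (trans (+-cong (zeroˡ _) (horner-zero {suc m} (λ _ → ι-0) x)) (+-identityʳ _))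
  divide m γ (a ∷ p) = t ∷ q , r′ , λ x → begin
      ι a + x * eval p x
        ≈⟨ +-congˡ (*-congˡ (eq x)) ⟩
      ι a + x * (eval q x * B x + horner 0# (ι ∘ r) x)
        ≈⟨ solve 5 (λ a x q b h → a :+ x :* (q :* b :+ h) := a :+ x :* q :* b :+ x :* h) refl (ι a) x (eval q x) (B x) _ ⟩
      ι a + x * eval q x * B x + x * horner 0# (ι ∘ r) x
        ≈⟨ +-congˡ (trans (horner-shift (ι ∘ r) x) (horner-leading (ι t) (shift (ι ∘ r)) x)) ⟩
      ι a + x * eval q x * B x + (0# + x * h x + ι t * x ^ suc m)
        ≈⟨ solve 7 (λ a x q p c h t → a :+ x :* q :* (p :- c) :+ (con 0ℤ :+ x :* h :+ t :* p) := (t :+ x :* q) :* (p :- c) :+ (a :+ t :* c :+ x :* h)) refl (ι a) x (eval q x) (x ^ suc m) (ι γ) (h x) (ι t) ⟩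
      (ι t + x * eval q x) * B x + (ι a + ι t * ι γ + x * h x)
        ≈⟨ +-congˡ (+-congʳ (trans (ι-+ a (t ℚ.* γ)) (+-congˡ (ι-* t γ)))) ⟨
      (ι t + x * eval q x) * B x + horner 0# (ι ∘ r′) x
        ∎
    where
    rec = divide m γ p
    q = proj₁ rec
    r : Fin (suc m) → ℚ
    r = proj₁ (proj₂ rec)
    t = r (fromℕ m)
    B h : Carrier → Carrier
    B x = x ^ suc m - ι γ
    h x = horner 0# (λ (j : Fin m) → ι (r (inject₁ j))) x
    eq : ∀ x → eval p x ≈ eval q x * B x + horner 0# (ι ∘ r) x
    eq = proj₂ (proj₂ rec)
    r′ : Fin (suc m) → ℚ
    r′ zero    = a ℚ.+ t ℚ.* γ
    r′ (suc j) = r (inject₁ j)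

  binomial-minimal : ∀ m γ {a} → a ^ suc m ≈ ι γ →
    ((r : Fin (suc m) → Carrier) → (∀ j → Rat (r j)) → horner 0# r a ≈ 0# → ∀ j → r j ≈ 0#) →
    IsMinimalPolynomial (binomial (suc m) γ) a
  binomial-minimal m γ {a} aⁿ≈γ independent = binomial-monic m γ , binomial-root (suc m) γ aⁿ≈γ , λ g g-root →
    let q , r , eq = divide m γ g
        r≈0 = independent (ι ∘ r) (λ j → r j , refl) (begin
          horner 0# (ι ∘ r) a                                     ≈⟨ +-identityˡ _ ⟨
          0# + horner 0# (ι ∘ r) a ≈⟨ +-congʳ (trans (*-congˡ (x≈y⇒x-y≈0 aⁿ≈γ)) (zeroʳ _)) ⟨
          eval q a * (a ^ suc m - ι γ) + horner 0# (ι ∘ r) a      ≈⟨ eq a ⟨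
          eval g a                                                ≈⟨ g-root ⟩
          0#                                                      ∎)
    in record { quotient = q ; equality = extensionality (q *ₚ binomial (suc m) γ) g λ x → begin
      eval (q *ₚ binomial (suc m) γ) x                            ≈⟨ eval-* q (binomial (suc m) γ) x ⟩
      eval q x * eval (binomial (suc m) γ) x ≈⟨ *-congˡ (eval-binomial (suc m) γ x) ⟩
      eval q x * (x ^ suc m - ι γ)                                ≈⟨ +-identityʳ _ ⟨
      eval q x * (x ^ suc m - ι γ) + 0#                           ≈⟨ +-congˡ (horner-zero r≈0 x) ⟨
      eval q x * (x ^ suc m - ι γ) + horner 0# (ι ∘ r) x          ≈⟨ eq x ⟨
      eval g x                                                    ∎ }

  -- Irrationality of the powers of the radical.

  geometric : ℕ → ℚ → ℕ → Poly
  geometric g s zero    = []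
  geometric g s (suc h) = (List.replicate g 0ℚ List.++ geometric g s h) +ₚ (s ^ℚ h ∷ [])

  eval-geometric : ∀ g s h x → (x ^ g - ι s) * eval (geometric g s h) x ≈ (x ^ g) ^ h - ι s ^ h
  eval-geometric g s zero    x = trans (zeroʳ _) (sym (-‿inverseʳ 1#))
  eval-geometric g s (suc h) x = begin
    (x ^ g - ι s) * eval (geometric g s (suc h)) x
      ≈⟨ *-congˡ (trans (eval-+ (List.replicate g 0ℚ List.++ geometric g s h) (s ^ℚ h ∷ []) x)
                        (+-cong (eval-power g (geometric g s h) x) (trans (eval-constant (s ^ℚ h) x) (ι-^ s h)))) ⟩
    (x ^ g - ι s) * (x ^ g * eval (geometric g s h) x + ι s ^ h)
      ≈⟨ solve 4 (λ p s q u → (p :- s) :* (p :* q :+ u) := p :* ((p :- s) :* q) :+ u :* (p :- s)) refl (x ^ g) (ι s) (eval (geometric g s h) x) (ι s ^ h) ⟩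
    x ^ g * ((x ^ g - ι s) * eval (geometric g s h) x) + ι s ^ h * (x ^ g - ι s)
      ≈⟨ +-congʳ (*-congˡ (eval-geometric g s h x)) ⟩
    x ^ g * ((x ^ g) ^ h - ι s ^ h) + ι s ^ h * (x ^ g - ι s)
      ≈⟨ solve 4 (λ p s v u → p :* (v :- u) :+ u :* (p :- s) := p :* v :- s :* u) refl (x ^ g) (ι s) ((x ^ g) ^ h) (ι s ^ h) ⟩
    x ^ g * (x ^ g) ^ h - ι s * ι s ^ h
      ∎

  module _ {m ζ} (prim : IsPrimitiveRootOfUnity (suc m) ζ) {γ a} (a≉0 : a ≉ 0#) (aⁿ≈γ : a ^ suc m ≈ ι γ)
    (irreducible : ℚ[x].Irreducible (binomial (suc m) γ)) where

    open PowersOfPrimitiveRoot prim using (ζ^n≈1)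

    private
      n : ℕ
      n = suc m

      -- Non-units are recognised by a root in `Q̄`, which replaces an argument with degrees.
      unit-has-no-root : ∀ {p x} → p ℚ[x].∣ (1ℚ ∷ []) → ¬ (eval p x ≈ 0#)
      unit-has-no-root {p} {x} record { quotient = q ; equality = qp≈1 } p≈0 = 1≉0 (begin
        1#                        ≈⟨ trans (eval-constant 1ℚ x) ι-1 ⟨
        eval (1ℚ ∷ []) x          ≈⟨ eval-≈ₚ (q *ₚ p) (1ℚ ∷ []) qp≈1 x ⟨
        eval (q *ₚ p) x           ≈⟨ eval-* q p x ⟩
        eval q x * eval p x       ≈⟨ trans (*-congˡ p≈0) (zeroʳ _) ⟩
        0#                        ∎)
        where
        eval-[] : ∀ p → p ≈ₚ [] → ∀ x → eval p x ≈ 0#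
        eval-[] []      e x = refl
        eval-[] (a ∷ p) e x = trans (+-cong (trans (ι-cong (e 0)) ι-0) (trans (*-congˡ (eval-[] p (e ∘ suc) x)) (zeroʳ x))) (+-identityʳ _)
        eval-≈ₚ : ∀ p q → p ≈ₚ q → ∀ x → eval p x ≈ eval q x
        eval-≈ₚ []      q       e x = sym (eval-[] q (≡.sym ∘ e) x)
        eval-≈ₚ (a ∷ p) []      e x = eval-[] (a ∷ p) e x
        eval-≈ₚ (a ∷ p) (b ∷ q) e x = +-cong (ι-cong (e 0)) (*-congˡ (eval-≈ₚ p q (e ∘ suc) x))

    -- If aᵍ = s were rational, x^(gh) - s^h would factor through xᵍ - s. The first factor has the
    -- root a. The cofactor has the root aζ, because ζᵍ ≠ 1. Neither is a unit, against
    -- irreducibility.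
    divisor-power-irrational : ∀ g h → h ℕ.* g ≡ n → 0 ℕ.< g → g ℕ.< n → ¬ Rat (a ^ g)
    divisor-power-irrational g h hg≡n 0<g g<n (s , aᵍ≈s) = impossible (ℚ[x].Irreducible.split-∣1 irreducible factors)
      where
      B = binomial g s
      Q = geometric g s h
      x^n : ∀ x → (x ^ g) ^ h ≈ x ^ n
      x^n x = trans (^-assocʳ x g h) (reflexive (≡.cong (x ^_) (≡.trans (ℕ.*-comm g h) hg≡n)))
      γ≈sʰ : ι γ ≈ ι s ^ h
      γ≈sʰ = trans (sym aⁿ≈γ) (trans (sym (x^n a)) (^-congˡ h aᵍ≈s))
      product-eval : ∀ x → (x ^ g - ι s) * eval Q x ≈ x ^ n - ι γ
      product-eval x = trans (eval-geometric g s h x) (+-cong (x^n x) (-‿cong (sym γ≈sʰ)))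
      factors : binomial n γ ≈ₚ B *ₚ Q
      factors = extensionality (binomial n γ) (B *ₚ Q) λ x → begin
        eval (binomial n γ) x               ≈⟨ eval-binomial n γ x ⟩
        x ^ n - ι γ                         ≈⟨ product-eval x ⟨
        (x ^ g - ι s) * eval Q x            ≈⟨ *-congʳ (eval-binomial g s x) ⟨
        eval B x * eval Q x                 ≈⟨ eval-* B Q x ⟨
        eval (B *ₚ Q) x                     ∎
      aζ = a * ζ
      not-root : aζ ^ g - ι s ≉ 0#
      not-root e = proj₂ prim g 0<g g<n (*-cancelˡ (^-≉0 g a≉0) (begin
        a ^ g * ζ ^ g       ≈⟨ ^-distrib-* a ζ g ⟨
        aζ ^ g              ≈⟨ x-y≈0⇒x≈y e ⟩
        ι s                 ≈⟨ aᵍ≈s ⟨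
        a ^ g               ≈⟨ *-identityʳ _ ⟨
        a ^ g * 1#          ∎))
      Q-root : eval Q aζ ≈ 0#
      Q-root = no-zero-divisors not-root (trans (product-eval aζ) (x≈y⇒x-y≈0
        (trans (^-distrib-* a ζ n) (trans (*-cong aⁿ≈γ ζ^n≈1) (*-identityʳ _)))))
      impossible : ¬ (B ℚ[x].∣ (1ℚ ∷ []) ⊎ Q ℚ[x].∣ (1ℚ ∷ []))
      impossible (inj₁ B∣1) = unit-has-no-root {B} {a} B∣1 (binomial-root g s aᵍ≈s)
      impossible (inj₂ Q∣1) = unit-has-no-root {Q} {aζ} Q∣1 Q-root

    -- The exponents with rational power of a are closed under integer combinations and include n.
    -- With e they include gcd(e, n), a divisor of n below n.
    power-irrational : ∀ e → 0 ℕ.< e → e ℕ.< n → ¬ Rat (a ^ e)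
    power-irrational e 0<e e<n aᵉ∈ = divisor-power-irrational g (n ÷ g) (÷-* (gcd[m,n]∣n e n))
      (ℕ.>-nonZero⁻¹ g) (ℕ.≤-<-trans (ℕ.∣⇒≤ {{ℕ.>-nonZero 0<e}} (gcd[m,n]∣m e n)) e<n) aᵍ∈
      where
      open IsSubring Rat-isSubring
      g = gcd e n
      instance
        g-nonZero : ℕ.NonZero g
        g-nonZero = ℕ.≢-nonZero (gcd[m,n]≢0 e n (inj₂ λ ()))
      aⁿ∈ : Rat (a ^ n)
      aⁿ∈ = γ , aⁿ≈γ
      cancel : ∀ {x y} → x ≉ 0# → Rat x → Rat (y * x) → Rat y
      cancel {x} {y} x≉0 x∈ yx∈ = let u , xu≈1 = inverse x≉0 in
        resp-in (trans (*-assoc y x u) (trans (*-congˡ xu≈1) (*-identityʳ y)))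
          (mul-in yx∈ (inverse-in Rat-isSubring id x∈ xu≈1))
      power : ∀ x e → (a ^ e) ^ x ≈ a ^ (x ℕ.* e)
      power x e = trans (^-assocʳ a e x) (reflexive (≡.cong (a ^_) (ℕ.*-comm e x)))
      from : ∀ {x y u v} → Rat (a ^ u) → Rat (a ^ v) → g ℕ.+ y ℕ.* v ≡ x ℕ.* u → Rat (a ^ g)
      from {x} {y} {u} {v} u∈ v∈ eq = cancel (^-≉0 (y ℕ.* v) a≉0) (resp-in (power y v) (pow-in y v∈))
        (resp-in (trans (power x u) (trans (reflexive (≡.cong (a ^_) (≡.sym eq))) (^-homo-* a g (y ℕ.* v)))) (pow-in x u∈))
      aᵍ∈ : Rat (a ^ g)
      aᵍ∈ with Bézout.identity (gcd-GCD e n)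
      ... | Bézout.+- x y eq = from {x} {y} aᵉ∈ aⁿ∈ eq
      ... | Bézout.-+ x y eq = from {y} {x} aⁿ∈ aᵉ∈ eq

  -- e is invertible modulo q, so z is a power of zᵉ or the inverse of such a power.
  root-from-power : ∀ {p} {D : Pred Carrier p} → IsSubring D → Rat ⊆ D →
                    ∀ {z e q} → z ^ q ≈ 1# → ℕ.Coprime e q → D (z ^ e) → D z
  root-from-power isD Rat⊆D {z} {e} {q} z^q≈1 e⊥q zᵉ∈ with ℕ.coprime-Bézout e⊥q
  ... | Bézout.+- x y 1+yq≡xe = resp-in (begin
      (z ^ e) ^ x               ≈⟨ power e x ⟩
      z ^ (x ℕ.* e)             ≡⟨ ≡.cong (z ^_) 1+yq≡xe ⟨
      z * z ^ (y ℕ.* q)         ≈⟨ *-congˡ (power q y) ⟨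
      z * (z ^ q) ^ y           ≈⟨ *-congˡ (trans (^-congˡ y z^q≈1) (1^ y)) ⟩
      z * 1#                    ≈⟨ *-identityʳ z ⟩
      z                         ∎) (pow-in x zᵉ∈)
    where
    open IsSubring isD
    power : ∀ u v → (z ^ u) ^ v ≈ z ^ (v ℕ.* u)
    power u v = trans (^-assocʳ z u v) (reflexive (≡.cong (z ^_) (ℕ.*-comm u v)))
  ... | Bézout.-+ x y 1+xe≡yq = inverse-in isD Rat⊆D (pow-in x zᵉ∈) (begin
      (z ^ e) ^ x * z           ≈⟨ *-comm _ _ ⟩
      z * (z ^ e) ^ x           ≈⟨ *-congˡ (power e x) ⟩
      z ^ (1 ℕ.+ x ℕ.* e)       ≡⟨ ≡.cong (z ^_) 1+xe≡yq ⟩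
      z ^ (y ℕ.* q)             ≈⟨ power q y ⟨
      (z ^ q) ^ y               ≈⟨ trans (^-congˡ y z^q≈1) (1^ y) ⟩
      1#                        ∎)
    where
    open IsSubring isD
    power : ∀ u v → (z ^ u) ^ v ≈ z ^ (v ℕ.* u)
    power u v = trans (^-assocʳ z u v) (reflexive (≡.cong (z ^_) (ℕ.*-comm u v)))

  -- One prime step of the tower.

  module Steps {m ζ} (prim : IsPrimitiveRootOfUnity (suc m) ζ) (squarefree : Squarefree (suc m))
    {s} {S : Pred Carrier s} (functional : ∀ {t} → ℕ.Coprime t (suc m) → Functional (Conj prim S t))
    where

    open PowersOfPrimitiveRoot prim

    Field : ℕ → Pred Carrier _
    Field R = ℚ⟨ S ∪ (_≈ ζ ^ R) ⟩

    private
      divisor-coprime : ∀ {q N M R} → Prime q → N ℕ.* q ≡ suc m → M ℕ.* R ≡ N → ℕ.Coprime M q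
      divisor-coprime {R = R} q-prime n≡ N≡ (e∣M , e∣q) =
        squarefree q-prime n≡ (≡.subst (_ ℕ.∣_) N≡ (ℕ.∣m⇒∣m*n R e∣M) , e∣q)

    step-spanned : ∀ q N M R → Prime q → N ℕ.* q ≡ suc m → M ℕ.* R ≡ N → ∀ {x} → Field R x →
      ∃[ r ] (∀ (j : Fin (q ℕ.∸ 1)) → Field (q ℕ.* R) (r j)) × x ≈ horner 0# r (ζ ^ N)
    step-spanned zero          N M R q-prime = contradiction q-prime ¬prime[0]
    step-spanned (suc zero)    N M R q-prime = contradiction q-prime ¬prime[1]
    step-spanned (suc (suc d)) N M R q-prime n≡ N≡ =
      PrimeStep.Top-spanned prim d N q-prime n≡ (squarefree q-prime n≡) M R N≡ (divisor-coprime q-prime n≡ N≡)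

    step-independent : ∀ q N M R → Prime q → N ℕ.* q ≡ suc m → M ℕ.* R ≡ N →
      (r : Fin (q ℕ.∸ 1) → Carrier) → (∀ j → Field (q ℕ.* R) (r j)) → horner 0# r (ζ ^ N) ≈ 0# → ∀ j → r j ≈ 0#
    step-independent zero          N M R q-prime = contradiction q-prime ¬prime[0]
    step-independent (suc zero)    N M R q-prime = contradiction q-prime ¬prime[1]
    step-independent (suc (suc d)) N M R q-prime n≡ N≡ r r∈ =
      PrimeStep.vanishing-relation prim d N q-prime n≡ N⊥q functional r
        (λ j → PrimeStep.Base-fixed prim d N q-prime n≡ N⊥q M R N≡ (divisor-coprime q-prime n≡ N≡) (r∈ j))
      where N⊥q = squarefree q-prime n≡

    generator-in : ∀ {N M R} → M ℕ.* R ≡ N → Field R (ζ ^ N)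
    generator-in {N} {M} {R} N≡ = resp
      (trans (^-assocʳ ζ R M) (reflexive (≡.cong (ζ ^_) (≡.trans (ℕ.*-comm R M) N≡))))
      (IsSubring.pow-in ℚ⟨⟩-isSubring M (generator (inj₂ refl)))

    Field-mono : ∀ {q R} → Field (q ℕ.* R) ⊆ Field R
    Field-mono {q} {R} = ℚ⟨⟩-mono λ where
      (inj₁ x∈S) → generator (inj₁ x∈S)
      (inj₂ x≈)  → resp (sym x≈) (generator-in {M = q} ≡.refl)

    -- For q = 2 the root of unity ζ^N = −1 would be rational.
    generator-not-in : ∀ {q N M R} → Prime q → 2 ℕ.< q → N ℕ.* q ≡ suc m → M ℕ.* R ≡ N → ¬ Field (q ℕ.* R) (ζ ^ N)
    generator-not-in {suc (suc (suc d))} {N} {M} {R} q-prime 2<q n≡ N≡ ω∈ =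
      1≉0 (step-independent (suc (suc (suc d))) N M R q-prime n≡ N≡ r r∈ root (suc zero))
      where
      open IsSubring (ℚ⟨⟩-isSubring {S = S ∪ (_≈ ζ ^ (suc (suc (suc d)) ℕ.* R))})
      -- The polynomial X - ζ^N. It fits into q - 1 coefficients because q ≥ 3, and its coefficient
      -- 1 would have to vanish.
      r : Fin (suc (suc d)) → Carrier
      r zero          = - (ζ ^ N)
      r (suc zero)    = 1#
      r (suc (suc j)) = 0#
      r∈ : ∀ j → Field (suc (suc (suc d)) ℕ.* R) (r j)
      r∈ zero          = neg ω∈
      r∈ (suc zero)    = one-in
      r∈ (suc (suc j)) = zero-in
      root : horner 0# r (ζ ^ N) ≈ 0#
      root = trans (+-congˡ (*-congˡ (+-congˡ (trans (*-congˡ (horner-zero {d} (λ _ → refl) (ζ ^ N))) (zeroʳ (ζ ^ N))))))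
        (solve 1 (λ w → :- w :+ w :* (con 1ℤ :+ con 0ℤ) := con 0ℤ) refl (ζ ^ N))
    generator-not-in {suc (suc zero)} q-prime (ℕ.s≤s (ℕ.s≤s ()))
    generator-not-in {suc zero}       q-prime (ℕ.s≤s ())

    -- If q does not divide s, then (ζˢ)^N = (ζ^N)ˢ gives back ζ^N, whose q-th power is 1, against
    -- `generator-not-in`.
    power-in⇒∣ : ∀ {q N M R} → Prime q → 2 ℕ.< q → N ℕ.* q ≡ suc m → M ℕ.* R ≡ N → ∀ s → Field (q ℕ.* R) (ζ ^ s) → q ℕ.∣ s
    power-in⇒∣ {q} {N} {M} {R} q-prime 2<q n≡ N≡ s ζˢ∈ with q ℕ.∣? s
    ... | yes q∣s = q∣s
    ... | no q∤s = contradiction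
      (root-from-power ℚ⟨⟩-isSubring Rat⊆ℚ⟨⟩ {e = s} {q} (trans (^-assocʳ ζ N q) (trans (reflexive (≡.cong (ζ ^_) n≡)) ζ^n≈1))
        (prime-coprime q-prime q∤s)
        (resp (trans (^-assocʳ ζ s N) (trans (reflexive (≡.cong (ζ ^_) (ℕ.*-comm s N))) (sym (^-assocʳ ζ N s))))
          (IsSubring.pow-in ℚ⟨⟩-isSubring N ζˢ∈)))
      (generator-not-in {q} {N} {M} {R} q-prime 2<q n≡ N≡)

  -- Real numbers and complex conjugation.

  module RealAlgebraicNumbers {ρ : Level} (ℝ : RealStructure ρ) where

    open RealStructure ℝ

    real-isSubring : IsSubring Real
    real-isSubring = record
      { one-in  = real-subfield (resp ι-1 (rational 1ℚ))
      ; add-in  = λ x y → real-subfield (add (generator x) (generator y))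
      ; neg-in  = λ x → real-subfield (neg (generator x))
      ; mul-in  = λ x y → real-subfield (mul (generator x) (generator y))
      ; resp-in = λ e x → real-subfield (resp e (generator x))
      }

    private module Real = IsSubring real-isSubring

    positive⇒≉0 : ∀ {x} → Positive x → x ≉ 0#
    positive⇒≉0 x>0 x≈0 = 0-not-positive (positive-resp x≈0 x>0)

    square-positive : ∀ {x} → Real x → x ≉ 0# → Positive (x * x)
    square-positive {x} x∈ x≉0 with trichotomy x∈
    ... | inj₁ x>0        = positive-* x>0 x>0
    ... | inj₂ (inj₁ x≈0) = contradiction x≈0 x≉0
    ... | inj₂ (inj₂ x<0) = positive-resp (solve 1 (λ x → (:- x) :* (:- x) := x :* x) refl x) (positive-* x<0 x<0)

    positive-1 : Positive 1#
    positive-1 = positive-resp (*-identityˡ 1#) (square-positive Real.one-in 1≉0)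

    positive-^ : ∀ {x} m → Positive x → Positive (x ^ m)
    positive-^ zero    x>0 = positive-1
    positive-^ (suc m) x>0 = positive-* x>0 (positive-^ m x>0)

    sum-of-squares : ∀ {u v} → Real u → Real v → u * u + v * v ≈ 0# → u ≈ 0#
    sum-of-squares {u} {v} u∈ v∈ e with u ≟ 0# | v ≟ 0#
    ... | yes u≈0 | _       = u≈0
    ... | no u≉0 | no v≉0 = contradiction e (positive⇒≉0 (positive-+ (square-positive u∈ u≉0) (square-positive v∈ v≉0)))
    ... | no u≉0 | yes v≈0 = contradiction (trans (sym (trans (+-congˡ (trans (*-congʳ v≈0) (zeroˡ v))) (+-identityʳ _))) e)
                                (positive⇒≉0 (square-positive u∈ u≉0))

    -- For x > 0 the cofactor 1 + x + ⋯ + x^m of x - 1 is positive. For x < 0 the odd power would be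
    -- negative.
    real-root-of-unity : ∀ m {x} → (∀ y → (- y) ^ suc m ≈ - (y ^ suc m)) → Real x → x ^ suc m ≈ 1# → x ≈ 1#
    real-root-of-unity m {x} odd x∈ xⁿ≈1 with trichotomy x∈
    ... | inj₁ x>0        = x-y≈0⇒x≈y (no-zero-divisors (positive⇒≉0 (sum>0 m))
                              (trans (*-comm _ _) (trans (geometric-sum m x) (x≈y⇒x-y≈0 xⁿ≈1))))
      where
      sum>0 : ∀ d → Positive (horner {d} 1# (λ _ → 1#) x)
      sum>0 zero    = positive-1
      sum>0 (suc d) = positive-+ positive-1 (positive-* x>0 (sum>0 d))
    ... | inj₂ (inj₁ x≈0) = contradiction (trans (sym xⁿ≈1) (trans (*-congʳ x≈0) (zeroˡ _))) 1≉0
    ... | inj₂ (inj₂ x<0) = contradiction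
      (positive-resp (-‿inverseʳ 1#) (positive-+ positive-1 (positive-resp (trans (odd x) (-‿cong xⁿ≈1)) (positive-^ (suc m) x<0))))
      0-not-positive

    i-free : ∀ {u v} → Real u → Real v → u + v * i ≈ 0# → u ≈ 0# × v ≈ 0#
    i-free {u} {v} u∈ v∈ e = sum-of-squares u∈ v∈ squares , sum-of-squares v∈ u∈ (trans (+-comm _ _) squares)
      where
      squares : u * u + v * v ≈ 0#
      squares = begin
        u * u + v * v ≈⟨ solve 2 (λ u v → u :* u :+ v :* v := u :* u :- v :* v :* (:- con 1ℤ)) refl u v ⟩
        u * u - v * v * (- 1#)                         ≈⟨ +-congˡ (-‿cong (*-congˡ i²≈-1)) ⟨
        u * u - v * v * (i * i) ≈⟨ solve 3 (λ u v i → u :* u :- v :* v :* (i :* i) := (u :+ v :* i) :* (u :- v :* i)) refl u v i ⟩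
        (u + v * i) * (u - v * i)                      ≈⟨ trans (*-congʳ e) (zeroˡ _) ⟩
        0#                                             ∎

    Conjugate : Pred (Carrier × Carrier) _
    Conjugate (x , y) = ∃[ u ] ∃[ v ] Real u × Real v × x ≈ u + v * i × y ≈ u - v * i

    conjugate-isSubring : Horner².IsSubring Conjugate
    conjugate-isSubring = record
      { one-in  = 1# , 0# , Real.one-in , Real.zero-in ,
          solve 1 (λ i → con 1ℤ := con 1ℤ :+ con 0ℤ :* i) refl i ,
          solve 1 (λ i → con 1ℤ := con 1ℤ :- con 0ℤ :* i) refl i
      ; add-in  = λ (u , v , u∈ , v∈ , e , e′) (s , t , s∈ , t∈ , f , f′) →
          u + s , v + t , Real.add-in u∈ s∈ , Real.add-in v∈ t∈ ,
          trans (+-cong e f) (solve 5 (λ u v s t i → u :+ v :* i :+ (s :+ t :* i) := u :+ s :+ (v :+ t) :* i) refl u v s t i) ,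
          trans (+-cong e′ f′) (solve 5 (λ u v s t i → u :- v :* i :+ (s :- t :* i) := u :+ s :- (v :+ t) :* i) refl u v s t i)
      ; neg-in  = λ (u , v , u∈ , v∈ , e , e′) →
          - u , - v , Real.neg-in u∈ , Real.neg-in v∈ ,
          trans (-‿cong e) (solve 3 (λ u v i → :- (u :+ v :* i) := :- u :+ (:- v) :* i) refl u v i) ,
          trans (-‿cong e′) (solve 3 (λ u v i → :- (u :- v :* i) := :- u :- (:- v) :* i) refl u v i)
      ; mul-in  = λ (u , v , u∈ , v∈ , e , e′) (s , t , s∈ , t∈ , f , f′) →
          u * s - v * t , u * t + v * s ,
          Real.sub-in (Real.mul-in u∈ s∈) (Real.mul-in v∈ t∈) , Real.add-in (Real.mul-in u∈ t∈) (Real.mul-in v∈ s∈) ,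
          trans (*-cong e f) (trans (solve 5 (λ u v s t i → (u :+ v :* i) :* (s :+ t :* i) := u :* s :+ v :* t :* (i :* i) :+ (u :* t :+ v :* s) :* i) refl u v s t i)
            (+-congʳ (trans (+-congˡ (*-congˡ i²≈-1)) (solve 4 (λ u v s t → u :* s :+ v :* t :* (:- con 1ℤ) := u :* s :- v :* t) refl u v s t)))) ,
          trans (*-cong e′ f′) (trans (solve 5 (λ u v s t i → (u :- v :* i) :* (s :- t :* i) := u :* s :+ v :* t :* (i :* i) :- (u :* t :+ v :* s) :* i) refl u v s t i)
            (+-congʳ (trans (+-congˡ (*-congˡ i²≈-1)) (solve 4 (λ u v s t → u :* s :+ v :* t :* (:- con 1ℤ) := u :* s :- v :* t) refl u v s t))))
      ; resp-in = λ (e , e′) (u , v , u∈ , v∈ , f , f′) → u , v , u∈ , v∈ , trans (sym e) f , trans (sym e′) f′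
      }

    conjugate-total : ∀ x → ∃[ y ] Conjugate (x , y)
    conjugate-total x with real+imaginary x
    ... | u , v , u∈ , v∈ , e = u - v * i , u , v , u∈ , v∈ , e , refl

    conjugate-sym : ∀ {x y} → Conjugate (x , y) → Conjugate (y , x)
    conjugate-sym (u , v , u∈ , v∈ , e , e′) = u , - v , u∈ , Real.neg-in v∈ ,
      trans e′ (solve 3 (λ u v i → u :- v :* i := u :+ (:- v) :* i) refl u v i) ,
      trans e (solve 3 (λ u v i → u :+ v :* i := u :- (:- v) :* i) refl u v i)

    conjugate-functional : ∀ {x y} → Conjugate (x , y) → x ≈ 0# → y ≈ 0#
    conjugate-functional (u , v , u∈ , v∈ , e , e′) x≈0 =
      let u≈0 , v≈0 = i-free u∈ v∈ (trans (sym e) x≈0) in begin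
      _             ≈⟨ e′ ⟩
      u - v * i     ≈⟨ +-cong u≈0 (-‿cong (*-congʳ v≈0)) ⟩
      0# - 0# * i   ≈⟨ solve 1 (λ i → con 0ℤ :- con 0ℤ :* i := con 0ℤ) refl i ⟩
      0#            ∎

    real⇒conjugate : ∀ {x} → Real x → Conjugate (x , x)
    real⇒conjugate {x} x∈ = x , 0# , x∈ , Real.zero-in ,
      solve 2 (λ x i → x := x :+ con 0ℤ :* i) refl x i , solve 2 (λ x i → x := x :- con 0ℤ :* i) refl x i

    conjugate⇒real : ∀ {x} → Conjugate (x , x) → Real x
    conjugate⇒real {x} (u , v , u∈ , v∈ , e , e′) = Real.resp-in (sym x≈u) u∈
      where
      two : 1# + 1# ≉ 0#
      two = positive⇒≉0 (positive-+ positive-1 positive-1)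
      x≈u : x ≈ u
      x≈u = *-cancelˡ two (begin
        (1# + 1#) * x               ≈⟨ solve 1 (λ x → (con 1ℤ :+ con 1ℤ) :* x := x :+ x) refl x ⟩
        x + x                       ≈⟨ +-cong e e′ ⟩
        u + v * i + (u - v * i) ≈⟨ solve 3 (λ u v i → u :+ v :* i :+ (u :- v :* i) := (con 1ℤ :+ con 1ℤ) :* u) refl u v i ⟩
        (1# + 1#) * u               ∎)


    conjugate-unique : ∀ {x y y′} → Conjugate (x , y) → Conjugate (x , y′) → y ≈ y′
    conjugate-unique xy xy′ = functional⇒unique conjugate-isSubring conjugate-functional xy xy′ refl

    conjugate-^ : ∀ {x y} k → Conjugate (x , y) → Conjugate (x ^ k , y ^ k)
    conjugate-^ {x} {y} k xy = Horner².IsSubring.resp-in conjugate-isSubring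
      (reflexive (^²₁ (x , y) k) , reflexive (^²₂ (x , y) k)) (Horner².IsSubring.pow-in conjugate-isSubring k xy)

    -- The norm z z̄ is real and an n-th root of unity, hence 1, so that z̄ = z⁻¹ = z^m.
    conjugate-root-of-unity : ∀ m {z} → (∀ y → (- y) ^ suc m ≈ - (y ^ suc m)) → z ^ suc m ≈ 1# → Conjugate (z , z ^ m)
    conjugate-root-of-unity m {z} odd zⁿ≈1 = Horner².IsSubring.resp-in conjugate-isSubring (refl , z̄≈) zz̄
      where
      n = suc m
      z̄ = proj₁ (conjugate-total z)
      zz̄ : Conjugate (z , z̄)
      zz̄ = proj₂ (conjugate-total z)
      z̄ⁿ≈1 : z̄ ^ n ≈ 1#
      z̄ⁿ≈1 = functional⇒unique conjugate-isSubring conjugate-functional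
        (conjugate-^ n zz̄) (Horner².IsSubring.one-in conjugate-isSubring) zⁿ≈1
      norm-real : Real (z * z̄)
      norm-real = conjugate⇒real (Horner².IsSubring.resp-in conjugate-isSubring (refl , *-comm z̄ z)
        (Horner².IsSubring.mul-in conjugate-isSubring zz̄ (conjugate-sym zz̄)))
      norm≈1 : z * z̄ ≈ 1#
      norm≈1 = real-root-of-unity m odd norm-real (trans (^-distrib-* z z̄ n) (trans (*-cong zⁿ≈1 z̄ⁿ≈1) (*-identityˡ 1#)))
      z̄≈ : z̄ ≈ z ^ m
      z̄≈ = *-cancelˡ (invertible⇒≉0 norm≈1) (trans norm≈1 (sym zⁿ≈1))

    -- Real radicals in the cyclotomic field.

    module _ {m ζ} (prim : IsPrimitiveRootOfUnity (suc m) ζ)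
      (odd : ∀ x → (- x) ^ suc m ≈ - (x ^ suc m)) (squarefree : Squarefree (suc m)) where

      open PowersOfPrimitiveRoot prim

      private
        n : ℕ
        n = suc m

        Conj₀ : ℕ → Pred (Carrier × Carrier) _
        Conj₀ = Conj prim (∅)

      -- ℚ(ζ) is abelian over ℚ: complex conjugation commutes with conjugations.
      conj-conjugate : ∀ {t x y} → Conj₀ t (x , y) →
        ∃[ x̄ ] ∃[ ȳ ] Conjugate (x , x̄) × Conjugate (y , ȳ) × Conj₀ t (x̄ , ȳ)
      conj-conjugate {t} = Horner².⟪⟫-least isD λ where
          (inj₁ (_ , inj₁ (q , z≈) , x≈ , y≈)) → ι q , ι q , rational-conjugate (trans x≈ z≈) , rational-conjugate (trans y≈ z≈) ,
            conj-fixed prim {t = t} (inj₁ (q , refl))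
          (inj₂ (x≈ , y≈)) → ζ ^ m , (ζ ^ t) ^ m ,
            C.resp-in (sym x≈ , refl) (conjugate-root-of-unity m odd ζ^n≈1) ,
            C.resp-in (sym y≈ , refl) (conjugate-root-of-unity m odd (trans (^-assocʳ ζ t n) (ζ^multiple t))) ,
            conj-ζ^ prim {t = t} m
        where
        module C = Horner².IsSubring conjugate-isSubring
        rational-conjugate : ∀ {q x} → x ≈ ι q → Conjugate (x , ι q)
        rational-conjugate {q} x≈ = C.resp-in (sym x≈ , refl)
          (real⇒conjugate (real-subfield (rational q)))
        D : Pred (Carrier × Carrier) _
        D (x , y) = ∃[ x̄ ] ∃[ ȳ ] Conjugate (x , x̄) × Conjugate (y , ȳ) × Conj₀ t (x̄ , ȳ)
        isD : Horner².IsSubring D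
        isD = record
          { one-in  = 1# , 1# , C.one-in , C.one-in , Conj.one-in prim {t = t}
          ; add-in  = λ (x , y , c , c′ , xy) (u , v , d , d′ , uv) →
              x + u , y + v , C.add-in c d , C.add-in c′ d′ , Conj.add-in prim {t = t} xy uv
          ; neg-in = λ (x , y , c , c′ , xy) → - x , - y , C.neg-in c , C.neg-in c′ , Conj.neg-in prim {t = t} xy
          ; mul-in  = λ (x , y , c , c′ , xy) (u , v , d , d′ , uv) →
              x * u , y * v , C.mul-in c d , C.mul-in c′ d′ , Conj.mul-in prim {t = t} xy uv
          ; resp-in = λ (e , e′) (x , y , c , c′ , xy) → x , y , C.resp-in (e , refl) c , C.resp-in (e′ , refl) c′ , xy
          }

      conj-total : ∀ t → ℚ⟨ ∅ ∪ (_≈ ζ) ⟩ ⊆ (λ x → ∃[ y ] Conj₀ t (x , y))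
      conj-total t = ℚ⟨⟩-least (domain-isSubring Horner².⟪⟫-isSubring) (λ {x} q → x , conj-fixed prim {t = t} (inj₁ q))
        (λ where (inj₂ x≈) → ζ ^ t , Conj.resp-in prim {t = t} (sym x≈ , refl) (conj-ζ prim {t = t}))

      real-radical-fixed : ∀ {α} → Real α → α ≉ 0# → Rat (α ^ n) → ℚ⟨ ∅ ∪ (_≈ ζ) ⟩ α →
                           ∀ {t} → ℕ.Coprime t n → Conj₀ t (α , α)
      real-radical-fixed {α} α∈ α≉0 αⁿ∈ α∈ℚζ {t} t⊥n = Conj.resp-in prim {t = t} (refl , y≈α) αy
        where
        unique : ∀ {x y x′ y′} → Conj₀ t (x , y) → Conj₀ t (x′ , y′) → x ≈ x′ → y ≈ y′
        unique = functional⇒unique Horner².⟪⟫-isSubring (conj-functional prim t⊥n)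
        total = conj-total t α∈ℚζ
        y = proj₁ total
        αy : Conj₀ t (α , y)
        αy = proj₂ total
        bars = conj-conjugate {t} αy
        ȳ = proj₁ (proj₂ bars)
        αᾱ = proj₁ (proj₂ (proj₂ bars))
        yȳ : Conjugate (y , ȳ)
        yȳ = proj₁ (proj₂ (proj₂ (proj₂ bars)))
        ȳ≈y : ȳ ≈ y
        ȳ≈y = unique (proj₂ (proj₂ (proj₂ (proj₂ bars)))) αy (conjugate-unique αᾱ (real⇒conjugate α∈))
        y∈ : Real y
        y∈ = conjugate⇒real (Horner².IsSubring.resp-in conjugate-isSubring (refl , ȳ≈y) yȳ)
        yⁿ≈αⁿ : y ^ n ≈ α ^ n
        yⁿ≈αⁿ = unique (Conj.resp-in prim {t = t} (reflexive (^²₁ (α , y) n) , reflexive (^²₂ (α , y) n)) (Conj.pow-in prim {t = t} n αy))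
                       (conj-fixed prim {t = t} (inj₁ αⁿ∈)) refl
        u = proj₁ (inverse α≉0)
        αu≈1 : α * u ≈ 1#
        αu≈1 = proj₂ (inverse α≉0)
        open IsSubring real-isSubring
        yu≈1 : y * u ≈ 1#
        yu≈1 = real-root-of-unity m odd
          (mul-in y∈ (real-subfield (inv (generator α∈) αu≈1)))
          (trans (^-distrib-* y u n) (trans (*-congʳ yⁿ≈αⁿ) (trans (sym (^-distrib-* α u n)) (trans (^-congˡ n αu≈1) (1^ n)))))
        y≈α : y ≈ α
        y≈α = *-cancelˡ (invertible⇒≉0 (trans (*-comm u α) αu≈1))
          (trans (*-comm u y) (trans yu≈1 (trans (sym αu≈1) (*-comm α u))))

      -- Write α = r₀ + r₁ω + ⋯ with p - 1 coefficients in the smaller field. Since α is fixed too,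
      -- r₀ - α, r₁, ... is a relation for ω to which `vanishing-relation` applies, and α = r₀
      -- follows.
      descend : ∀ d N → Prime (suc (suc d)) → N ℕ.* suc (suc d) ≡ n → ∀ M R → M ℕ.* R ≡ N →
                ∀ {α} → (∀ {t} → ℕ.Coprime t n → Conj₀ t (α , α)) →
                ℚ⟨ ∅ ∪ (_≈ ζ ^ R) ⟩ α → ℚ⟨ ∅ ∪ (_≈ ζ ^ (suc (suc d) ℕ.* R)) ⟩ α
      descend d N p-prime n≡ M R N≡ {α} α-fixed α∈ = resp (sym (x-y≈0⇒x≈y α-r₀≈0)) (r∈ zero)
        where
        N⊥p = squarefree p-prime n≡
        M⊥p : ℕ.Coprime M (suc (suc d))
        M⊥p (e∣M , e∣p) = N⊥p (ℕ.∣-trans e∣M (≡.subst (M ℕ.∣_) N≡ (ℕ.m∣m*n R)) , e∣p)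
        spanned = PrimeStep.Top-spanned prim d N p-prime n≡ N⊥p M R N≡ M⊥p α∈
        r₁ : Fin (suc d) → Carrier
        r₁ = proj₁ spanned
        r∈ = proj₁ (proj₂ spanned)
        α≈ = proj₂ (proj₂ spanned)
        r′ : Fin (suc d) → Carrier
        r′ zero    = - (α - r₁ zero)
        r′ (suc j) = r₁ (suc j)
        fixed : ∀ j → PrimeStep.Fixed prim d N p-prime n≡ N⊥p {S = ∅} (r₁ j)
        fixed j = PrimeStep.Base-fixed prim d N p-prime n≡ N⊥p M R N≡ M⊥p (r∈ j)
        r′-fixed : ∀ j → PrimeStep.Fixed prim d N p-prime n≡ N⊥p {S = ∅} (r′ j)
        r′-fixed zero k t⊥n = Conj.neg-in prim {t = 1 ℕ.+ N ℕ.* k} (Conj.sub-in prim {t = 1 ℕ.+ N ℕ.* k} (α-fixed t⊥n) (fixed zero k t⊥n))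
        r′-fixed (suc j) k t⊥n = fixed (suc j) k t⊥n
        ω′ = ζ ^ N
        root : horner 0# r′ ω′ ≈ 0#
        root = trans (solve 3 (λ α r h → :- (α :- r) :+ h := r :+ h :- α) refl α (r₁ zero) (ω′ * horner 0# (r₁ ∘ suc) ω′))
                     (x≈y⇒x-y≈0 (sym α≈))
        α-r₀≈0 : α - r₁ zero ≈ 0#
        α-r₀≈0 = ⁻¹-injective (trans
          (PrimeStep.vanishing-relation prim d N p-prime n≡ N⊥p (conj-functional prim) r′ r′-fixed root zero) (sym -0#≈0#))

      -- Descending through the prime factors of n raises R from 1 to n, where ζ^R = 1 generates
      -- nothing beyond ℚ.
      fixed⇒rational : ∀ {α} → (∀ {t} → ℕ.Coprime t n → Conj₀ t (α , α)) → ℚ⟨ ∅ ∪ (_≈ ζ) ⟩ α → Rat α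
      fixed⇒rational {α} α-fixed α∈ = along factors 1 factorsPrime
          (≡.trans (≡.cong (ℕ._* 1) (≡.sym isFactorisation)) (ℕ.*-identityʳ n))
          (ℚ⟨⟩-mono (λ where (inj₂ x≈) → generator (inj₂ (trans x≈ (sym (*-identityʳ ζ))))) α∈)
        where
        open PrimeFactorisation (factorise n)
        along : ∀ qs R → All Prime qs → product qs ℕ.* R ≡ n → ℚ⟨ ∅ ∪ (_≈ ζ ^ R) ⟩ α → Rat α
        along [] R _ R≡n α∈ = ℚ⟨⟩-least Rat-isSubring id
          (λ where (inj₂ x≈) → 1ℚ , trans x≈ (trans (reflexive (≡.cong (ζ ^_) (≡.trans (≡.sym (ℕ.*-identityˡ R)) R≡n))) (trans ζ^n≈1 (sym ι-1)))) α∈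
        along (zero ∷ qs)          R (q-prime ∷ _) = contradiction q-prime ¬prime[0]
        along (suc zero ∷ qs)      R (q-prime ∷ _) = contradiction q-prime ¬prime[1]
        along (suc (suc d) ∷ qs)   R (q-prime ∷ primes) eq α∈ =
          along qs (suc (suc d) ℕ.* R) primes (≡.trans (lemma (product qs) (suc (suc d)) R) eq)
            (descend d (product qs ℕ.* R) q-prime (≡.trans (lemma′ (product qs) (suc (suc d)) R) eq) (product qs) R ≡.refl α-fixed α∈)
          where
          lemma : ∀ M p R → M ℕ.* (p ℕ.* R) ≡ p ℕ.* M ℕ.* R
          lemma = ℕ-solve-∀
          lemma′ : ∀ M p R → M ℕ.* R ℕ.* p ≡ p ℕ.* M ℕ.* R
          lemma′ = ℕ-solve-∀

      real-radical⇒rational : ∀ {α} → Real α → α ≉ 0# → Rat (α ^ n) → ℚ⟨ ∅ ∪ (_≈ ζ) ⟩ α → Rat α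
      real-radical⇒rational α∈ α≉0 αⁿ∈ α∈ℚζ = fixed⇒rational (real-radical-fixed α∈ α≉0 αⁿ∈ α∈ℚζ) α∈ℚζ

      module _ {a γ} (a-real : Real a) (a≉0 : a ≉ 0#) (aⁿ≈γ : a ^ n ≈ ι γ)
        (aᵉ-irrational : ∀ e → 0 ℕ.< e → e ℕ.< n → ¬ Rat (a ^ e)) where

        aᵉ∉ℚζ : ∀ e → 0 ℕ.< e → e ℕ.< n → ¬ ℚ⟨ ∅ ∪ (_≈ ζ) ⟩ (a ^ e)
        aᵉ∉ℚζ e 0<e e<n aᵉ∈ = aᵉ-irrational e 0<e e<n (real-radical⇒rational
          (IsSubring.pow-in real-isSubring e a-real) (^-≉0 e a≉0)
          (IsSubring.resp-in Rat-isSubring (begin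
            ι γ ^ e            ≈⟨ ^-congˡ e aⁿ≈γ ⟨
            (a ^ n) ^ e        ≈⟨ ^-assocʳ a n e ⟩
            a ^ (n ℕ.* e)      ≡⟨ ≡.cong (a ^_) (ℕ.*-comm n e) ⟩
            a ^ (e ℕ.* n)      ≈⟨ ^-assocʳ a e n ⟨
            (a ^ e) ^ n        ∎) (IsSubring.pow-in Rat-isSubring e (γ , refl)))
          aᵉ∈)

        independent-over-ℚζ : (c : Fin n → Carrier) → (∀ j → ℚ⟨ ∅ ∪ (_≈ ζ) ⟩ (c j)) → horner 0# c a ≈ 0# → ∀ j → c j ≈ 0#
        independent-over-ℚζ = powers-independent ℚ⟨⟩-isSubring Rat⊆ℚ⟨⟩ odd a≉0 aⁿ≈γ
          (rational γ) prim (generator (inj₂ refl)) aᵉ∉ℚζ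

        -- Reduction modulo xⁿ - γ turns a pair into two polynomials in a with corresponding
        -- coefficients from ℚ(ζ). If x ≈ 0, independence over ℚ(ζ) kills the first coefficients,
        -- and the conjugation of ℚ(ζ) then kills the second.
        conj-functional-a : ∀ {t} → ℕ.Coprime t n → Functional (Conj prim (_≈ a) t)
        conj-functional-a {t} t⊥n {x} {y} xy x≈0 = trans y≈ (horner-zero c′≈0 a)
          where
          pure∈ : ∀ j → Conj₀ t (pure m (ι γ) j , pure m (ι γ) j)
          pure∈ zero    = Conj.neg-in prim {t = t} (conj-fixed prim {t = t} (inj₁ (γ , refl)))
          pure∈ (suc j) = conj-fixed prim {t = t} (inj₁ (IsSubring.zero-in Rat-isSubring))
          xy′ : Horner².⟪ Conj₀ t ∪ (Q̄²._≈ (a , a)) ⟫ (x , y)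
          xy′ = Horner².⟪⟫-least Horner².⟪⟫-isSubring (λ where
            (inj₁ (_ , inj₁ q , x≈ , y≈)) → Horner².gen (inj₁ (Horner².gen (inj₁ (_ , inj₁ q , x≈ , y≈))))
            (inj₁ (_ , inj₂ z≈ , x≈ , y≈)) → Horner².gen (inj₂ (trans x≈ z≈ , trans y≈ z≈))
            (inj₂ e)                       → Horner².gen (inj₁ (Horner².gen (inj₂ e)))) xy
          root : horner 1# (pure m (ι γ)) a ≈ 0#
          root = pure-root m aⁿ≈γ
          reduced = reduce² Horner².⟪⟫-isSubring (pure m (ι γ)) (pure m (ι γ)) pure∈ root root xy′
          c c′ : Fin n → Carrier
          c  = proj₁ reduced
          c′ = proj₁ (proj₂ reduced)
          cc′ : ∀ j → Conj₀ t (c j , c′ j)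
          cc′ = proj₁ (proj₂ (proj₂ reduced))
          y≈ : y ≈ horner 0# c′ a
          y≈ = proj₂ (proj₂ (proj₂ (proj₂ reduced)))
          c≈0 : ∀ j → c j ≈ 0#
          c≈0 = independent-over-ℚζ c (λ j → conj-domain prim {t = t} (cc′ j))
            (trans (sym (proj₁ (proj₂ (proj₂ (proj₂ reduced))))) x≈0)
          c′≈0 : ∀ j → c′ j ≈ 0#
          c′≈0 j = conj-functional prim t⊥n (cc′ j) (c≈0 j)

    horner-substitute : ∀ {d} (r : Fin d → Carrier) x z → horner 0# r (x * z) ≈ horner 0# (λ j → r j * z ^ toℕ j) x
    horner-substitute {zero}  r x z = refl
    horner-substitute {suc d} r x z = +-cong (sym (*-identityʳ _)) (begin
      x * z * horner 0# (r ∘ suc) (x * z) ≈⟨ *-congˡ (horner-substitute (r ∘ suc) x z) ⟩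
      x * z * horner 0# r′ x                                     ≈⟨ *-assoc _ _ _ ⟩
      x * (z * horner 0# r′ x)                                   ≈⟨ *-congˡ (horner₀-* z r′ x) ⟨
      x * horner 0# (λ j → z * r′ j) x ≈⟨ *-congˡ (horner-cong {c = λ j → z * r′ j} refl
                                                                      (λ j → solve 3 (λ z r p → z :* (r :* p) := r :* (z :* p)) refl z (r (suc j)) (z ^ toℕ j)) refl) ⟩
      x * horner 0# (λ j → r (suc j) * z ^ toℕ (suc j)) x        ∎)
      where
      r′ : Fin d → Carrier
      r′ j = r (suc j) * z ^ toℕ j

    -- Roots of the binomial and the fields they generate.

    module Root {m ζ} (prim : IsPrimitiveRootOfUnity (suc m) ζ)
      (odd : ∀ x → (- x) ^ suc m ≈ - (x ^ suc m)) (squarefree : Squarefree (suc m))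
      {a γ} (a-positive : Positive a) (aⁿ≈γ : a ^ suc m ≈ ι γ)
      (irreducible : ℚ[x].Irreducible (ℚ[x].binomial (suc m) γ)) where

      open PowersOfPrimitiveRoot prim

      private
        n : ℕ
        n = suc m

      a≉0 : a ≉ 0#
      a≉0 = positive⇒≉0 a-positive

      private
        irrational : ∀ e → 0 ℕ.< e → e ℕ.< n → ¬ Rat (a ^ e)
        irrational = power-irrational prim a≉0 aⁿ≈γ irreducible

      functional : ∀ {t} → ℕ.Coprime t n → Functional (Conj prim (_≈ a) t)
      functional = conj-functional-a prim odd squarefree (positive⇒real a-positive) a≉0 aⁿ≈γ irrational

      is-root : ∀ s → (a * ζ ^ s) ^ n ≈ ι γ
      is-root s = begin
        (a * ζ ^ s) ^ n       ≈⟨ ^-distrib-* a (ζ ^ s) n ⟩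
        a ^ n * (ζ ^ s) ^ n   ≈⟨ *-cong aⁿ≈γ (trans (^-assocʳ ζ s n) (ζ^multiple s)) ⟩
        ι γ * 1#              ≈⟨ *-identityʳ _ ⟩
        ι γ                   ∎

      ratio-root-of-unity : ∀ {x y u} → x ^ n ≈ ι γ → y ^ n ≈ ι γ → x * u ≈ 1# → (y * u) ^ n ≈ 1#
      ratio-root-of-unity {x} {y} {u} xⁿ yⁿ xu≈1 = begin
        (y * u) ^ n           ≈⟨ ^-distrib-* y u n ⟩
        y ^ n * u ^ n         ≈⟨ *-congʳ (trans yⁿ (sym xⁿ)) ⟩
        x ^ n * u ^ n         ≈⟨ ^-distrib-* x u n ⟨
        (x * u) ^ n           ≈⟨ ^-congˡ n xu≈1 ⟩
        1# ^ n                ≈⟨ 1^ n ⟩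
        1#                    ∎

      root-form : ∀ {y} → y ^ n ≈ ι γ → ∃[ s ] s ℕ.< n × y ≈ a * ζ ^ s
      root-form {y} yⁿ =
        let u , au≈1 = inverse a≉0
            s , s<n , yu≈ζˢ = root-of-unity (ratio-root-of-unity aⁿ≈γ yⁿ au≈1)
        in s , s<n , (begin
          y                ≈⟨ *-identityʳ y ⟨
          y * 1#           ≈⟨ *-congˡ au≈1 ⟨
          y * (a * u)      ≈⟨ solve 3 (λ y a u → y :* (a :* u) := a :* (y :* u)) refl y a u ⟩
          a * (y * u)      ≈⟨ *-congˡ yu≈ζˢ ⟩
          a * ζ ^ s        ∎)

      -- A rational relation for aζˢ is a relation for a over ℚ(ζ), with coefficients rⱼ ζ^(sj).
      root-independent : ∀ s (r : Fin n → Carrier) → (∀ j → Rat (r j)) → horner 0# r (a * ζ ^ s) ≈ 0# → ∀ j → r j ≈ 0#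
      root-independent s r r∈ e j = no-zero-divisors (^-≉0 (toℕ j) (^-≉0 s ζ≉0)) (trans (*-comm _ _)
        (independent-over-ℚζ prim odd squarefree (positive⇒real a-positive) a≉0 aⁿ≈γ irrational
          (λ j → r j * (ζ ^ s) ^ toℕ j)
          (λ j → mul (Rat⊆ℚ⟨⟩ (r∈ j)) (pow-in (toℕ j) (pow-in s (generator (inj₂ refl)))))
          (trans (sym (horner-substitute r a (ζ ^ s))) e) j))
        where open IsSubring (ℚ⟨⟩-isSubring {S = ∅ ∪ (_≈ ζ)})

      a-independent : (r : Fin n → Carrier) → (∀ j → Rat (r j)) → horner 0# r a ≈ 0# → ∀ j → r j ≈ 0#
      a-independent r r∈ e = root-independent 0 r r∈ (trans (horner-cong {c = r} refl (λ _ → refl) (*-identityʳ a)) e)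

      a-minimal : IsMinimalPolynomial (ℚ[x].binomial n γ) a
      a-minimal = binomial-minimal m γ aⁿ≈γ a-independent

      private
        pure∈ : ∀ j → Rat (pure m (ι γ) j)
        pure∈ zero    = IsSubring.neg-in Rat-isSubring (γ , refl)
        pure∈ (suc j) = IsSubring.zero-in Rat-isSubring

      degree-root : ∀ s → HasDegree ℚ⟨ _≈ (a * ζ ^ s) ⟩ n
      degree-root s = ≡.subst (HasDegree ℚ⟨ _≈ b ⟩) (ℕ.*-identityˡ n)
        (degree-extension Rat-isSubring id Rat-degree b
          (λ y∈ j → mul (Rat⊆ℚ⟨⟩ y∈) (IsSubring.pow-in ℚ⟨⟩-isSubring (toℕ j) (generator refl)))
          (λ y∈ → MonicExtension.reduce Rat-isSubring (pure m (ι γ)) pure∈ b (pure-root m (is-root s))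
            (ℚ⟨⟩-least ⟪⟫-isSubring (gen ∘ inj₁) (gen ∘ inj₂) y∈))
          (root-independent s))
        where b = a * ζ ^ s

      -- ℚ(aζˢ) is isomorphic to the real field ℚ(a), in which 1 is the only n-th
      -- root of unity.
      only-root : ∀ s {y} → y ^ n ≈ ι γ → ℚ⟨ _≈ (a * ζ ^ s) ⟩ y → y ≈ a * ζ ^ s
      only-root s {y} yⁿ y∈ = begin
        y                ≈⟨ *-identityʳ y ⟨
        y * 1#           ≈⟨ *-congˡ bu≈1 ⟨
        y * (b * u)      ≈⟨ solve 3 (λ y b u → y :* (b :* u) := y :* u :* b) refl y b u ⟩
        y * u * b        ≈⟨ *-congʳ z≈1 ⟩
        1# * b           ≈⟨ *-identityˡ b ⟩
        b                ∎
        where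
        b = a * ζ ^ s
        b≉0 : b ≉ 0#
        b≉0 = *-≉0 a≉0 (^-≉0 s ζ≉0)
        u = proj₁ (inverse b≉0)
        bu≈1 : b * u ≈ 1#
        bu≈1 = proj₂ (inverse b≉0)
        -- The graph of the isomorphism ℚ(aζˢ) → ℚ(a). It is single-valued in both directions
        -- because both generators satisfy xⁿ = γ and have independent powers over ℚ.
        G : Pred (Carrier × Carrier) _
        G = Horner².⟪ Diagonal Rat ∪ (Q̄²._≈ (b , a)) ⟫
        module G = Horner².IsSubring (Horner².⟪⟫-isSubring {S = Diagonal Rat ∪ (Q̄²._≈ (b , a))})
        reduced : ∀ {x x′} → G (x , x′) → ∃[ r ] ∃[ r′ ] (∀ (j : Fin n) → Diagonal Rat (r j , r′ j)) ×
                  x ≈ horner 0# r b × x′ ≈ horner 0# r′ a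
        reduced = reduce² (diagonal-isSubring Rat-isSubring) (pure m (ι γ)) (pure m (ι γ))
          (λ j → _ , pure∈ j , refl , refl) (pure-root m (is-root s)) (pure-root m aⁿ≈γ)
        G-functional : Functional G
        G-functional {x} {x′} xx′ x≈0 =
          let r , r′ , rr′ , x≈ , x′≈ = reduced xx′
              r≈0 = root-independent s r (λ j → let z , z∈ , e , _ = rr′ j in IsSubring.resp-in Rat-isSubring (sym e) z∈)
                (trans (sym x≈) x≈0)
          in trans x′≈ (horner-zero {c = r′} (λ j → let z , z∈ , e , e′ = rr′ j in trans e′ (trans (sym e) (r≈0 j))) a)
        G-injective : ∀ {x x′} → G (x , x′) → x′ ≈ 0# → x ≈ 0#
        G-injective {x} {x′} xx′ x′≈0 =
          let r , r′ , rr′ , x≈ , x′≈ = reduced xx′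
              r′≈0 = a-independent r′ (λ j → let z , z∈ , _ , e′ = rr′ j in IsSubring.resp-in Rat-isSubring (sym e′) z∈)
                (trans (sym x′≈) x′≈0)
          in trans x≈ (horner-zero {c = r} (λ j → let z , z∈ , e , e′ = rr′ j in trans e (trans (sym e′) (r′≈0 j))) b)
        total : ℚ⟨ _≈ b ⟩ ⊆ (λ x → ∃[ x′ ] G (x , x′))
        total = ℚ⟨⟩-least (domain-isSubring Horner².⟪⟫-isSubring) (λ {x} q → x , Horner².gen (inj₁ (x , q , refl , refl)))
          (λ x≈b → a , Horner².gen (inj₂ (x≈b , refl)))
        G-real : G ⊆ (λ xx′ → Real (proj₂ xx′))
        G-real = Horner².⟪⟫-least isD λ where
            (inj₁ (z , (q , z≈) , _ , e′)) → resp-in (sym (trans e′ z≈)) (real-subfield (rational q))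
            (inj₂ (_ , e′))                → resp-in (sym e′) (positive⇒real a-positive)
          where
          open IsSubring real-isSubring
          isD : Horner².IsSubring (λ xx′ → Real (proj₂ xx′))
          isD = record
            { one-in = one-in ; add-in = add-in ; neg-in = neg-in ; mul-in = mul-in ; resp-in = λ (_ , e′) → resp-in e′ }
        z = y * u
        zⁿ≈1 : z ^ n ≈ 1#
        zⁿ≈1 = ratio-root-of-unity (is-root s) yⁿ bu≈1
        z∈ : ℚ⟨ _≈ b ⟩ z
        z∈ = mul y∈ (inv (generator refl) bu≈1)
        z′ = proj₁ (total z∈)
        zz′ : G (z , z′)
        zz′ = proj₂ (total z∈)
        z′ⁿ≈1 : z′ ^ n ≈ 1#
        z′ⁿ≈1 = functional⇒unique Horner².⟪⟫-isSubring G-functional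
          (G.resp-in (reflexive (^²₁ (z , z′) n) , reflexive (^²₂ (z , z′) n)) (G.pow-in n zz′)) G.one-in zⁿ≈1
        z′≈1 : z′ ≈ 1#
        z′≈1 = real-root-of-unity m odd (G-real zz′) z′ⁿ≈1
        z≈1 : z ≈ 1#
        z≈1 = x-y≈0⇒x≈y (G-injective (G.sub-in zz′ G.one-in) (x≈y⇒x-y≈0 z′≈1))

    ∈-take-tabulate⁺ : ∀ {k} (f : Fin k → Carrier) {i} j → toℕ j ℕ.< i → f j ∈ List.take i (List.tabulate f)
    ∈-take-tabulate⁺ f {suc i} zero    _   = here refl
    ∈-take-tabulate⁺ f {suc i} (suc j) j<i = there (∈-take-tabulate⁺ (f ∘ suc) j (ℕ.s<s⁻¹ j<i))

    ∈-take-tabulate⁻ : ∀ {k} (f : Fin k → Carrier) i {x} → x ∈ List.take i (List.tabulate f) → ∃[ j ] toℕ j ℕ.< i × x ≈ f j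
    ∈-take-tabulate⁻ {suc k} f (suc i) (here x≈)  = zero , ℕ.s≤s ℕ.z≤n , x≈
    ∈-take-tabulate⁻ {suc k} f (suc i) (there x∈) =
      let j , j<i , x≈ = ∈-take-tabulate⁻ (f ∘ suc) i x∈ in suc j , ℕ.s≤s j<i , x≈

    ℚ⦅_,_⦆≐ : ∀ x y → ℚ⦅ x ∷ y ∷ [] ⦆ ≐ ℚ⟨ (_≈ x) ∪ (_≈ y) ⟩
    ℚ⦅ x , y ⦆≐ =
      ℚ⟨⟩-mono (λ where
        (here z≈x)         → generator (inj₁ z≈x)
        (there (here z≈y)) → generator (inj₂ z≈y)) ,
      ℚ⟨⟩-mono (λ where
        (inj₁ z≈x) → generator (here z≈x)
        (inj₂ z≈y) → generator (there (here z≈y)))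

    -- The index function f is general and known only pointwise because `applyUpTo` recurses by
    -- composing it with `suc`.
    strict-steps : ∀ (G : ℕ → Pred Carrier (κ ⊔ ℓ₁)) s l f → (∀ j → f j ≡ suc s ℕ.+ j) →
                   (∀ i → i ℕ.< s ℕ.+ l → G i ⊂ G (suc i)) →
                   StrictSteps (G s) (List.map G (List.applyUpTo f l)) (List.map G (List.applyUpTo f l))
    strict-steps G s zero    f f≡ G⊂ = []
    strict-steps G s (suc l) f f≡ G⊂ = ≡.subst
      (λ i → StrictSteps (G s) (G i ∷ rest) (G i ∷ rest)) (≡.trans (≡.cong suc (≡.sym (ℕ.+-identityʳ s))) (≡.sym (f≡ 0)))
      (strict (G⊂ s (ℕ.m<m+n s (ℕ.s≤s ℕ.z≤n)))
        (strict-steps G (suc s) l (f ∘ suc) (λ j → ≡.trans (f≡ (suc j)) (≡.cong suc (ℕ.+-suc s j)))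
          (λ i i< → G⊂ i (≡.subst (i ℕ.<_) (≡.sym (ℕ.+-suc s l)) i<))))
      where rest = List.map G (List.applyUpTo (f ∘ suc) l)

    degrees-pointwise : ∀ (G : ℕ → Pred Carrier (κ ⊔ ℓ₁)) l (f g : ℕ → ℕ) → (∀ j → j ℕ.< l → HasDegree (G (f j)) (g j)) →
                        Pointwise HasDegree (List.map G (List.applyUpTo f l)) (List.applyUpTo g l)
    degrees-pointwise G zero    f g d = []
    degrees-pointwise G (suc l) f g d = d 0 (ℕ.s≤s ℕ.z≤n) ∷ degrees-pointwise G l (f ∘ suc) (g ∘ suc) (λ j j<l → d (suc j) (ℕ.s≤s j<l))

    -- The cluster tower.

    module ClusterTower
      {k : ℕ} (2<k : 2 ℕ.< k) (p : Fin k → ℕ) (p-injective : Injective _≡_ _≡_ p)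
      (p-prime : ∀ j → Prime (p j)) (p-odd : ∀ j → ¬ 2 ℕ.∣ p j)
      {ζ : Carrier} (prim : IsPrimitiveRootOfUnity (prefixProduct p k) ζ)
      {γ : ℚ} (irreducible : ℚ[x].Irreducible (ℚ[x].binomial (prefixProduct p k) γ))
      {a : Carrier} (a-root : IsRoot (ℚ[x].binomial (prefixProduct p k) γ) a)
      (a-positive : Positive a)
      where

      open PrefixProducts p

      -- The preceding theory takes exponents of the form `suc m`, whereas n = p₁⋯p_k is a successor
      -- only propositionally; primed names are the transported hypotheses.
      n m : ℕ
      n = P k
      m = ℕ.pred n

      instance
        n-nonZero : ℕ.NonZero n
        n-nonZero = P-nonZero p-injective p-prime ℕ.≤-refl

      n≡ : suc m ≡ n
      n≡ = ℕ.suc-pred n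

      n-odd : ¬ 2 ℕ.∣ n
      n-odd 2∣n = let j , 2≡pⱼ = ∈.∈-tabulate⁻ (factorisationHasAllPrimeFactors prime[2] (≡.subst (2 ℕ.∣_) P-all 2∣n) (All.tabulate⁺ p-prime))
                  in p-odd j (ℕ.∣-reflexive 2≡pⱼ)

      2<p : ∀ j → 2 ℕ.< p j
      2<p j = ℕ.≤∧≢⇒< (prime≥2 (p-prime j)) λ 2≡p → p-odd j (ℕ.∣-reflexive 2≡p)
        where
        prime≥2 : ∀ {q} → Prime q → 2 ℕ.≤ q
        prime≥2 {zero}        q-prime = contradiction q-prime ¬prime[0]
        prime≥2 {suc zero}    q-prime = contradiction q-prime ¬prime[1]
        prime≥2 {suc (suc q)} _       = ℕ.s≤s (ℕ.s≤s ℕ.z≤n)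

      prim′ : IsPrimitiveRootOfUnity (suc m) ζ
      prim′ = ≡.subst (λ n → IsPrimitiveRootOfUnity n ζ) (≡.sym n≡) prim

      squarefree : Squarefree n
      squarefree = P-squarefree p-injective p-prime

      squarefree′ : Squarefree (suc m)
      squarefree′ {q} {N} q-prime Nq≡ = squarefree q-prime (≡.trans Nq≡ n≡)

      odd : ∀ x → (- x) ^ suc m ≈ - (x ^ suc m)
      odd = odd-power (suc m) (n-odd ∘ ≡.subst (2 ℕ.∣_) n≡)

      f : ℚ[x].Poly
      f = ℚ[x].binomial n γ

      root⇒ : ∀ {x} → IsRoot f x → x ^ suc m ≈ ι γ
      root⇒ root = trans (reflexive (≡.cong (_ ^_) n≡)) (root-binomial n γ root)

      ⇒root : ∀ {x} → x ^ suc m ≈ ι γ → IsRoot f x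
      ⇒root e = binomial-root n γ (trans (reflexive (≡.cong (_ ^_) (≡.sym n≡))) e)

      open PowersOfPrimitiveRoot prim
      open Root prim′ odd squarefree′ a-positive (root⇒ a-root)
        (≡.subst (λ n → ℚ[x].Irreducible (ℚ[x].binomial n γ)) (≡.sym n≡) irreducible)
      open Steps prim′ squarefree′ functional

      R : ℕ → ℕ
      R i = n ÷ P i

      R*P : ∀ {i} → i ℕ.≤ k → R i ℕ.* P i ≡ n
      R*P i≤k = ÷-* (P∣P i≤k) {{P-nonZero p-injective p-prime i≤k}}

      N : Fin k → ℕ
      N j = n ÷ p j

      N*p : ∀ j → N j ℕ.* p j ≡ n
      N*p j = ÷-* (ℕ.∣-trans (≡.subst (p j ℕ.∣_) (≡.sym (P-suc j)) (ℕ.n∣m*n (P (toℕ j)))) (P∣P (Fin.toℕ<n j)))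
        {{prime⇒nonZero (p-prime j)}}

      N*p′ : ∀ j → N j ℕ.* p j ≡ suc m
      N*p′ j = ≡.trans (N*p j) (≡.sym n≡)

      P*R : ∀ j → P (toℕ j) ℕ.* R (suc (toℕ j)) ≡ N j
      P*R j = ℕ.*-cancelʳ-≡ _ _ (p j) {{prime⇒nonZero (p-prime j)}}
        (≡.trans (rearrange (P (toℕ j)) (R (suc (toℕ j))) (p j))
          (≡.trans (≡.cong (R (suc (toℕ j)) ℕ.*_) (≡.sym (P-suc j))) (≡.trans (R*P (Fin.toℕ<n j)) (≡.sym (N*p j)))))
        where
        rearrange : ∀ x y z → x ℕ.* y ℕ.* z ≡ y ℕ.* (x ℕ.* z)
        rearrange = ℕ-solve-∀

      R-suc : ∀ j → R (toℕ j) ≡ p j ℕ.* R (suc (toℕ j))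
      R-suc j = ℕ.*-cancelʳ-≡ _ _ (P (toℕ j)) {{P-nonZero p-injective p-prime j≤k}}
        (≡.trans (R*P j≤k) (≡.trans (≡.sym (N*p j)) (≡.trans (≡.cong (ℕ._* p j) (≡.sym (P*R j)))
          (rearrange (P (toℕ j)) (R (suc (toℕ j))) (p j)))))
        where
        j≤k = ℕ.<⇒≤ (Fin.toℕ<n j)
        rearrange : ∀ x y z → x ℕ.* y ℕ.* z ≡ z ℕ.* y ℕ.* x
        rearrange = ℕ-solve-∀

      at : ∀ {ℓ} (Q : ℕ → Set ℓ) → (∀ (j : Fin k) → Q (toℕ j)) → ∀ i → i ℕ.< k → Q i
      at Q q i i<k = ≡.subst Q (Fin.toℕ-fromℕ< i<k) (q (Fin.fromℕ< i<k))

      -- E i = ℚ(a, ζ^{n/(p₁⋯pᵢ)})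
      E : ℕ → Pred Carrier _
      E i = Field (R i)

      below : ∀ j {x} → E (toℕ j) x → Field (p j ℕ.* R (suc (toℕ j))) x
      below j {x} = ≡.subst (λ R → Field R x) (R-suc j)

      above : ∀ j {x} → Field (p j ℕ.* R (suc (toℕ j))) x → E (toℕ j) x
      above j {x} = ≡.subst (λ R → Field R x) (≡.sym (R-suc j))

      E-suc : ∀ j → E (toℕ j) ⊆ E (suc (toℕ j))
      E-suc j = Field-mono {q = p j} ∘ below j

      E-mono : ∀ {i l} → i ℕ.≤′ l → l ℕ.≤ k → E i ⊆ E l
      E-mono ℕ.≤′-refl                 l≤k = id
      E-mono (ℕ.≤′-step {n = l} i≤′l) l<k = at (λ l → E l ⊆ E (suc l)) E-suc l l<k ∘ E-mono i≤′l (ℕ.<⇒≤ l<k)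

      ω : Fin k → Carrier
      ω j = ζ ^ N j

      ω^p≈1 : ∀ j → ω j ^ p j ≈ 1#
      ω^p≈1 j = trans (^-assocʳ ζ (N j) (p j)) (trans (reflexive (≡.cong (ζ ^_) (N*p j))) ζ^n≈1)

      ω≉1 : ∀ j → ω j ≉ 1#
      ω≉1 j ω≈1 = ℕ.>⇒∤ {{N-nonZero}} N<n (ζ^≈1⇒∣ (N j) ω≈1)
        where
        N-nonZero : ℕ.NonZero (N j)
        N-nonZero = ℕ.m*n≢0⇒m≢0 (N j) {{≡.subst ℕ.NonZero (≡.sym (N*p j)) n-nonZero}}
        N<n : N j ℕ.< n
        N<n = ≡.subst (N j ℕ.<_) (N*p j) (ℕ.m<m*n (N j) (p j) {{N-nonZero}} (ℕ.<-trans (ℕ.n<1+n 1) (2<p j)))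

      a∈E : ∀ i → E i a
      a∈E i = generator (inj₁ refl)

      ω∈E : ∀ j {i} → toℕ j ℕ.< i → i ℕ.≤ k → E i (ω j)
      ω∈E j j<i i≤k = E-mono (ℕ.≤⇒≤′ j<i) i≤k (generator-in {M = P (toℕ j)} (P*R j))

      E-generated : ∀ j {x} → E (suc (toℕ j)) x →
        ∃[ r ] (∀ (l : Fin (p j ℕ.∸ 1)) → E (toℕ j) (r l)) × x ≈ horner 0# r (ω j)
      E-generated j x∈ =
        let r , r∈ , x≈ = step-spanned (p j) (N j) (P (toℕ j)) (R (suc (toℕ j))) (p-prime j) (N*p′ j) (P*R j) x∈
        in r , above j ∘ r∈ , x≈

      -- Descending induction on i, measured by d = k - i, from R k = 1. The larger field gives R
      -- (i+1) ∣ s, and `power-in⇒∣` gives the prime that distinguishes R i from R (i+1); the two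
      -- are coprime.
      ζ^∈E⇒∣ : ∀ s d i → i ℕ.+ d ≡ k → E i (ζ ^ s) → R i ℕ.∣ s
      ζ^∈E⇒∣ s zero    i i≡k _  = ≡.subst (ℕ._∣ s) (≡.sym Rᵢ≡1) (ℕ.1∣ s)
        where
        i≡k′ = ≡.trans (≡.sym (ℕ.+-identityʳ i)) i≡k
        Rᵢ≡1 : R i ≡ 1
        Rᵢ≡1 = ℕ.*-cancelʳ-≡ (R i) 1 n (≡.trans (≡.cong (λ l → R i ℕ.* P l) (≡.sym i≡k′))
          (≡.trans (R*P (ℕ.≤-reflexive i≡k′)) (≡.sym (ℕ.*-identityˡ n))))
      ζ^∈E⇒∣ s (suc d) i eq ζˢ∈ =
        at (λ i → E i (ζ ^ s) → R (suc i) ℕ.∣ s → R i ℕ.∣ s) divides-step i i<k ζˢ∈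
          (ζ^∈E⇒∣ s d (suc i) (≡.trans (≡.sym (ℕ.+-suc i d)) eq) (at (λ l → E l ⊆ E (suc l)) E-suc i i<k ζˢ∈))
        where
        i<k : i ℕ.< k
        i<k = ≡.subst (i ℕ.<_) eq (ℕ.m<m+n i (ℕ.s≤s ℕ.z≤n))
        divides-step : ∀ j → E (toℕ j) (ζ ^ s) → R (suc (toℕ j)) ℕ.∣ s → R (toℕ j) ℕ.∣ s
        divides-step j ζˢ∈ (ℕ.divides u s≡) = ≡.subst₂ ℕ._∣_ (≡.sym (R-suc j)) (≡.sym s≡) (ℕ.*-monoˡ-∣ (R (suc (toℕ j))) p∣u)
          where
          p∣s : p j ℕ.∣ s
          p∣s = power-in⇒∣ {M = P (toℕ j)} (p-prime j) (2<p j) (N*p′ j) (P*R j) s (below j ζˢ∈)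
          p⊥R : ℕ.Coprime (p j) (R (suc (toℕ j)))
          p⊥R (e∣p , e∣R) = squarefree (p-prime j) (N*p j)
            (≡.subst (_ ℕ.∣_) (P*R j) (ℕ.∣n⇒∣m*n (P (toℕ j)) e∣R) , e∣p)
          p∣u : p j ℕ.∣ u
          p∣u = ℕ.coprime-divisor p⊥R (≡.subst (p j ℕ.∣_) (≡.trans s≡ (ℕ.*-comm u _)) p∣s)

      -- The start E 0 is ℚ(a), since R 0 = n and ζⁿ = 1. Each step multiplies the degree by pⱼ - 1,
      -- as passing from P j to P (j+1) does to φ.
      E-degree : ∀ i → i ℕ.≤ k → HasDegree (E i) (n ℕ.* φ (P i))
      E-degree zero    _   = ≡.subst (HasDegree (E 0)) (≡.trans n≡ (≡.sym (ℕ.*-identityʳ n)))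
        (degree-≐ (⊆E₀ , E₀⊆) (degree-root 0))
        where
        ζ^R₀≈1 : ζ ^ R 0 ≈ 1#
        ζ^R₀≈1 = trans (reflexive (≡.cong (ζ ^_) (≡.trans (≡.sym (ℕ.*-identityʳ (R 0))) (R*P ℕ.z≤n)))) ζ^n≈1
        ⊆E₀ : ℚ⟨ _≈ (a * ζ ^ 0) ⟩ ⊆ E 0
        ⊆E₀ = ℚ⟨⟩-mono λ x≈ → resp (sym (trans x≈ (*-identityʳ a))) (a∈E 0)
        E₀⊆ : E 0 ⊆ ℚ⟨ _≈ (a * ζ ^ 0) ⟩
        E₀⊆ = ℚ⟨⟩-mono λ where
          (inj₁ x≈a) → generator (trans x≈a (sym (*-identityʳ a)))
          (inj₂ x≈ζ) → resp (sym (trans x≈ζ ζ^R₀≈1)) (IsSubring.one-in ℚ⟨⟩-isSubring)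
      E-degree (suc i) i<k = at (λ i → HasDegree (E i) (n ℕ.* φ (P i)) → HasDegree (E (suc i)) (n ℕ.* φ (P (suc i))))
        extend i i<k (E-degree i (ℕ.<⇒≤ i<k))
        where
        extend : ∀ j → HasDegree (E (toℕ j)) (n ℕ.* φ (P (toℕ j))) → HasDegree (E (suc (toℕ j))) (n ℕ.* φ (P (suc (toℕ j))))
        extend j degree = ≡.subst (HasDegree (E (suc (toℕ j)))) degree≡
          (degree-extension ℚ⟨⟩-isSubring Rat⊆ℚ⟨⟩ degree (ω j)
            (λ y∈ l → mul (E-suc j y∈) (IsSubring.pow-in ℚ⟨⟩-isSubring (toℕ l) (ω∈E j ℕ.≤-refl (Fin.toℕ<n j))))
            (E-generated j)
            (λ r r∈ → step-independent (p j) (N j) (P (toℕ j)) (R (suc (toℕ j))) (p-prime j) (N*p′ j) (P*R j) r (below j ∘ r∈)))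
          where
          P⊥p : ℕ.Coprime (P (toℕ j)) (p j)
          P⊥p (e∣P , e∣p) = squarefree (p-prime j) (N*p j) (≡.subst (_ ℕ.∣_) (P*R j) (ℕ.∣m⇒∣m*n (R (suc (toℕ j))) e∣P) , e∣p)
          degree≡ : n ℕ.* φ (P (toℕ j)) ℕ.* (p j ℕ.∸ 1) ≡ n ℕ.* φ (P (suc (toℕ j)))
          degree≡ = ≡.trans (ℕ.*-assoc n (φ (P (toℕ j))) (p j ℕ.∸ 1)) (≡.cong (n ℕ.*_)
            (≡.trans (≡.sym (φ-*-prime (P (toℕ j)) (p-prime j) P⊥p)) (≡.cong φ (≡.sym (P-suc j)))))

      b : Fin k → Carrier
      b j = a * ω j

      β : List Carrier
      β = List.tabulate b

      L : ℕ → Pred Carrier _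
      L i = ℚ⦅ List.take i β ⦆

      b∈L : ∀ j {i} → toℕ j ℕ.< i → L i (b j)
      b∈L j j<i = generator (∈-take-tabulate⁺ b j j<i)

      L⊆ : ∀ i {q} {S : Pred Carrier q} → (∀ j → toℕ j ℕ.< i → ℚ⟨ S ⟩ (b j)) → L i ⊆ ℚ⟨ S ⟩
      L⊆ i b∈ = ℚ⟨⟩-mono λ x∈ → let j , j<i , x≈ = ∈-take-tabulate⁻ b i x∈ in resp (sym x≈) (b∈ j j<i)

      L⊆E : ∀ {i} → i ℕ.≤ k → L i ⊆ E i
      L⊆E {i} i≤k = L⊆ i λ j j<i → mul (a∈E i) (ω∈E j j<i i≤k)

      L-suc : ∀ i → L i ⊆ L (suc i)
      L-suc i = L⊆ i λ j j<i → b∈L j (ℕ.m<n⇒m<1+n j<i)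

      private
        0<k : 0 ℕ.< k
        0<k = ℕ.<-trans (ℕ.s≤s ℕ.z≤n) 2<k
        1<k : 1 ℕ.< k
        1<k = ℕ.<-trans (ℕ.n<1+n 1) 2<k

      0F 1F : Fin k
      0F = Fin.fromℕ< 0<k
      1F = Fin.fromℕ< 1<k

      unit : ∀ j → ∃[ u ] ω j * u ≈ 1#
      unit j = inverse (^-≉0 (N j) ζ≉0)

      L-cancel-ω : ∀ {i} j → L i (b j) → L i (ω j) → L i a
      L-cancel-ω j b∈ ω∈ = let u , ωu≈1 = unit j in
        resp (trans (*-assoc a (ω j) u) (trans (*-congˡ ωu≈1) (*-identityʳ a))) (mul b∈ (inv ω∈ ωu≈1))

      -- ω₀ᵖ = (b₀/b₁)ᵖ for p = p₁, and p₁ is prime to the order p₀ of ω₀.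
      a∈L : ∀ {i} → 2 ℕ.≤ i → L i a
      a∈L {i} 2≤i = L-cancel-ω 0F b₀∈ (root-from-power ℚ⟨⟩-isSubring Rat⊆ℚ⟨⟩ {e = p 1F} {p 0F} (ω^p≈1 0F) p₁⊥p₀
          (resp tᵖ≈ (IsSubring.pow-in ℚ⟨⟩-isSubring (p 1F) (mul b₀∈ (inv b₁∈ b₁u≈1)))))
        where
        b₀∈ : L i (b 0F)
        b₀∈ = b∈L 0F (≡.subst (ℕ._< i) (≡.sym (Fin.toℕ-fromℕ< 0<k)) (ℕ.<-≤-trans (ℕ.s≤s ℕ.z≤n) 2≤i))
        b₁∈ : L i (b 1F)
        b₁∈ = b∈L 1F (≡.subst (ℕ._< i) (≡.sym (Fin.toℕ-fromℕ< 1<k)) 2≤i)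
        p₁⊥p₀ : ℕ.Coprime (p 1F) (p 0F)
        p₁⊥p₀ = prime-coprime (p-prime 0F) p₀∤p₁
          where
          0F≢1F : ¬ 0F ≡ 1F
          0F≢1F e = contradiction (≡.trans (≡.sym (Fin.toℕ-fromℕ< 0<k)) (≡.trans (≡.cong toℕ e) (Fin.toℕ-fromℕ< 1<k))) λ ()
          p₀∤p₁ : ¬ p 0F ℕ.∣ p 1F
          p₀∤p₁ p₀∣p₁ with prime⇒irreducible (p-prime 1F) p₀∣p₁
          ... | inj₁ p₀≡1  = ¬prime[1] (≡.subst Prime p₀≡1 (p-prime 0F))
          ... | inj₂ p₀≡p₁ = 0F≢1F (p-injective p₀≡p₁)
        a⁻¹ = proj₁ (inverse a≉0)
        v = proj₁ (unit 1F)
        u = a⁻¹ * v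
        b₁u≈1 : b 1F * u ≈ 1#
        b₁u≈1 = begin
          a * ω 1F * (a⁻¹ * v) ≈⟨ solve 4 (λ a w i v → a :* w :* (i :* v) := a :* i :* (w :* v)) refl a (ω 1F) a⁻¹ v ⟩
          a * a⁻¹ * (ω 1F * v)        ≈⟨ *-cong (proj₂ (inverse a≉0)) (proj₂ (unit 1F)) ⟩
          1# * 1#                     ≈⟨ *-identityˡ 1# ⟩
          1#                          ∎
        q = p 1F
        tᵖ≈ : (b 0F * u) ^ q ≈ ω 0F ^ q
        tᵖ≈ = begin
          (a * ω 0F * (a⁻¹ * v)) ^ q ≈⟨ ^-congˡ q (solve 4 (λ a w i v → a :* w :* (i :* v) := a :* i :* (w :* v)) refl a (ω 0F) a⁻¹ v) ⟩
          (a * a⁻¹ * (ω 0F * v)) ^ q ≈⟨ ^-congˡ q (trans (*-congʳ (proj₂ (inverse a≉0))) (*-identityˡ _)) ⟩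
          (ω 0F * v) ^ q                  ≈⟨ ^-distrib-* (ω 0F) v q ⟩
          ω 0F ^ q * v ^ q ≈⟨ *-congˡ (trans (trans (sym (*-identityˡ _)) (*-congʳ (sym (ω^p≈1 1F)))) (sym (^-distrib-* (ω 1F) v q))) ⟩
          ω 0F ^ q * (ω 1F * v) ^ q       ≈⟨ *-congˡ (trans (^-congˡ q (proj₂ (unit 1F))) (1^ q)) ⟩
          ω 0F ^ q * 1#                   ≈⟨ *-identityʳ _ ⟩
          ω 0F ^ q                        ∎

      -- Once a lies in L i, so does each ωⱼ = bⱼ/a with j < i, and these build E i from ℚ(a) one
      -- step at a time.
      E⊆L : ∀ {i} → 2 ℕ.≤ i → i ℕ.≤ k → E i ⊆ L i
      E⊆L {i} 2≤i i≤k = contained i ℕ.≤-refl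
        where
        open IsSubring (ℚ⟨⟩-isSubring {S = _∈ List.take i β})
        ω∈ : ∀ j → toℕ j ℕ.< i → L i (ω j)
        ω∈ j j<i = let u , au≈1 = inverse a≉0 in
          resp (trans (solve 3 (λ a w u → a :* w :* u := a :* u :* w) refl a (ω j) u) (trans (*-congʳ au≈1) (*-identityˡ _)))
            (mul (b∈L j j<i) (inv (a∈L 2≤i) au≈1))
        contained : ∀ l → l ℕ.≤ i → E l ⊆ L i
        contained zero    _   = ℚ⟨⟩-mono λ where
          (inj₁ x≈a) → resp (sym x≈a) (a∈L 2≤i)
          (inj₂ x≈ζ) → resp (sym (trans x≈ζ (trans (reflexive (≡.cong (ζ ^_)
            (≡.trans (≡.sym (ℕ.*-identityʳ (R 0))) (R*P ℕ.z≤n)))) ζ^n≈1))) one-in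
        contained (suc l) l<i = at (λ l → l ℕ.< i → E l ⊆ L i → E (suc l) ⊆ L i) step l (ℕ.<-≤-trans l<i i≤k) l<i (contained l (ℕ.<⇒≤ l<i))
          where
          step : ∀ j → toℕ j ℕ.< i → E (toℕ j) ⊆ L i → E (suc (toℕ j)) ⊆ L i
          step j j<i E⊆ x∈ = let r , r∈ , x≈ = E-generated j x∈ in
            resp (sym x≈) (horner-in zero-in (λ l → E⊆ (r∈ l)) (ω∈ j j<i))

      L₁⊆ : L 1 ⊆ ℚ⟨ _≈ b 0F ⟩
      L₁⊆ = L⊆ 1 λ j j<1 → generator (reflexive (≡.cong b (Fin.toℕ-injective
        (≡.trans (ℕ.n<1⇒n≡0 j<1) (≡.sym (Fin.toℕ-fromℕ< 0<k))))))

      0F<1 : toℕ 0F ℕ.< 1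
      0F<1 = ≡.subst (ℕ._< 1) (≡.sym (Fin.toℕ-fromℕ< 0<k)) (ℕ.n<1+n 0)

      a≉b : ∀ j → a ≉ b j
      a≉b j a≈b = ω≉1 j (*-cancelˡ a≉0 (trans (sym a≈b) (sym (*-identityʳ a))))

      -- Three different reasons. A rational b₀ would be a second root in ℚ(a). L 2 contains the
      -- root a, whereas b₀ is the only root in L 1. From there on L agrees with E, where
      -- `generator-not-in` applies.
      L-strict : ∀ i → i ℕ.< k → L i ⊂ L (suc i)
      L-strict zero          i<k = L-suc 0 , λ L₁⊆L₀ → a≉b 0F (sym
        (trans (only-root 0 (is-root (N 0F)) (ℚ⟨⟩-mono (λ ()) (L₁⊆L₀ (b∈L 0F 0F<1)))) (*-identityʳ a)))
      L-strict (suc zero)    i<k = L-suc 1 , λ L₂⊆L₁ → a≉b 0F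
        (only-root (N 0F) (root⇒ a-root) (L₁⊆ (L₂⊆L₁ (a∈L ℕ.≤-refl))))
      L-strict (suc (suc i)) i<k = L-suc _ , λ L⊆L → at (λ l → ¬ (E (suc l) ⊆ E l))
        (λ j E⊆E → generator-not-in {M = P (toℕ j)} (p-prime j) (2<p j) (N*p′ j) (P*R j)
          (below j (E⊆E (ω∈E j ℕ.≤-refl (Fin.toℕ<n j)))))
        (suc (suc i)) i<k (L⊆E (ℕ.<⇒≤ i<k) ∘ L⊆L ∘ E⊆L (ℕ.s≤s (ℕ.s≤s ℕ.z≤n)) i<k)

      b-root : ∀ j → IsRoot f (b j)
      b-root j = ⇒root (is-root (N j))

      splitting-field : SplittingField f ≐ ℚ⦅ a ∷ ζ ∷ [] ⦆
      splitting-field =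
        ℚ⟨⟩-mono (λ y-root → let s , _ , y≈ = root-form (root⇒ y-root) in
          resp (sym y≈) (mul (generator (here refl)) (IsSubring.pow-in ℚ⟨⟩-isSubring s (generator (there (here refl)))))) ,
        ℚ⟨⟩-mono (λ where
          (here x≈a)         → resp (sym x≈a) (generator a-root)
          (there (here x≈ζ)) → let u , au≈1 = inverse a≉0 in
            resp (trans (solve 3 (λ a z u → a :* (z :* con 1ℤ) :* u := a :* u :* z) refl a ζ u)
                   (trans (*-congʳ au≈1) (trans (*-identityˡ ζ) (sym x≈ζ))))
              (mul (generator (⇒root (is-root 1))) (inv (generator a-root) au≈1)))

      minimal-polynomial : IsMinimalPolynomial f a
      minimal-polynomial = ≡.subst (λ n → IsMinimalPolynomial (ℚ[x].binomial n γ) a) n≡ a-minimal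

      L-fields : ∀ i → 2 ℕ.≤ i → i ℕ.≤ k → L i ≐ ℚ⦅ a ∷ ζ ^ R i ∷ [] ⦆
      L-fields i 2≤i i≤k = proj₂ ℚ⦅ a , ζ ^ R i ⦆≐ ∘ L⊆E i≤k , E⊆L 2≤i i≤k ∘ proj₁ ℚ⦅ a , ζ ^ R i ⦆≐

      R-k : R k ≡ 1
      R-k = ℕ.*-cancelʳ-≡ (R k) 1 n (≡.trans (R*P ℕ.≤-refl) (≡.sym (ℕ.*-identityˡ n)))

      β-splitting : ℚ⟨ _∈ β ⟩ ≐ SplittingField f
      β-splitting =
        ℚ⟨⟩-mono (λ x∈ → let j , _ , x≈ = ∈-take-tabulate⁻ b k (≡.subst (_ ∈_) (≡.sym take-all) x∈) in
          resp (sym x≈) (generator (b-root j))) ,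
        λ x∈ → ≡.subst (λ xs → ℚ⦅ xs ⦆ _) take-all (E⊆L (ℕ.<⇒≤ 2<k) ℕ.≤-refl (ℚ⟨⟩-mono (λ where
          (here x≈a)         → generator (inj₁ x≈a)
          (there (here x≈ζ)) → generator (inj₂ (trans x≈ζ (sym (trans (reflexive (≡.cong (ζ ^_) R-k)) (*-identityʳ ζ))))))
          (proj₁ splitting-field x∈)))
        where
        take-all : List.take k β ≡ β
        take-all = List.take-all k β (ℕ.≤-reflexive (List.length-tabulate b))

      minimal-generating : IsMinimalGeneratingSet f (_∈ β)
      minimal-generating = (λ x∈ → let j , x≈ = ∈β⁻ x∈ in ⇒root (trans (^-congˡ (suc m) x≈) (is-root (N j)))) , β-splitting ,
          λ A A-resp (A⊆β , β⊈A) (_ , split⊆) → all-in (λ j ∉A → omit A A-resp A⊆β j ∉A split⊆)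
            (λ in-A → β⊈A λ x∈ → let j , x≈ = ∈β⁻ x∈ in A-resp (sym x≈) (in-A j))
        where
        ∈β⁻ : ∀ {x} → x ∈ β → ∃[ j ] x ≈ b j
        ∈β⁻ x∈ = let j , _ , x≈ = ∈-take-tabulate⁻ b k (≡.subst (_ ∈_) (≡.sym (List.take-all k β (ℕ.≤-reflexive (List.length-tabulate b)))) x∈) in j , x≈
        -- Membership in A is undecidable. The goal is a negation, so it is enough that no bⱼ can be
        -- missing, and double negation commutes with a finite conjunction.
        all-in : ∀ {k q} {Q : Fin k → Set q} → (∀ j → ¬ ¬ Q j) → ¬ ¬ (∀ j → Q j)
        all-in {zero}  q ¬all = ¬all λ ()
        all-in {suc k} q ¬all = q zero λ q₀ → all-in (q ∘ suc) λ qs → ¬all λ where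
          zero    → q₀
          (suc j) → qs j
        other-prime-divides : ∀ j l → ¬ l ≡ j → p j ℕ.∣ N l
        other-prime-divides j l l≢j = cases (euclidsLemma (N l) (p l) (p-prime j) (≡.subst (p j ℕ.∣_) (≡.trans (N*p j) (≡.sym (N*p l))) (ℕ.n∣m*n (N j))))
          where
          p∤p : ¬ p j ℕ.∣ p l
          p∤p p∣p with prime⇒irreducible (p-prime l) p∣p
          ... | inj₁ p≡1 = ¬prime[1] (≡.subst Prime p≡1 (p-prime j))
          ... | inj₂ p≡p = l≢j (p-injective (≡.sym p≡p))
          cases : p j ℕ.∣ N l ⊎ p j ℕ.∣ p l → p j ℕ.∣ N l
          cases (inj₁ p∣N) = p∣N
          cases (inj₂ p∣p) = contradiction p∣p p∤p
        -- Without b j the others generate a subfield of ℚ(a, ζ^{pⱼ}).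
        omit : (A : Pred Carrier _) → A Respects _≈_ → A ⊆ (_∈ β) → ∀ j → ¬ A (b j) → ¬ (SplittingField f ⊆ ℚ⟨ A ⟩)
        omit A A-resp A⊆β j bⱼ∉A split⊆ =
          generator-not-in {M = N j} (p-prime j) (2<p j) (N*p′ j) (ℕ.*-identityʳ (N j))
            (IsSubring.pow-in ℚ⟨⟩-isSubring (N j) (ℚ⟨⟩-mono A⊆ (split⊆ (proj₂ splitting-field (generator (there (here refl)))))))
          where
          A⊆ : A ⊆ Field (p j ℕ.* 1)
          A⊆ x∈A with ∈β⁻ (A⊆β x∈A)
          ... | l , x≈ = resp (sym x≈) (mul (generator (inj₁ refl)) ωₗ∈)
            where
            l≢j : ¬ l ≡ j
            l≢j ≡.refl = bⱼ∉A (A-resp x≈ x∈A)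
            p∣N : p j ℕ.∣ N l
            p∣N = other-prime-divides j l l≢j
            ωₗ∈ : Field (p j ℕ.* 1) (ω l)
            ωₗ∈ with p∣N
            ... | ℕ.divides u N≡ = generator-in {M = u} (≡.trans (≡.cong (u ℕ.*_) (ℕ.*-identityʳ (p j))) (≡.sym N≡))

      private
        steps : StrictSteps ℚ⦅ [] ⦆ (clusterTower β) (List.map L (List.applyUpTo suc k))
        steps = ≡.subst (λ l → StrictSteps ℚ⦅ [] ⦆ (List.map L (List.upTo (suc l))) (List.map L (List.applyUpTo suc k)))
          (≡.sym (List.length-tabulate b))
          -- `clusterTower` begins with ℚ itself, which is dropped as equal to its predecessor.
          (equal (id , id) (strict-steps L 0 k suc (λ _ → ≡.refl) L-strict))

      tower-length : HasLength β k
      tower-length = _ , steps , ≡.trans (List.length-map L (List.applyUpTo suc k)) (List.length-applyUpTo suc k)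

      -- The first entry is n and not n φ(p₁), because L 1 is generated by a single root and omits
      -- ζ^(n/p₁). From L 2 on the fields are the E i.
      tower-degrees : HasDegreeSequence β (n ∷ List.applyUpTo (λ j → n ℕ.* φ (P (2 ℕ.+ j))) (k ℕ.∸ 1))
      tower-degrees = _ , steps , ≡.subst
        (λ l → Pointwise HasDegree (List.map L (List.applyUpTo suc l)) (n ∷ List.applyUpTo (λ j → n ℕ.* φ (P (2 ℕ.+ j))) (k ℕ.∸ 1)))
        (ℕ.m+[n∸m]≡n 0<k)
        (first ∷ degrees-pointwise L (k ℕ.∸ 1) (λ j → 2 ℕ.+ j) (λ j → n ℕ.* φ (P (2 ℕ.+ j))) rest)
        where
        first : HasDegree (L 1) n
        first = ≡.subst (HasDegree (L 1)) n≡ (degree-≐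
          (ℚ⟨⟩-mono (λ x≈ → resp (sym x≈) (b∈L 0F 0F<1)) , L₁⊆) (degree-root (N 0F)))
        rest : ∀ j → j ℕ.< k ℕ.∸ 1 → HasDegree (L (2 ℕ.+ j)) (n ℕ.* φ (P (2 ℕ.+ j)))
        rest j j<k-1 = degree-≐ (E⊆L 2≤ 2+j≤k , L⊆E 2+j≤k) (E-degree (2 ℕ.+ j) 2+j≤k)
          where
          2≤ : 2 ℕ.≤ 2 ℕ.+ j
          2≤ = ℕ.s≤s (ℕ.s≤s ℕ.z≤n)
          2+j≤k : 2 ℕ.+ j ℕ.≤ k
          2+j≤k = ≡.subst (2 ℕ.+ j ℕ.≤_) (ℕ.m+[n∸m]≡n 0<k) (ℕ.s≤s j<k-1)

      ζ^∈L⇒∣ : ∀ {i s} → 2 ℕ.≤ i → i ℕ.≤ k → L i (a * ζ ^ s) → R i ℕ.∣ s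
      ζ^∈L⇒∣ {i} {s} 2≤i i≤k aζˢ∈ = ζ^∈E⇒∣ s (k ℕ.∸ i) i (ℕ.m+[n∸m]≡n i≤k) (resp cancel-a (mul (L⊆E i≤k aζˢ∈) (inv (a∈E i) au≈1)))
        where
        u = proj₁ (inverse a≉0)
        au≈1 : a * u ≈ 1#
        au≈1 = proj₂ (inverse a≉0)
        cancel-a : a * ζ ^ s * u ≈ ζ ^ s
        cancel-a = begin
          a * ζ ^ s * u      ≈⟨ solve 3 (λ a z u → a :* z :* u := a :* u :* z) refl a (ζ ^ s) u ⟩
          a * u * ζ ^ s      ≈⟨ *-congʳ au≈1 ⟩
          1# * ζ ^ s         ≈⟨ *-identityˡ _ ⟩
          ζ ^ s              ∎

      module RootsInL {i} (2≤i : 2 ℕ.≤ i) (i≤k : i ℕ.≤ k) where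

        instance
          R-nonZero : ℕ.NonZero (R i)
          R-nonZero = ℕ.m*n≢0⇒m≢0 (R i) {{≡.subst ℕ.NonZero (≡.sym (R*P i≤k)) n-nonZero}}

        -- A root aζˢ lies in L i exactly when R i divides s, and n = R i · P i leaves P i such
        -- exponents below n.
        element : Fin (P i) → Carrier
        element l = a * ζ ^ (R i ℕ.* toℕ l)

        bound : ∀ (l : Fin (P i)) → R i ℕ.* toℕ l ℕ.< n
        bound l = ≡.subst (R i ℕ.* toℕ l ℕ.<_) (R*P i≤k) (ℕ.*-monoʳ-< (R i) (Fin.toℕ<n l))

        distinct : ∀ {l l′} → element l ≈ element l′ → l ≡ l′
        distinct {l} {l′} e = Fin.toℕ-injective (ℕ.*-cancelˡ-≡ (toℕ l) (toℕ l′) (R i)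
          (ζ^-injective (bound l) (bound l′) (*-cancelˡ a≉0 e)))

        element-in : ∀ l → L i (element l)
        element-in l = E⊆L 2≤i i≤k (mul (a∈E i) (generator-in {M = toℕ l} (ℕ.*-comm (toℕ l) (R i))))

        index : ∀ {s} → s ℕ.< n → R i ℕ.∣ s → ∃[ l ] a * ζ ^ s ≈ element l
        index {s} s<n (ℕ.divides q s≡) =
          Fin.fromℕ< q<P , *-congˡ (reflexive (≡.cong (ζ ^_) (≡.trans s≡Rq (≡.cong (R i ℕ.*_) (≡.sym (Fin.toℕ-fromℕ< q<P))))))
          where
          s≡Rq : s ≡ R i ℕ.* q
          s≡Rq = ≡.trans s≡ (ℕ.*-comm q (R i))
          q<P : q ℕ.< P i
          q<P = ℕ.*-cancelˡ-< (R i) q (P i) (≡.subst₂ ℕ._<_ s≡Rq (≡.sym (R*P i≤k)) s<n)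

        complete : ∀ {y} → IsRoot f y → L i y → ∃[ l ] y ≈ element l
        complete {y} y-root y∈ = proj₁ found , trans y≈ (proj₂ found)
          where
          form = root-form (root⇒ y-root)
          s = proj₁ form
          y≈ : y ≈ a * ζ ^ s
          y≈ = proj₂ (proj₂ form)
          found : ∃[ l ] a * ζ ^ s ≈ element l
          found = index (≡.subst (s ℕ.<_) n≡ (proj₁ (proj₂ form))) (ζ^∈L⇒∣ 2≤i i≤k (resp y≈ y∈))

      roots-in-L : ∀ i → 2 ℕ.≤ i → i ℕ.≤ k → ρ[ L i , a ]≡ P i
      roots-in-L i 2≤i i≤k = f , minimal-polynomial , record
        { element    = element
        ; element-in = λ l → ⇒root (is-root (R i ℕ.* toℕ l)) , element-in l
        ; distinct   = distinct
        ; complete   = λ (y-root , y∈) → complete y-root y∈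
        }
        where open RootsInL 2≤i i≤k

      roots-in-L₁ : ρ[ L 1 , a ]≡ 1
      roots-in-L₁ = f , minimal-polynomial , record
        { element    = λ _ → b 0F
        ; element-in = λ _ → b-root 0F , b∈L 0F 0F<1
        ; distinct   = λ { {zero} {zero} _ → ≡.refl }
        ; complete   = λ (y-root , y∈) → zero , only-root (N 0F) (root⇒ y-root) (L₁⊆ y∈)
        }

open import Data.List.Base using (applyUpTo; take; tabulate)
open import Data.Nat.Base using (_+_; _*_; _∸_; _<_; _≤_)
open import Data.Nat.Divisibility using (_∣_)
open import Data.Rational.Base using () renaming (_<_ to _<ℚ_)

proposition2p10 :
    {c₀ ℓ₁ ℓ₂ r : Level} (Q̄ : AlgebraicClosureOfℚ c₀ ℓ₁ ℓ₂) →
    let module K = Subfields Q̄ in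
    let open Subfields Q̄ using (ℚ⦅_⦆) using (ρ[_,_]≡_) using (_^_) using (_∈_) in
    (ℝ : K.RealStructure r) →
    (k : ℕ) → 2 < k →
    (p : Fin k → ℕ) → Injective _≡_ _≡_ p → (∀ j → Prime (p j)) → (∀ j → ¬ 2 ∣ p j) →
    let P = prefixProduct p
        n = P k in
    (ζ : K.Carrier) → K.IsPrimitiveRootOfUnity n ζ →
    (c : ℚ) → 0ℚ <ℚ c →
    let f = ℚ[x].binomial n c in
    ℚ[x].Irreducible f →
    (a : K.Carrier) → K.IsRoot f a → K.RealStructure.Positive ℝ a →
    let β = tabulate (λ j → a K.* ζ ^ (n ÷ p j))
        L = λ i → ℚ⦅ take i β ⦆ in
    K.SplittingField f ≐ ℚ⦅ a ∷ ζ ∷ [] ⦆ ×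
    K.IsMinimalGeneratingSet f (_∈ β) ×
    K.HasLength β k ×
    (∀ i → 2 ≤ i → i ≤ k → L i ≐ ℚ⦅ a ∷ ζ ^ (n ÷ P i) ∷ [] ⦆) ×
    K.HasDegreeSequence β (n ∷ applyUpTo (λ j → n * φ (P (2 + j))) (k ∸ 1)) ×
    (∀ i → 2 ≤ i → i ≤ k → ρ[ L i , a ]≡ P i) ×
    ρ[ L 1 , a ]≡ 1
proposition2p10 Q̄ ℝ k 2<k p p-injective p-prime p-odd ζ prim c 0<c irreducible a a-root a-positive =
  splitting-field , minimal-generating , tower-length , L-fields , tower-degrees , roots-in-L , roots-in-L₁
  where open AlgebraicNumbers.RealAlgebraicNumbers.ClusterTower Q̄ ℝ 2<k p p-injective p-prime p-odd prim irreducible a-root a-positive
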